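{- Assume the $ABC$ conjecture. Then there is a positive integer $C_1$ such that $M(d)\le C_1$ for every positive integer $d$. Moreover, $M(d)\le 9$ for every sufficiently large positive integer $d$.
   Context: A pair $(a,b)\in\mathbb{Z}^2$ is multiplicatively dependent if $ab\neq 0$ and there is $(k_1,k_2)\in\mathbb{Z}^2\setminus\{(0,0)\}$ with $a^{k_1}b^{k_2}=1$. For $d\in\mathbb{Z}$, $\mathcal{M}(d)$ is the set of multiplicatively dependent pairs $(a,b)\in\mathbb{Z}^2$ with $ab\ne0$ and $b-a=d$, and $M(d)=|\mathcal{M}(d)|$. The $ABC$ conjecture: for every real $\varepsilon>0$ there is a constant $K_\varepsilon$ such that for all non-zero integers $A,B,C$ with $A+B=C$ and $\gcd(A,B)=1$ one has $\max\{|A|,|B|,|C|\}\le K_\varepsilon\big(\prod_{p\mid ABC}p\big)^{1+\varepsilon}$, the product over the distinct primes dividing $ABC$. -}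

module Defs where

open import Data.Nat as ℕ using (ℕ; zero; suc; _⊔_)
open import Data.Nat.Primality using (prime?)
open import Data.Nat.Divisibility using (_∣?_)
open import Data.Integer as ℤ using (ℤ; +_; -[1+_]; ∣_∣)
open import Data.Integer.GCD as ℤG using ()
open import Data.Rational as ℚ using (ℚ; 0ℚ; 1ℚ; 1/_; ≢-nonZero)
open import Data.Rational.Properties using (_≟_)
open import Data.List using (List; filter; upTo; length)
open import Data.Nat.ListAction using (product)
open import Data.List.Relation.Unary.All using (All)
open import Data.List.Relation.Unary.Unique.Propositional using (Unique)
open import Data.Product using (_×_; _,_; Σ; ∃; ∃-syntax)
open import Relation.Nullary using (¬_; yes; no)
open import Relation.Nullary.Decidable using (_×-dec_)
open import Relation.Binary.PropositionalEquality using (_≡_; _≢_)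

-- radical of a natural number: product of the distinct primes dividing it
-- (primes dividing n > 0 are ≤ n, so ranging over 0..n suffices)
rad : ℕ → ℕ
rad n = product (filter (λ p → prime? p ×-dec (p ∣? n)) (upTo (suc n)))

-- The ABC conjecture.  A real ε > 0 is replaced by a rational ε = p/q with
-- p, q ≥ 1 (equivalent, since the bound is monotone in ε and rad ≥ 1), and a
-- real constant K_ε by a natural number (equivalent by taking the ceiling).
-- max ≤ K · rad^(1 + p/q)  ⇔  max^q ≤ K^q · rad^(q + p).
ABC : Set
ABC = (p q : ℕ) → 1 ℕ.≤ p → 1 ℕ.≤ q →
      ∃[ K ] ((A B C : ℤ) → A ≢ ℤ.0ℤ → B ≢ ℤ.0ℤ → C ≢ ℤ.0ℤ →
              A ℤ.+ B ≡ C → ℤG.gcd A B ≡ ℤ.1ℤ →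
              ((∣ A ∣ ⊔ ∣ B ∣ ⊔ ∣ C ∣) ℕ.^ q)
                ℕ.≤ (K ℕ.^ q) ℕ.* (rad ∣ A ℤ.* B ℤ.* C ∣ ℕ.^ (q ℕ.+ p)))

-- inverse in ℚ (value at 0 is irrelevant: only used for non-zero bases)
qinv : ℚ → ℚ
qinv q with q ≟ 0ℚ
... | yes _ = 0ℚ
... | no q≢0 = 1/_ q {{≢-nonZero q≢0}}

qpow : ℚ → ℕ → ℚ
qpow q zero = 1ℚ
qpow q (suc n) = q ℚ.* qpow q n

zpow : ℤ → ℤ → ℚ
zpow a (+ n) = qpow (a ℚ./ 1) n
zpow a -[1+ n ] = qinv (qpow (a ℚ./ 1) (suc n))

MultDep : ℤ → ℤ → Set
MultDep a b = a ℤ.* b ≢ ℤ.0ℤ ×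
  ∃[ k₁ ] ∃[ k₂ ] (¬ (k₁ ≡ ℤ.0ℤ × k₂ ≡ ℤ.0ℤ) × zpow a k₁ ℚ.* zpow b k₂ ≡ 1ℚ)

InM : ℤ → ℤ × ℤ → Set
InM d (a , b) = MultDep a b × b ℤ.- a ≡ d

-- M(d) ≤ N : every duplicate-free list of elements of 𝓜(d) has length ≤ N
-- (i.e. 𝓜(d) is finite with at most N elements)
M≤ : ℤ → ℕ → Set
M≤ d N = (xs : List (ℤ × ℤ)) → Unique xs → All (InM d) xs → length xs ℕ.≤ N

{-# OPTIONS --safe #-}
module Submission where

-- A pair in 𝓜(d) is, up to the symmetry (a , b) ↦ (- b , - a), either one of five trivial pairs or a solution of
-- d = c ^ i * (c ^ k ± 1) with i and k coprime; write n = i + k. So it suffices that a large d has at most two solutions.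
--
-- Solutions with n = 2 exist exactly when d = x (x + 1), and then there are two of them. In that case another solution has
-- bounded n: apply ABC to x, x + 1, to (2 x + 1) ^ 2, 4 c ^ n, and to the pairs (x + 1) ^ 2, c ^ n and x ^ 2, c ^ n after
-- cancelling common factors. For fixed i and k the critical values of d ^ k as a polynomial in c ^ k are rational, so
-- Belyi's trick applies: ABC bounds from below the radical of U (U - m₁) (U - m₂), with U proportional to (4 d) ^ (2 k), whereas
-- U - m₁ is divisible by (2 x + 1) ^ 2 and U - m₂ has a double root.
--
-- Three solutions with n ≥ 3 have different n. Comparing two of them, write c = p ^ e * q and c′ = p ^ f * r with p collecting
-- the common primes. ABC applied to c ^ k, c ^ k ± 1 and to the two powers c ^ n, c′ ^ n′ gives linear inequalities between
-- the logarithms of p, q, r, which leave so few possible exponents for a pair that no three are pairwise compatible.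

open import Defs
open import Data.Empty using (⊥; ⊥-elim)
open import Data.Integer as Z using (ℤ; -[1+_]) renaming (+_ to pos; ∣_∣ to abs)
open import Data.Integer.Properties as ℤP using ()
open import Data.Integer.Tactic.RingSolver as ℤS using ()
open import Data.List using (List; []; _∷_; upTo; _++_; length)
open import Data.List.Membership.Propositional using (_∈_; _∉_; find)
open import Data.List.Membership.Propositional.Properties using (∈-∃++; ∈-++⁺ˡ; ∈-++⁺ʳ; ∈-++⁻)
open import Data.List.Properties using (length-++)
open import Data.List.Relation.Unary.All as All using (All)
open import Data.List.Relation.Unary.All.Properties using (all-filter; ¬Any⇒All¬)
open import Data.List.Relation.Unary.AllPairs as AllPairs using ()
open import Data.List.Relation.Unary.Any as Any using (here; there)
open import Data.List.Relation.Unary.Unique.Propositional using (Unique)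
open import Data.List.Relation.Unary.Unique.Propositional.Properties as UniqueP using ()
open import Data.Nat
open import Data.Nat.Coprimality as Cop using (Coprime; coprime-divisor; coprime?)
open import Data.Nat.Divisibility
open import Data.Nat.DivMod using (_/_; m/n*n≤m; /-monoˡ-≤; m*n/n≡m; +-distrib-/-∣ˡ)
open import Data.Nat.GCD
open import Data.Nat.Induction using (<-wellFounded)
open import Data.Nat.ListAction using (product)
open import Data.Nat.Logarithm
open import Data.Nat.Primality
open import Data.Nat.Primality.Factorisation using (factorisationHasAllPrimeFactors; factorise)
open import Data.Nat.Properties
open import Data.Nat.Tactic.RingSolver using (solve; solve-∀)
open import Data.Product using (∃; ∃-syntax; _×_; _,_; proj₁; proj₂)
open import Data.Product.Properties using (≡-dec)
open import Data.Rational as ℚ using (ℚ; 1ℚ; 0ℚ)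
open import Data.Rational.Properties as ℚP using (toℚᵘ-fromℚᵘ; toℚᵘ-homo-*; toℚᵘ-cong)
open import Data.Rational.Unnormalised as ℚᵘ using (mkℚᵘ; *≡*)
open import Data.Rational.Unnormalised.Properties as ℚᵘP using ()
open import Data.Sum using (_⊎_; inj₁; inj₂; [_,_]′)
open import Function using (_∘_)
open import Induction.WellFounded using (Acc; acc)
open import Relation.Binary.Definitions using (tri<; tri≈; tri>)
open import Relation.Binary.PropositionalEquality
open import Relation.Nullary using (¬_; ¬?; Dec; yes; no)
open import Relation.Nullary.Decidable using (_×-dec_; decidable-stable; from-no)

-- Each value of `c ^ n` accounts for two pairs, so two solutions give 5 + 2 · 2 = 9. ABC comes with
-- an unspecified constant, so its inequalities between logarithms hold only up to a small
-- proportion of log (c ^ k), and only when that logarithm is large. Two obstacles follow. If `D` is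
-- bounded, ABC is too weak; but then `c ^ i` is huge and must be the same for all solutions. If `D`
-- is large, only exponents that miss an inequality by a fixed margin are refuted; borderline ones
-- need coprimality or a comparison of three solutions. For d = x (x + 1) the two solutions with n =
-- 2 exhaust the quota, so none with n ≥ 3 may remain. Direct use of ABC gives, approximately, n ≤ 2
-- i + 2, n ≤ 2 k + 2 and min (i, k) ≤ 2, hence only n ≤ 6. For these exponents Belyi's map bounds
-- the radical below by U ^ (2 - ε), while the two square divisors lower it by the factors y = 2 x +
-- 1 and Y ≥ c ^ k. Thus y · Y is at most about c · D; as y is about c ^ (n / 2) and D about c ^ k,
-- this forces n ≤ 2.

infix 4 _⊑_

-- For m ≥ 1 this says that rad m divides r, without mentioning `rad`. With r fixed it is closed
-- under products and powers, so a bound on a radical can be assembled factor by factor.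
record _⊑_ (m r : ℕ) : Set where
  constructor primes⇒
  field prime-∣ : ∀ {ℓ} → Prime ℓ → ℓ ∣ m → ℓ ∣ r
open _⊑_

∣⇒⊑ : ∀ {m r} → m ∣ r → m ⊑ r
∣⇒⊑ m∣r = primes⇒ λ _ ℓ∣m → ∣-trans ℓ∣m m∣r

⊑-trans : ∀ {m n r} → m ⊑ n → n ⊑ r → m ⊑ r
⊑-trans f g = primes⇒ λ pr h → prime-∣ g pr (prime-∣ f pr h)

⊑-* : ∀ {m n r} → m ⊑ r → n ⊑ r → m * n ⊑ r
⊑-* {m} {n} f g = primes⇒ λ pr h → [ prime-∣ f pr , prime-∣ g pr ]′ (euclidsLemma m n pr h)

1⊑ : ∀ {r} → 1 ⊑ r
1⊑ = primes⇒ λ pr ℓ∣1 → ⊥-elim (¬prime[1] (subst Prime (∣1⇒≡1 ℓ∣1) pr))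

⊑-^ : ∀ {m r} k → m ⊑ r → m ^ k ⊑ r
⊑-^ zero    f = 1⊑
⊑-^ (suc k) f = ⊑-* f (⊑-^ k f)

⊑-*ʳ : ∀ {m r} s → m ⊑ r → m ⊑ r * s
⊑-*ʳ s f = primes⇒ λ pr h → ∣m⇒∣m*n s (prime-∣ f pr h)

⊑-*ˡ : ∀ {m r} s → m ⊑ r → m ⊑ s * r
⊑-*ˡ s f = primes⇒ λ pr h → ∣n⇒∣m*n s (prime-∣ f pr h)

coprime-*∣ : ∀ {a b r} → Coprime a b → a ∣ r → b ∣ r → a * b ∣ r
coprime-*∣ {a} {b} co (divides q refl) b∣ =
  subst (a * b ∣_) (*-comm a q)
    (*-monoʳ-∣ a (coprime-divisor (Cop.sym co) (subst (b ∣_) (*-comm q a) b∣)))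

product-distinct-primes-∣ : ∀ {r} ps → Unique ps → All (λ p → Prime p × p ∣ r) ps → product ps ∣ r
product-distinct-primes-∣ []       _        _                = 1∣ _
product-distinct-primes-∣ (p ∷ ps) (p∉ AllPairs.∷ u) ((pr , p∣r) All.∷ h) =
  coprime-*∣ co p∣r (product-distinct-primes-∣ ps u h)
  where
  co : Coprime p (product ps)
  co (d∣p , d∣ps) with prime⇒irreducible pr d∣p
  ... | inj₁ d≡1 = d≡1
  ... | inj₂ refl =
    ⊥-elim (All.lookup p∉ (factorisationHasAllPrimeFactors pr d∣ps (All.map proj₁ h)) refl)

rad-≤ : ∀ {n r} → 1 ≤ r → n ⊑ r → rad n ≤ r
rad-≤ {n} {suc r} _ f = ∣⇒≤ (product-distinct-primes-∣ _
  (UniqueP.filter⁺ P? (UniqueP.upTo⁺ (suc n)))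
  (All.map (λ (pr , p∣n) → pr , prime-∣ f pr p∣n) (all-filter P? (upTo (suc n)))))
  where P? = λ p → prime? p ×-dec (p ∣? n)

-- Forms of the ABC inequality

ABC-coprime : ABC → ∀ M → 1 ≤ M → ∃[ K ] ∀ A B R → 1 ≤ A → 1 ≤ B → 1 ≤ R →
  Coprime A B → A * B * (A + B) ⊑ R → (A + B) ^ M ≤ K ^ M * R ^ (M + 1)
ABC-coprime abc M 1≤M with abc 1 M ≤-refl 1≤M
... | K , h = K , bound
  where
  bound : ∀ A B R → 1 ≤ A → 1 ≤ B → 1 ≤ R → Coprime A B → A * B * (A + B) ⊑ R →
    (A + B) ^ M ≤ K ^ M * R ^ (M + 1)
  bound A@(suc _) B@(suc _) R _ _ 1≤R co f = begin
    (A + B) ^ M                            ≤⟨ ^-monoˡ-≤ M (m≤n⊔m (A ⊔ B) (A + B)) ⟩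
    (A ⊔ B ⊔ (A + B)) ^ M                  ≤⟨ h (pos A) (pos B) (pos (A + B)) (λ ()) (λ ()) (λ ())
                                                refl (cong pos (Cop.coprime⇒gcd≡1 co)) ⟩
    K ^ M * rad (A * B * (A + B)) ^ (M + 1) ≤⟨ *-monoʳ-≤ (K ^ M) (^-monoˡ-≤ (M + 1) (rad-≤ 1≤R f)) ⟩
    K ^ M * R ^ (M + 1)                    ∎
    where open ≤-Reasoning

^-distribʳ-* : ∀ m n k → (m * n) ^ k ≡ m ^ k * n ^ k
^-distribʳ-* m n zero    = refl
^-distribʳ-* m n (suc k) rewrite ^-distribʳ-* m n k = interchange m n (m ^ k) (n ^ k)
  where
  interchange : ∀ a b c d → a * b * (c * d) ≡ a * c * (b * d)
  interchange = solve-∀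

1≤-*ˡ : ∀ {m} n → 1 ≤ m * n → 1 ≤ m
1≤-*ˡ {suc m} n _ = s≤s z≤n

1≤-*ʳ : ∀ m {n} → 1 ≤ m * n → 1 ≤ n
1≤-*ʳ m {zero}  h = subst (1 ≤_) (*-zeroʳ m) h
1≤-*ʳ m {suc n} _ = s≤s z≤n

1≤* : ∀ {m n} → 1 ≤ m → 1 ≤ n → 1 ≤ m * n
1≤* = *-mono-≤

1≤^ : ∀ {m} k → 1 ≤ m → 1 ≤ m ^ k
1≤^ zero    h = ≤-refl
1≤^ (suc k) h = 1≤* h (1≤^ k h)

gcd-cofactors : ∀ A B → 1 ≤ A → ∃[ g ] ∃[ A′ ] ∃[ B′ ]
  (1 ≤ g × A ≡ A′ * g × B ≡ B′ * g × Coprime A′ B′)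
gcd-cofactors A B 1≤A with mkGCD A B
... | g , G with GCD.commonDivisor G
... | divides A′ refl , divides B′ refl = g , A′ , B′ , 1≤g , refl , refl ,
      Cop.GCD≡1⇒coprime (GCD-* {{>-nonZero 1≤g}} (subst (GCD (A′ * g) (B′ * g)) (sym (*-identityˡ g)) G))
  where 1≤g = 1≤-*ʳ A′ 1≤A

private
  regroup : ∀ K R δ g M → K ^ M * (R * δ) ^ (M + 1) * g ^ (M + 1) ≡ K ^ M * (R * (δ * g)) ^ (M + 1)
  regroup K R δ g M =
    trans (*-assoc (K ^ M) _ _)
      (cong (K ^ M *_) (trans (sym (^-distribʳ-* (R * δ) g (M + 1))) (cong (_^ (M + 1)) (*-assoc R δ g))))

-- Dividing by g = gcd (A , δ) leaves coprime summands, with all primes of the new product in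
-- `R * δ′`. Restoring g costs g ^ M on the left, and a factor g ^ (M + 1) on the right turns δ′
-- back into δ.
ABC-difference : ABC → ∀ M → 1 ≤ M → ∃[ K ] ∀ A δ R → 1 ≤ A → 1 ≤ δ → 1 ≤ R →
  A ⊑ R → A + δ ⊑ R → (A + δ) ^ M ≤ K ^ M * (R * δ) ^ (M + 1)
ABC-difference abc M 1≤M with ABC-coprime abc M 1≤M
... | K , h = K , bound
  where
  bound : ∀ A δ R → 1 ≤ A → 1 ≤ δ → 1 ≤ R → A ⊑ R → A + δ ⊑ R →
    (A + δ) ^ M ≤ K ^ M * (R * δ) ^ (M + 1)
  bound A δ R 1≤A 1≤δ 1≤R fA fB with gcd-cofactors A δ 1≤A
  ... | g , A′ , δ′ , 1≤g , refl , refl , co = begin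
    (A′ * g + δ′ * g) ^ M                          ≡⟨ cong (_^ M) (sym (*-distribʳ-+ g A′ δ′)) ⟩
    ((A′ + δ′) * g) ^ M                            ≡⟨ ^-distribʳ-* (A′ + δ′) g M ⟩
    (A′ + δ′) ^ M * g ^ M                          ≤⟨ *-mono-≤
      (h A′ δ′ (R * δ′) (1≤-*ˡ g 1≤A) (1≤-*ˡ g 1≤δ) (1≤* 1≤R (1≤-*ˡ g 1≤δ)) co
        (⊑-* (⊑-* (⊑-*ʳ δ′ (⊑-trans (∣⇒⊑ (m∣m*n {A′} g)) fA)) (⊑-*ˡ R (∣⇒⊑ ∣-refl)))
          (⊑-*ʳ δ′ (⊑-trans (∣⇒⊑ (divides g (trans (sym (*-distribʳ-+ g A′ δ′)) (*-comm (A′ + δ′) g)))) fB))))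
      (^-monoʳ-≤ g {{>-nonZero 1≤g}} (m≤m+n M 1)) ⟩
    K ^ M * (R * δ′) ^ (M + 1) * g ^ (M + 1)       ≡⟨ regroup K R δ′ g M ⟩
    K ^ M * (R * (δ′ * g)) ^ (M + 1)               ∎
    where open ≤-Reasoning

-- Here the gcd is charged to `A`, which will be a constant, so `δ` enters only through its radical.
-- This matters when `δ` has a large square factor.
ABC-radical : ABC → ∀ M → 1 ≤ M → ∃[ K ] ∀ A δ R → 1 ≤ A → 1 ≤ δ → 1 ≤ R →
  A * δ * (A + δ) ⊑ R → (A + δ) ^ M ≤ (K * A) ^ M * R ^ (M + 1)
ABC-radical abc M 1≤M with ABC-coprime abc M 1≤M
... | K , h = K , bound
  where
  bound : ∀ A δ R → 1 ≤ A → 1 ≤ δ → 1 ≤ R → A * δ * (A + δ) ⊑ R →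
    (A + δ) ^ M ≤ (K * A) ^ M * R ^ (M + 1)
  bound A δ R 1≤A 1≤δ 1≤R f with gcd-cofactors A δ 1≤A
  ... | g , A′ , δ′ , 1≤g , refl , refl , co = begin
    (A′ * g + δ′ * g) ^ M                          ≡⟨ cong (_^ M) (sym (*-distribʳ-+ g A′ δ′)) ⟩
    ((A′ + δ′) * g) ^ M                            ≡⟨ ^-distribʳ-* (A′ + δ′) g M ⟩
    (A′ + δ′) ^ M * g ^ M                          ≤⟨ *-mono-≤
      (h A′ δ′ R (1≤-*ˡ g 1≤A) (1≤-*ˡ g 1≤δ) 1≤R co (⊑-trans (∣⇒⊑ div) f))
      (^-monoˡ-≤ M (m≤n*m g A′ {{>-nonZero (1≤-*ˡ g 1≤A)}})) ⟩
    K ^ M * R ^ (M + 1) * (A′ * g) ^ M             ≡⟨ rot (K ^ M) (R ^ (M + 1)) ((A′ * g) ^ M) ⟩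
    K ^ M * (A′ * g) ^ M * R ^ (M + 1)             ≡⟨ cong (_* R ^ (M + 1)) (sym (^-distribʳ-* K (A′ * g) M)) ⟩
    (K * (A′ * g)) ^ M * R ^ (M + 1)               ∎
    where
    open ≤-Reasoning
    rot : ∀ a b c → a * b * c ≡ a * c * b
    rot = solve-∀
    div : A′ * δ′ * (A′ + δ′) ∣ A′ * g * (δ′ * g) * (A′ * g + δ′ * g)
    div = divides (g * g * g) (lem A′ δ′ g)
      where
      lem : ∀ a b g → a * g * (b * g) * (a * g + b * g) ≡ g * g * g * (a * b * (a + b))
      lem = solve-∀

-- Scaled binary logarithms

2^⌊log₂⌋≤ : ∀ n → 1 ≤ n → 2 ^ ⌊log₂ n ⌋ ≤ n
2^⌊log₂⌋≤ n = go n (<-wellFounded n)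
  where
  go : ∀ n → Acc _<_ n → 1 ≤ n → 2 ^ ⌊log₂ n ⌋ ≤ n
  go 1 _ _ = ≤-refl
  go n@(suc (suc n′)) (acc rs) _ = begin
    2 ^ ⌊log₂ n ⌋                 ≡⟨ cong (2 ^_) log≡ ⟩
    2 * 2 ^ ⌊log₂ ⌊ n /2⌋ ⌋        ≤⟨ *-monoʳ-≤ 2 (go ⌊ n /2⌋ (rs (⌊n/2⌋<n (suc n′))) (s≤s z≤n)) ⟩
    2 * ⌊ n /2⌋                   ≡⟨ cong (⌊ n /2⌋ +_) (+-identityʳ ⌊ n /2⌋) ⟩
    ⌊ n /2⌋ + ⌊ n /2⌋             ≤⟨ +-monoʳ-≤ ⌊ n /2⌋ (⌊n/2⌋≤⌈n/2⌉ n) ⟩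
    ⌊ n /2⌋ + ⌈ n /2⌉             ≡⟨ ⌊n/2⌋+⌈n/2⌉≡n n ⟩
    n                             ∎
    where
    open ≤-Reasoning
    1≤log : 1 ≤ ⌊log₂ n ⌋
    1≤log = subst (_≤ ⌊log₂ n ⌋) (⌊log₂[2^n]⌋≡n 1) (⌊log₂⌋-mono-≤ {2} {n} (s≤s (s≤s z≤n)))
    log≡ : ⌊log₂ n ⌋ ≡ suc ⌊log₂ ⌊ n /2⌋ ⌋
    log≡ = trans (sym (m+[n∸m]≡n 1≤log)) (cong suc (sym (⌊log₂⌊n/2⌋⌋≡⌊log₂n⌋∸1 n)))

<2^[1+⌊log₂⌋] : ∀ n → n < 2 ^ suc ⌊log₂ n ⌋
<2^[1+⌊log₂⌋] n = ≰⇒> λ h → 1+n≰n (subst (_≤ ⌊log₂ n ⌋) (⌊log₂[2^n]⌋≡n (suc ⌊log₂ n ⌋)) (⌊log₂⌋-mono-≤ h))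

⌊log₂⌋-*-≥ : ∀ m n → 1 ≤ m → 1 ≤ n → ⌊log₂ m ⌋ + ⌊log₂ n ⌋ ≤ ⌊log₂ (m * n) ⌋
⌊log₂⌋-*-≥ m n 1≤m 1≤n = subst (_≤ ⌊log₂ (m * n) ⌋) (⌊log₂[2^n]⌋≡n (⌊log₂ m ⌋ + ⌊log₂ n ⌋))
  (⌊log₂⌋-mono-≤ (subst (_≤ m * n) (sym (^-distribˡ-+-* 2 ⌊log₂ m ⌋ ⌊log₂ n ⌋))
    (*-mono-≤ (2^⌊log₂⌋≤ m 1≤m) (2^⌊log₂⌋≤ n 1≤n))))

⌊log₂⌋-*-≤ : ∀ m n → 1 ≤ m → 1 ≤ n → ⌊log₂ (m * n) ⌋ ≤ ⌊log₂ m ⌋ + ⌊log₂ n ⌋ + 1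
⌊log₂⌋-*-≤ m n 1≤m 1≤n = ≮⇒≥ λ h → <-irrefl refl (begin-strict
    m * n                                   <⟨ *-mono-< (<2^[1+⌊log₂⌋] m) (<2^[1+⌊log₂⌋] n) ⟩
    2 ^ suc ⌊log₂ m ⌋ * 2 ^ suc ⌊log₂ n ⌋    ≡⟨ sym (^-distribˡ-+-* 2 (suc ⌊log₂ m ⌋) (suc ⌊log₂ n ⌋)) ⟩
    2 ^ (suc ⌊log₂ m ⌋ + suc ⌊log₂ n ⌋)      ≡⟨ cong (2 ^_) (lem ⌊log₂ m ⌋ ⌊log₂ n ⌋) ⟩
    2 ^ suc (⌊log₂ m ⌋ + ⌊log₂ n ⌋ + 1)      ≤⟨ ^-monoʳ-≤ 2 h ⟩
    2 ^ ⌊log₂ (m * n) ⌋                     ≤⟨ 2^⌊log₂⌋≤ (m * n) (1≤* 1≤m 1≤n) ⟩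
    m * n                                   ∎)
  where
  open ≤-Reasoning
  lem : ∀ a b → suc a + suc b ≡ suc (a + b + 1)
  lem = solve-∀

-- N sets the precision of L; it also serves as 1 / ε in applications of ABC.
opaque
  N : ℕ
  N = 1000

  1000≤N : 1000 ≤ N
  1000≤N = ≤-refl

opaque
  -- N log₂ m rounded down. A product costs a rounding error of at most 1, which is the N-th part of
  -- `L 2`.
  L : ℕ → ℕ
  L m = ⌊log₂ (m ^ N) ⌋

  L-mono : ∀ {m n} → m ≤ n → L m ≤ L n
  L-mono h = ⌊log₂⌋-mono-≤ (^-monoˡ-≤ N h)

  L1≡0 : L 1 ≡ 0
  L1≡0 = trans (cong ⌊log₂_⌋ (^-zeroˡ N)) (⌊log₂[2^n]⌋≡n 0)

  L2≡N : L 2 ≡ N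
  L2≡N = ⌊log₂[2^n]⌋≡n N

  L-*-≥ : ∀ {m n} → 1 ≤ m → 1 ≤ n → L m + L n ≤ L (m * n)
  L-*-≥ {m} {n} p q = subst (λ z → L m + L n ≤ ⌊log₂ z ⌋) (sym (^-distribʳ-* m n N))
    (⌊log₂⌋-*-≥ (m ^ N) (n ^ N) (1≤^ N p) (1≤^ N q))

  L-*-≤ : ∀ {m n} → 1 ≤ m → 1 ≤ n → L (m * n) ≤ L m + L n + 1
  L-*-≤ {m} {n} p q = subst (λ z → ⌊log₂ z ⌋ ≤ L m + L n + 1) (sym (^-distribʳ-* m n N))
    (⌊log₂⌋-*-≤ (m ^ N) (n ^ N) (1≤^ N p) (1≤^ N q))

L≥N : ∀ {m} → 2 ≤ m → N ≤ L m
L≥N {m} h = subst (_≤ L m) L2≡N (L-mono h)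

L-^-≥ : ∀ {m} k → 1 ≤ m → k * L m ≤ L (m ^ k)
L-^-≥ zero    h = z≤n
L-^-≥ {m} (suc k) h = ≤-trans (+-monoʳ-≤ (L m) (L-^-≥ k h)) (L-*-≥ h (1≤^ k h))

L-^-≤ : ∀ {m} k → 1 ≤ m → L (m ^ k) ≤ k * L m + k
L-^-≤ zero    h = ≤-reflexive L1≡0
L-^-≤ {m} (suc k) h = begin
  L (m * m ^ k)            ≤⟨ L-*-≤ h (1≤^ k h) ⟩
  L m + L (m ^ k) + 1      ≤⟨ +-monoˡ-≤ 1 (+-monoʳ-≤ (L m) (L-^-≤ k h)) ⟩
  L m + (k * L m + k) + 1  ≡⟨ lem (L m) (k * L m) k ⟩
  L m + k * L m + suc k    ∎
  where
  open ≤-Reasoning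
  lem : ∀ a b k → a + (b + k) + 1 ≡ a + b + suc k
  lem = solve-∀

L-ABC : ∀ M {C K R} → 1 ≤ M → 1 ≤ C → 1 ≤ K → 1 ≤ R → C ^ M ≤ K ^ M * R ^ (M + 1) →
  M * L C ≤ (M + 1) * L R + M * (L K + 4)
L-ABC M {C} {K} {R} 1≤M 1≤C 1≤K 1≤R h = begin
  M * L C                                            ≤⟨ L-^-≥ M 1≤C ⟩
  L (C ^ M)                                          ≤⟨ L-mono h ⟩
  L (K ^ M * R ^ (M + 1))                            ≤⟨ L-*-≤ (1≤^ M 1≤K) (1≤^ (M + 1) 1≤R) ⟩
  L (K ^ M) + L (R ^ (M + 1)) + 1                    ≤⟨ +-monoˡ-≤ 1 (+-mono-≤ (L-^-≤ M 1≤K) (L-^-≤ (M + 1) 1≤R)) ⟩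
  M * L K + M + ((M + 1) * L R + (M + 1)) + 1        ≡⟨ lem M (L K) ((M + 1) * L R) ⟩
  (M + 1) * L R + (M * L K + M * 2 + 2)              ≤⟨ +-monoʳ-≤ ((M + 1) * L R) (+-monoʳ-≤ (M * L K + M * 2) (≤-trans (*-monoˡ-≤ 2 1≤M) (≤-refl {M * 2}))) ⟩
  (M + 1) * L R + (M * L K + M * 2 + M * 2)          ≡⟨ lem₂ M (L K) ((M + 1) * L R) ⟩
  (M + 1) * L R + M * (L K + 4)                      ∎
  where
  open ≤-Reasoning
  lem : ∀ m k r → m * k + m + (r + (m + 1)) + 1 ≡ r + (m * k + m * 2 + 2)
  lem = solve-∀
  lem₂ : ∀ m k r → r + (m * k + m * 2 + m * 2) ≡ r + m * (k + 4)
  lem₂ = solve-∀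

1≤N : 1 ≤ N
1≤N = ≤-trans (s≤s z≤n) 1000≤N

^-monoˡ-suc : ∀ K M R → K ^ M * R ≤ suc K ^ M * R
^-monoˡ-suc K M R = *-monoˡ-≤ R (^-monoˡ-≤ M (n≤1+n K))

-- `A` and `B` may share factors; the price is their difference, standing beside the radical. So two
-- numbers that are close together force a large radical. `κ` does not depend on `A`, `B`, `R`.
ABC-log : ABC → ∃[ κ ] ∀ A B R → 1 ≤ A → 1 ≤ B → 1 ≤ R → A ≢ B → A ⊑ R → B ⊑ R →
  N * L A ≤ (N + 1) * L (R * ∣ A - B ∣) + N * κ × N * L B ≤ (N + 1) * L (R * ∣ A - B ∣) + N * κ
ABC-log abc with ABC-difference abc N 1≤N
-- `suc K` because the estimates for `L` of a product need positive factors.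
... | K , h = L (suc K) + 4 , bound
  where
  larger : ∀ A B R → 1 ≤ A → 1 ≤ R → A < B → A ⊑ R → B ⊑ R →
    N * L B ≤ (N + 1) * L (R * (B ∸ A)) + N * (L (suc K) + 4)
  larger A B R 1≤A 1≤R A<B fA fB = L-ABC N 1≤N (≤-trans 1≤A (<⇒≤ A<B)) (s≤s z≤n) (1≤* 1≤R 1≤δ)
    (≤-trans (subst (λ z → z ^ N ≤ K ^ N * (R * (B ∸ A)) ^ (N + 1)) eq
      (h A (B ∸ A) R 1≤A 1≤δ 1≤R fA (subst (_⊑ R) (sym eq) fB))) (^-monoˡ-suc K N _))
    where
    1≤δ = m<n⇒0<n∸m A<B
    eq : A + (B ∸ A) ≡ B
    eq = m+[n∸m]≡n (<⇒≤ A<B)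
  bound : ∀ A B R → 1 ≤ A → 1 ≤ B → 1 ≤ R → A ≢ B → A ⊑ R → B ⊑ R →
    N * L A ≤ (N + 1) * L (R * ∣ A - B ∣) + N * (L (suc K) + 4) ×
    N * L B ≤ (N + 1) * L (R * ∣ A - B ∣) + N * (L (suc K) + 4)
  bound A B R 1≤A 1≤B 1≤R A≢B fA fB with <-cmp A B
  ... | tri≈ _ A≡B _ = ⊥-elim (A≢B A≡B)
  ... | tri< A<B _ _ rewrite m≤n⇒∣m-n∣≡n∸m (<⇒≤ A<B) =
    ≤-trans (*-monoʳ-≤ N (L-mono (<⇒≤ A<B))) r , r
    where r = larger A B R 1≤A 1≤R A<B fA fB
  ... | tri> _ _ B<A rewrite m≤n⇒∣n-m∣≡n∸m (<⇒≤ B<A) =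
    r , ≤-trans (*-monoʳ-≤ N (L-mono (<⇒≤ B<A))) r
    where r = larger B A R 1≤B 1≤R B<A fB fA

-- Coprimality and common bases of powers

prime-divisor : ∀ n → n ≢ 1 → 1 ≤ n → ∃[ ℓ ] (Prime ℓ × ℓ ∣ n)
prime-divisor n n≢1 1≤n with factorise n {{>-nonZero 1≤n}}
... | record { factors = [] ; isFactorisation = eq } = ⊥-elim (n≢1 eq)
... | record { factors = p ∷ ps ; isFactorisation = eq ; factorsPrime = pr All.∷ _ } =
  p , pr , divides (product ps) (trans eq (*-comm p (product ps)))

coprime-by-primes : ∀ {a b} → 1 ≤ a → (∀ {ℓ} → Prime ℓ → ℓ ∣ a → ℓ ∣ b → ⊥) → Coprime a b
coprime-by-primes {a} {b} 1≤a h {d} (d∣a , d∣b) with d ≟ 1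
... | yes d≡1 = d≡1
... | no d≢1 with prime-divisor d d≢1 (n≢0⇒n>0 λ { refl → <-irrefl (sym (0∣⇒≡0 d∣a)) 1≤a })
... | ℓ , pr , ℓ∣d = ⊥-elim (h pr (∣-trans ℓ∣d d∣a) (∣-trans ℓ∣d d∣b))

coprime-no-prime : ∀ {a b ℓ} → Coprime a b → Prime ℓ → ℓ ∣ a → ℓ ∣ b → ⊥
coprime-no-prime co pr x y = ¬prime[1] (subst Prime (co (x , y)) pr)

coprime-⊑ : ∀ {a b r s} → 1 ≤ a → a ⊑ r → b ⊑ s → Coprime r s → Coprime a b
coprime-⊑ 1≤a f g co = coprime-by-primes 1≤a λ pr x y →
  coprime-no-prime co pr (_⊑_.prime-∣ f pr x) (_⊑_.prime-∣ g pr y)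

coprime-^ : ∀ {a b} m n → 1 ≤ a → Coprime a b → Coprime (a ^ m) (b ^ n)
coprime-^ m n 1≤a co = coprime-⊑ (1≤^ m 1≤a) (⊑-^ m (∣⇒⊑ ∣-refl)) (⊑-^ n (∣⇒⊑ ∣-refl)) co

coprime-∣⇒≡1 : ∀ {a b} → Coprime a b → a ∣ b → a ≡ 1
coprime-∣⇒≡1 co h = co (∣-refl , h)

^-∣-cancel : ∀ a {u v} → 1 ≤ a → 1 ≤ u → v ^ a ∣ u ^ a → v ∣ u
^-∣-cancel a@(suc a-1) {u} {v} _ 1≤u h with gcd-cofactors u v 1≤u
... | g , u′ , v′ , 1≤g , refl , refl , co = subst (λ z → z * g ∣ u′ * g) (sym v′≡1) (divides u′ (cong (u′ *_) (sym (*-identityˡ g))))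
  where
  h′ : v′ ^ a ∣ u′ ^ a
  h′ = *-cancelʳ-∣ (g ^ a) {{>-nonZero (1≤^ a 1≤g)}} (subst₂ _∣_ (^-distribʳ-* v′ g a) (^-distribʳ-* u′ g a) h)
  v′≡1 : v′ ≡ 1
  v′≡1 with m^n≡1⇒n≡0∨m≡1 v′ a (coprime-∣⇒≡1 (Cop.sym (coprime-^ a a (1≤-*ˡ g 1≤u) co)) h′)
  ... | inj₂ e = e

^-injective : ∀ a {u v} → 1 ≤ a → 1 ≤ u → 1 ≤ v → u ^ a ≡ v ^ a → u ≡ v
^-injective a 1≤a 1≤u 1≤v eq = ∣-antisym (^-∣-cancel a 1≤a 1≤v (∣-reflexive eq)) (^-∣-cancel a 1≤a 1≤u (∣-reflexive (sym eq)))

CommonBase : ℕ → ℕ → ℕ → ℕ → Set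
CommonBase a b u v = ∃[ c ] ∃[ e ] ∃[ f ]
  (1 ≤ c × 1 ≤ e × 1 ≤ f × u ≡ c ^ e × v ≡ c ^ f × e * a ≡ f * b × Coprime e f)

CommonBase-sym : ∀ {a b u v} → CommonBase a b u v → CommonBase b a v u
CommonBase-sym (c , e , f , 1≤c , 1≤e , 1≤f , eqᵤ , eqᵥ , eq , co) =
  c , f , e , 1≤c , 1≤f , 1≤e , eqᵥ , eqᵤ , sym eq , Cop.sym co

-- Subtractive Euclid on the exponents: v ^ a ∣ u ^ a forces v ∣ u.
^≡^⇒common-base : ∀ a b u v → 1 ≤ a → 1 ≤ b → 1 ≤ u → 1 ≤ v → u ^ a ≡ v ^ b → CommonBase a b u v
^≡^⇒common-base a b u v = go a b u v (<-wellFounded (a + b))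
  where
  step : ∀ a b u v → (∀ w → 1 ≤ w → w ^ a ≡ v ^ b → CommonBase a b w v) →
    1 ≤ a → 1 ≤ u → 1 ≤ v → u ^ a ≡ v ^ (a + b) → CommonBase a (a + b) u v
  step a b u v rec 1≤a 1≤u 1≤v eq with ^-∣-cancel a {u} {v} 1≤a 1≤u
      (divides (v ^ b) (trans eq (trans (^-distribˡ-+-* v a b) (*-comm (v ^ a) (v ^ b)))))
  ... | divides w refl with rec w (1≤-*ˡ v 1≤u)
        (*-cancelʳ-≡ _ _ (v ^ a) {{>-nonZero (1≤^ a 1≤v)}}
          (trans (sym (^-distribʳ-* w v a)) (trans eq (trans (^-distribˡ-+-* v a b) (*-comm (v ^ a) (v ^ b))))))
  ... | c , e , f , 1≤c , 1≤e , 1≤f , refl , refl , eq′ , co =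
    c , f + e , f , 1≤c , ≤-trans 1≤f (m≤m+n f e) , 1≤f ,
    trans (*-comm (c ^ e) (c ^ f)) (sym (^-distribˡ-+-* c f e)) , refl ,
    trans (*-distribʳ-+ a f e) (trans (cong (f * a +_) eq′) (sym (*-distribˡ-+ f a b))) ,
    Cop.coprime-+ co
  go : ∀ a b u v → Acc _<_ (a + b) → 1 ≤ a → 1 ≤ b → 1 ≤ u → 1 ≤ v → u ^ a ≡ v ^ b → CommonBase a b u v
  go a b u v (acc rs) 1≤a 1≤b 1≤u 1≤v eq with <-cmp a b
  ... | tri≈ _ refl _ = u , 1 , 1 , 1≤u , ≤-refl , ≤-refl , sym (*-identityʳ u) ,
        trans (sym (^-injective a 1≤a 1≤u 1≤v eq)) (sym (*-identityʳ u)) , refl , Cop.1-coprimeTo 1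
  ... | tri< a<b _ _ with m≤n⇒∃[o]m+o≡n (<⇒≤ a<b)
  ...   | b′ , refl = step a b′ u v
            (λ w 1≤w → go a b′ w v (rs (m<n+m (a + b′) 1≤a)) 1≤a (+-cancelˡ-< a 0 b′ (subst (_< a + b′) (sym (+-identityʳ a)) a<b)) 1≤w 1≤v)
            1≤a 1≤u 1≤v eq
  go a b u v (acc rs) 1≤a 1≤b 1≤u 1≤v eq | tri> _ _ b<a with m≤n⇒∃[o]m+o≡n (<⇒≤ b<a)
  ...   | a′ , refl = CommonBase-sym (step b a′ v u
            (λ w 1≤w eq′ → CommonBase-sym (go a′ b u w (rs (subst (a′ + b <_) (+-comm b (b + a′)) (subst (_< b + (b + a′)) (+-comm b a′) (m<n+m (b + a′) 1≤b))))
               (+-cancelˡ-< b 0 a′ (subst (_< b + a′) (sym (+-identityʳ b)) b<a)) 1≤b 1≤u 1≤w (sym eq′)))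
            1≤b 1≤v 1≤u (sym eq))

-- Moves gcd (m , r) out of `m` repeatedly until it is 1; everything moved has its primes in `r`.
coprime-part : ∀ m r → 1 ≤ m → ∃[ a ] ∃[ q ] (m ≡ a * q × a ⊑ r × Coprime q r)
coprime-part m r = go m (<-wellFounded m)
  where
  go : ∀ m → Acc _<_ m → 1 ≤ m → ∃[ a ] ∃[ q ] (m ≡ a * q × a ⊑ r × Coprime q r)
  go m (acc rs) 1≤m with mkGCD m r
  ... | g , G with g ≟ 1
  ... | yes refl = 1 , m , sym (*-identityˡ m) , 1⊑ , Cop.GCD≡1⇒coprime G
  ... | no g≢1 with GCD.commonDivisor G
  ... | divides m′ refl , g∣r with go m′ (rs (m<m*n m′ g {{>-nonZero (1≤-*ˡ g 1≤m)}} (≤∧≢⇒< (1≤-*ʳ m′ 1≤m) (g≢1 ∘ sym)))) (1≤-*ˡ g 1≤m)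
  ... | a , q , refl , a⊑r , co = a * g , q , swap a q g , ⊑-* a⊑r (∣⇒⊑ g∣r) , co
    where
    swap : ∀ a q g → a * q * g ≡ a * g * q
    swap = solve-∀

-- Solutions of d = c ^ i * (c ^ k ± 1)

Near : ℕ → ℕ → Set
Near m D = D ≡ suc m ⊎ m ≡ suc D

Near-1≤ : ∀ {m D} → 2 ≤ m → Near m D → 1 ≤ D
Near-1≤ _ (inj₁ refl) = s≤s z≤n
Near-1≤ h (inj₂ refl) = s≤s⁻¹ h

Near-≤ : ∀ {m D} → 1 ≤ m → Near m D → D ≤ 2 * m
Near-≤ {m} h (inj₁ refl) = subst (suc m ≤_) (cong (m +_) (sym (+-identityʳ m))) (+-monoˡ-≤ m h)
Near-≤ {m} h (inj₂ refl) = ≤-trans (n≤1+n _) (m≤m+n m _)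

Near-≥ : ∀ {m D} → 1 ≤ D → Near m D → m ≤ 2 * D
Near-≥ {m} {D} h (inj₁ refl) = ≤-trans (n≤1+n m) (m≤m+n D _)
Near-≥ {m} {D} h (inj₂ refl) = subst (suc D ≤_) (cong (D +_) (sym (+-identityʳ D))) (+-monoˡ-≤ D h)

Near-∣1 : ∀ {m D e} → e ∣ m → e ∣ D → Near m D → e ∣ 1
Near-∣1 {m} {D} {e} e∣m e∣D (inj₁ refl) = ∣m+n∣m⇒∣n (subst (e ∣_) (+-comm 1 m) e∣D) e∣m
Near-∣1 {m} {D} {e} e∣m e∣D (inj₂ refl) = ∣m+n∣m⇒∣n (subst (e ∣_) (+-comm 1 D) e∣m) e∣D

m∣m^n : ∀ m {n} → 1 ≤ n → m ∣ m ^ n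
m∣m^n m {suc n} _ = m∣m*n (m ^ n)

-- The sign is hidden in `near`, so most arguments treat both signs at once. Coprimality of `i` and
-- `k` makes `c` the largest common base of `c ^ i` and `c ^ (i + k)`, and later removes borderline
-- exponents.
record Sol (d : ℕ) : Set where
  field
    c i k D : ℕ
    2≤c : 2 ≤ c
    1≤i : 1 ≤ i
    1≤k : 1 ≤ k
    i⊥k : Coprime i k
    near : Near (c ^ k) D
    d≡ : d ≡ c ^ i * D
  n : ℕ
  n = i + k
  1≤c : 1 ≤ c
  1≤c = <⇒≤ 2≤c
  2≤cᵏ : 2 ≤ c ^ k
  2≤cᵏ = ≤-trans 2≤c (≤-trans (≤-reflexive (sym (*-identityʳ c))) (^-monoʳ-≤ c {{>-nonZero 1≤c}} 1≤k))
  1≤D : 1 ≤ D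
  1≤D = Near-1≤ 2≤cᵏ near
  D≤2cᵏ : D ≤ 2 * c ^ k
  D≤2cᵏ = Near-≤ (<⇒≤ 2≤cᵏ) near
  cᵏ≤2D : c ^ k ≤ 2 * D
  cᵏ≤2D = Near-≥ 1≤D near
  D⊥c : Coprime D c
  D⊥c (e∣D , e∣c) = ∣1⇒≡1 (Near-∣1 (∣-trans e∣c (m∣m^n c 1≤k)) e∣D near)

-- As `D` is coprime to `c`, the primes shared by the two bases contribute the same factor `P` to d
-- on both sides, while the primes of one base alone must be supplied by the other `D`. Altogether d
-- = P * q ^ iX * r ^ iY * h.
record Common {d} (X Y : Sol d) : Set where
  private
    module X = Sol X
    module Y = Sol Y
  field
    p q r e f h : ℕ
    1≤p : 1 ≤ p
    1≤q : 1 ≤ q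
    1≤r : 1 ≤ r
    1≤e : 1 ≤ e
    1≤f : 1 ≤ f
    e⊥f : Coprime e f
    ei≡fi : e * X.i ≡ f * Y.i
    cX≡ : X.c ≡ p ^ e * q
    cY≡ : Y.c ≡ p ^ f * r
    DY≡ : Y.D ≡ q ^ X.i * h
    DX≡ : X.D ≡ r ^ Y.i * h
    P : ℕ
    vX≡ : X.c ^ X.i ≡ P * q ^ X.i
    vY≡ : Y.c ^ Y.i ≡ P * r ^ Y.i

common : ∀ {d} (X Y : Sol d) → Common X Y
common {d} X Y with coprime-part (Sol.c X) (Sol.c Y) (Sol.1≤c X) | coprime-part (Sol.c Y) (Sol.c X) (Sol.1≤c Y)
... | a , q , cX≡ , a⊑ , q⊥ | b , r , cY≡ , b⊑ , r⊥ = result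
  where
  module X = Sol X
  module Y = Sol Y
  1≤aq = subst (1 ≤_) cX≡ X.1≤c
  1≤br = subst (1 ≤_) cY≡ Y.1≤c
  1≤a = 1≤-*ˡ q 1≤aq
  1≤b = 1≤-*ˡ r 1≤br
  1≤q = 1≤-*ʳ a 1≤aq
  1≤r = 1≤-*ʳ b 1≤br
  dX : d ≡ a ^ X.i * (q ^ X.i * X.D)
  dX = trans X.d≡ (trans (cong (λ z → z ^ X.i * X.D) cX≡) (trans (cong (_* X.D) (^-distribʳ-* a q X.i)) (*-assoc (a ^ X.i) _ _)))
  dY : d ≡ b ^ Y.i * (r ^ Y.i * Y.D)
  dY = trans Y.d≡ (trans (cong (λ z → z ^ Y.i * Y.D) cY≡) (trans (cong (_* Y.D) (^-distribʳ-* b r Y.i)) (*-assoc (b ^ Y.i) _ _)))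
  -- A prime of `a` divides both bases, hence neither `r` nor `D`; so all of `a ^ i` must divide
  -- `b ^ j`.
  half : ∀ {a b r i j D x y} → 1 ≤ a → a ∣ x → a ⊑ y → Coprime r x → Coprime D y →
    a ^ i ∣ b ^ j * (r ^ j * D) → a ^ i ∣ b ^ j
  half {a} {b} {r} {i} {j} {D} 1≤a a∣x a⊑y r⊥x D⊥y h =
    coprime-divisor co (subst (a ^ i ∣_) (*-comm (b ^ j) (r ^ j * D)) h)
    where
    co : Coprime (a ^ i) (r ^ j * D)
    co = coprime-by-primes (1≤^ i 1≤a) λ pr ℓ∣aⁱ ℓ∣rD →
      let ℓ∣a = _⊑_.prime-∣ (⊑-^ i (∣⇒⊑ ∣-refl)) pr ℓ∣aⁱ in
      [ (λ ℓ∣rʲ → coprime-no-prime r⊥x pr (_⊑_.prime-∣ (⊑-^ j (∣⇒⊑ ∣-refl)) pr ℓ∣rʲ) (∣-trans ℓ∣a a∣x))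
      , (λ ℓ∣D → coprime-no-prime D⊥y pr ℓ∣D (_⊑_.prime-∣ a⊑y pr ℓ∣a)) ]′ (euclidsLemma (r ^ j) D pr ℓ∣rD)
  aⁱ≡bʲ : a ^ X.i ≡ b ^ Y.i
  aⁱ≡bʲ = ∣-antisym
    (half {i = X.i} {j = Y.i} 1≤a (subst (a ∣_) (sym cX≡) (m∣m*n q)) a⊑ r⊥ Y.D⊥c
      (subst (a ^ X.i ∣_) (trans (sym dX) dY) (m∣m*n _)))
    (half {i = Y.i} {j = X.i} 1≤b (subst (b ∣_) (sym cY≡) (m∣m*n r)) b⊑ q⊥ X.D⊥c
      (subst (b ^ Y.i ∣_) (trans (sym dY) dX) (m∣m*n _)))
  qD≡rD : q ^ X.i * X.D ≡ r ^ Y.i * Y.D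
  qD≡rD = *-cancelˡ-≡ _ _ (a ^ X.i) {{>-nonZero (1≤^ X.i 1≤a)}}
    (trans (sym dX) (trans dY (cong (_* (r ^ Y.i * Y.D)) (sym aⁱ≡bʲ))))
  q⊥r : Coprime (q ^ X.i) (r ^ Y.i)
  q⊥r = coprime-^ X.i Y.i 1≤q λ (x , y) → q⊥ (x , ∣-trans y (subst (r ∣_) (sym cY≡) (n∣m*n b)))
  q∣D : q ^ X.i ∣ Y.D
  q∣D = coprime-divisor q⊥r (subst (q ^ X.i ∣_) qD≡rD (m∣m*n X.D))
  result : Common X Y
  result with ^≡^⇒common-base X.i Y.i a b X.1≤i Y.1≤i 1≤a 1≤b aⁱ≡bʲ | q∣D
  ... | p , e , f , 1≤p , 1≤e , 1≤f , a≡ , b≡ , eq , e⊥f | divides h DY≡ = record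
    { p = p ; q = q ; r = r ; e = e ; f = f ; h = h
    ; 1≤p = 1≤p ; 1≤q = 1≤q ; 1≤r = 1≤r ; 1≤e = 1≤e ; 1≤f = 1≤f ; e⊥f = e⊥f ; ei≡fi = eq
    ; cX≡ = trans cX≡ (cong (_* q) a≡) ; cY≡ = trans cY≡ (cong (_* r) b≡)
    ; DY≡ = trans DY≡ (*-comm h (q ^ X.i))
    ; DX≡ = *-cancelˡ-≡ _ _ (q ^ X.i) {{>-nonZero (1≤^ X.i 1≤q)}}
        (trans qD≡rD (trans (cong (r ^ Y.i *_) DY≡) (rot (r ^ Y.i) h (q ^ X.i))))
    ; P = a ^ X.i
    ; vX≡ = trans (cong (_^ X.i) cX≡) (^-distribʳ-* a q X.i)
    ; vY≡ = trans (cong (_^ Y.i) cY≡) (trans (^-distribʳ-* b r Y.i) (cong (_* r ^ Y.i) (sym aⁱ≡bʲ)))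
    }
    where
    rot : ∀ r h q → r * (h * q) ≡ q * (r * h)
    rot = solve-∀

-- Linear inequalities are proved by Farkas certificates: a combination of the hypotheses whose left-hand side
-- exceeds its right-hand side by suc s.
sum-absurd : ∀ {A B} s → A ≤ B → A ≡ suc (B + s) → ⊥
sum-absurd {A} {B} s h eq = 1+n≰n (≤-trans (s≤s (m≤m+n B s)) (≤-trans (≤-reflexive (sym eq)) h))

infixl 6 _⊹_
infixl 7 _·_

_⊹_ : ∀ {a b c d} → a ≤ b → c ≤ d → a + c ≤ b + d
_⊹_ = +-mono-≤

_·_ : ∀ k {a b} → a ≤ b → k * a ≤ k * b
k · h = *-monoʳ-≤ k h

-- Since N ≥ 1000, an error of 10 t / N is at most one per cent of t.
scale-error : ∀ a b t → N * a ≤ N * b + 10 * t → 100 * a ≤ 100 * b + t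
scale-error a b t h = *-cancelˡ-≤ N {{>-nonZero 1≤N}} (begin
  N * (100 * a)          ≡⟨ lem₁ N a ⟩
  100 * (N * a)          ≤⟨ *-monoʳ-≤ 100 h ⟩
  100 * (N * b + 10 * t) ≡⟨ lem₂ N b t ⟩
  N * (100 * b) + 1000 * t ≤⟨ +-monoʳ-≤ (N * (100 * b)) (*-monoˡ-≤ t 1000≤N) ⟩
  N * (100 * b) + N * t  ≡⟨ sym (*-distribˡ-+ N (100 * b) t) ⟩
  N * (100 * b + t)      ∎)
  where
  open ≤-Reasoning
  lem₁ : ∀ n a → n * (100 * a) ≡ 100 * (n * a)
  lem₁ = solve-∀
  lem₂ : ∀ n b t → 100 * (n * b + 10 * t) ≡ n * (100 * b) + 1000 * t
  lem₂ = solve-∀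

round-error : ∀ a b t → 100 * a ≤ 100 * b + t → a ≤ b + t / 100
round-error a b t h = begin
  a                          ≡⟨ sym (m*n/n≡m a 100) ⟩
  a * 100 / 100              ≡⟨ cong (_/ 100) (*-comm a 100) ⟩
  100 * a / 100              ≤⟨ /-monoˡ-≤ 100 h ⟩
  (100 * b + t) / 100        ≡⟨ +-distrib-/-∣ˡ t (m∣m*n b) ⟩
  100 * b / 100 + t / 100    ≡⟨ cong (λ z → z / 100 + t / 100) (*-comm 100 b) ⟩
  b * 100 / 100 + t / 100    ≡⟨ cong (_+ t / 100) (m*n/n≡m b 100) ⟩
  b + t / 100                ∎
  where open ≤-Reasoning

round : ∀ a b t → N * a ≤ N * b + 10 * t → a ≤ b + t / 100
round a b t h = round-error a b t (scale-error a b t h)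

-- In this group `n` stands for `N`. The recurring hypothesis `n * κ + 3 * n * n + 20 * n ≤ t` lets
-- t absorb the constant of ABC and all rounding terms, so that errors on the N-fold scale become
-- small multiples of t, at most `10 * t`.
arith-D≤ : ∀ n κ t k l →
  n * κ + 3 * n * n + 20 * n ≤ t →
  l ≤ n + 1 + t + k →
  n * k ≤ t →
  n * l ≤ n * t + 2 * t
arith-D≤ n κ t k l hb h1 h2 = ≮⇒≥ λ (hg : suc (n * t + 2 * t) ≤ n * l) → sum-absurd (2 + 17 * n + n * κ + 2 * t)
  (hb ⊹ (3 * n) · h1 ⊹ 3 · h2 ⊹ 3 · hg)
  (solve (n ∷ κ ∷ t ∷ k ∷ l ∷ []))

arith-D≥ : ∀ n κ t l →
  n * κ + 3 * n * n + 20 * n ≤ t →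
  t ≤ n + l + 1 →
  n * t ≤ n * l + t
arith-D≥ n κ t l hb h1 = ≮⇒≥ λ (hg : suc (n * l + t) ≤ n * t) → sum-absurd (2 + 17 * n + n * κ + 2 * t)
  (hb ⊹ (3 * n) · h1 ⊹ 3 · hg)
  (solve (n ∷ κ ∷ t ∷ l ∷ []))

arith-D≤2 : ∀ n t l →
  2 ≤ n →
  n * l ≤ n * t + 2 * t →
  l ≤ 2 * t
arith-D≤2 n t l hn h1 = ≮⇒≥ λ (hg : suc (2 * t) ≤ l) → sum-absurd (1)
  (hn ⊹ t · hn ⊹ h1 ⊹ n · hg)
  (solve (n ∷ t ∷ l ∷ []))

arith-F : ∀ n κ t α tX l →
  1 ≤ n →
  n * κ + 3 * n * n + 20 * n ≤ t →
  n * tX ≤ (n + 1) * (α + l + 1) + n * κ →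
  n * l ≤ n * t + 2 * t →
  l ≤ 2 * t →
  α ≤ t →
  n * tX ≤ n * (α + t) + 10 * t
arith-F n κ t α tX l hn hb h0 h1 h2 h3 = ≮⇒≥ λ (hg : suc (n * (α + t) + 10 * t) ≤ n * tX) → sum-absurd (18 * n + 3 * n * n + 4 * t)
  (hn ⊹ hb ⊹ h0 ⊹ h1 ⊹ h2 ⊹ h3 ⊹ hg)
  (solve (n ∷ κ ∷ t ∷ α ∷ tX ∷ l ∷ []))

arith-3t : ∀ n t α tX →
  10 ≤ n →
  n * tX ≤ n * (α + t) + 10 * t →
  α ≤ t →
  tX ≤ 3 * t
arith-3t n t α tX hn h0 h3 = ≮⇒≥ λ (hg : suc (3 * t) ≤ tX) → sum-absurd (9)
  (hn ⊹ t · hn ⊹ h0 ⊹ n · h3 ⊹ n · hg)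
  (solve (n ∷ t ∷ α ∷ tX ∷ []))

arith-I : ∀ n κ t R Q →
  1 ≤ n →
  n * κ + 3 * n * n + 20 * n ≤ t →
  n * (Q + t) ≤ (n + 1) * (R + Q + n + 4) + n * κ →
  R ≤ 3 * t →
  Q ≤ 6 * t →
  n * t ≤ n * R + 10 * t
arith-I n κ t R Q hn hb h0 h1 h2 = ≮⇒≥ λ (hg : suc (n * R + 10 * t) ≤ n * t) → sum-absurd (11 * n + 2 * n * n)
  (4 · hn ⊹ hb ⊹ h0 ⊹ h1 ⊹ h2 ⊹ hg)
  (solve (n ∷ κ ∷ t ∷ R ∷ Q ∷ []))

arith-II : ∀ n κ t R l y ck →
  1 ≤ n →
  n * κ + 3 * n * n + 20 * n ≤ t →
  n * ck ≤ (n + 1) * (R + l + 3) + n * κ →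
  R ≤ 3 * t →
  l ≤ 2 * t →
  y + l ≤ n + ck + 1 →
  n * y ≤ n * R + 10 * t
arith-II n κ t R l y ck hn hb h0 h1 h2 h3 = ≮⇒≥ λ (hg : suc (n * R + 10 * t) ≤ n * y) → sum-absurd (13 * n + 2 * n * n + 4 * t)
  (3 · hn ⊹ hb ⊹ h0 ⊹ h1 ⊹ h2 ⊹ n · h3 ⊹ hg)
  (solve (n ∷ κ ∷ t ∷ R ∷ l ∷ y ∷ ck ∷ []))

arith-T : ∀ n t tX lX lY →
  n * t ≤ n * lY + t →
  lY ≤ lX →
  n * lX ≤ n * tX + 2 * tX →
  tX ≤ 3 * t →
  n * t ≤ n * tX + 10 * t
arith-T n t tX lX lY h0 h1 h2 h3 = ≮⇒≥ λ (hg : suc (n * tX + 10 * t) ≤ n * t) → sum-absurd (3 * t)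
  (h0 ⊹ n · h1 ⊹ h2 ⊹ 2 · h3 ⊹ hg)
  (solve (n ∷ t ∷ tX ∷ lX ∷ lY ∷ []))

arith-E : ∀ n κ t a b m →
  n * κ + 3 * n * n + 20 * n ≤ t →
  a ≤ b + m + 2 * n + 2 →
  n * m ≤ b →
  t ≤ b →
  n * a ≤ n * b + 10 * b
arith-E n κ t a b m hb h0 h1 h2 = ≮⇒≥ λ (hg : suc (n * b + 10 * b) ≤ n * a) → sum-absurd (2 + 25 * b + 34 * n + 2 * n * κ)
  (2 · hb ⊹ (3 * n) · h0 ⊹ 3 · h1 ⊹ 2 · h2 ⊹ 3 · hg)
  (solve (n ∷ κ ∷ t ∷ a ∷ b ∷ m ∷ []))

arith-E2 : ∀ n a b f c t →
  a ≤ b + f + c + 1 →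
  n * f ≤ t →
  n ≤ t →
  n * a ≤ n * (b + c) + 10 * t
arith-E2 n a b f c t h0 h1 h2 = ≮⇒≥ λ (hg : suc (n * (b + c) + 10 * t) ≤ n * a) → sum-absurd (8 * t)
  (n · h0 ⊹ h1 ⊹ h2 ⊹ hg)
  (solve (n ∷ a ∷ b ∷ f ∷ c ∷ t ∷ []))

-- Pairs of solutions on the logarithmic scale

Big : ℕ → ℕ → Set
Big κ t = N * κ + 3 * N * N + 20 * N ≤ t

10≤N : 10 ≤ N
10≤N = ≤-trans (m≤m+n 10 990) 1000≤N

-- `t` stands for the logarithms of c ^ k and of `D` at once and is linear in `α`. For large `t` it
-- deviates from `L D` by at most 2 t / N.
module SolLog {d : ℕ} (S : Sol d) where
  open Sol S

  α t : ℕ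
  α = L c
  t = k * α

  N≤α : N ≤ α
  N≤α = L≥N 2≤c

  α≤t : α ≤ t
  α≤t = m≤n*m α k {{>-nonZero 1≤k}}

  Nk≤t : N * k ≤ t
  Nk≤t = subst (_≤ t) (*-comm k N) (*-monoʳ-≤ k N≤α)

  t≤Lcᵏ : t ≤ L (c ^ k)
  t≤Lcᵏ = L-^-≥ k 1≤c

  Lcᵏ≤ : L (c ^ k) ≤ N + L D + 1
  Lcᵏ≤ = ≤-trans (L-mono cᵏ≤2D) (≤-trans (L-*-≤ (s≤s z≤n) 1≤D) (≤-reflexive (cong (λ z → z + L D + 1) L2≡N)))

  LD≤Lcᵏ : L D ≤ N + L (c ^ k) + 1
  LD≤Lcᵏ = ≤-trans (L-mono D≤2cᵏ) (≤-trans (L-*-≤ (s≤s z≤n) (<⇒≤ 2≤cᵏ)) (≤-reflexive (cong (λ z → z + L (c ^ k) + 1) L2≡N)))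

  module _ {κ : ℕ} (big : Big κ t) where
    N*LD≤ : N * L D ≤ N * t + 2 * t
    N*LD≤ = arith-D≤ N κ t k (L D) big
      (≤-trans LD≤Lcᵏ (≤-trans (+-monoˡ-≤ 1 (+-monoʳ-≤ N (L-^-≤ k 1≤c))) (≤-reflexive (eq N t k)))) Nk≤t
      where
      eq : ∀ n t k → n + (t + k) + 1 ≡ n + 1 + t + k
      eq = solve-∀

    N*t≤ : N * t ≤ N * L D + t
    N*t≤ = arith-D≥ N κ t (L D) big (≤-trans t≤Lcᵏ Lcᵏ≤)

    LD≤2t : L D ≤ 2 * t
    LD≤2t = arith-D≤2 N t (L D) (≤-trans (m≤m+n 2 8) 10≤N) N*LD≤

c∣d : ∀ {d} (S : Sol d) → Sol.c S ∣ d
c∣d S = subst (Sol.c S ∣_) (sym (Sol.d≡ S)) (∣m⇒∣m*n (Sol.D S) (m∣m^n (Sol.c S) (Sol.1≤i S)))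

D∣d : ∀ {d} (S : Sol d) → Sol.D S ∣ d
D∣d S = subst (Sol.D S ∣_) (sym (Sol.d≡ S)) (n∣m*n (Sol.c S ^ Sol.i S))

d⊑cD : ∀ {d} (S : Sol d) → d ⊑ Sol.c S * Sol.D S
d⊑cD S = subst (_⊑ _) (sym (Sol.d≡ S)) (⊑-* (⊑-^ (Sol.i S) (∣⇒⊑ (m∣m*n (Sol.D S)))) (∣⇒⊑ (n∣m*n (Sol.c S))))

Near-∣-∣ : ∀ {m D} → Near m D → ∣ m - D ∣ ≡ 1
Near-∣-∣ {m} (inj₁ refl) = trans (m≤n⇒∣m-n∣≡n∸m (n≤1+n m)) (m+n∸n≡m 1 m)
Near-∣-∣ {_} {D} (inj₂ refl) = trans (m≤n⇒∣n-m∣≡n∸m (n≤1+n D)) (m+n∸n≡m 1 D)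

Near-≢ : ∀ {m D} → Near m D → m ≢ D
Near-≢ (inj₁ refl) eq = 1+n≢n (sym eq)
Near-≢ (inj₂ refl) eq = 1+n≢n eq

ABCLog : ℕ → Set
ABCLog κ = ∀ A B R → 1 ≤ A → 1 ≤ B → 1 ≤ R → A ≢ B → A ⊑ R → B ⊑ R →
  N * L A ≤ (N + 1) * L (R * ∣ A - B ∣) + N * κ × N * L B ≤ (N + 1) * L (R * ∣ A - B ∣) + N * κ

-- ABC for the neighbours c ^ k and `D`. `R` is left open because the primes of c * D are those of
-- d, and these can be bounded through another solution.
power-log : ∀ {d κ} → ABCLog κ → (S : Sol d) → ∀ R → 1 ≤ R → Sol.c S ⊑ R → Sol.D S ⊑ R →
  N * L (Sol.c S ^ Sol.k S) ≤ (N + 1) * L R + N * κ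
power-log {κ = κ} abc S R 1≤R fc fD =
  subst (λ z → N * L (c ^ k) ≤ (N + 1) * L z + N * κ) (trans (cong (R *_) (Near-∣-∣ near)) (*-identityʳ R))
    (proj₁ (abc (c ^ k) D R (<⇒≤ 2≤cᵏ) 1≤D 1≤R (Near-≢ near) (⊑-^ k fc) fD))
  where open Sol S

module Ordered {d κ : ℕ} (abc : ABCLog κ) (X Y : Sol d) where
  private
    module X = Sol X
    module Y = Sol Y
    module LX = SolLog X
    module LY = SolLog Y

  u≤ : X.c ^ X.n ≤ 2 * d
  u≤ = begin
    X.c ^ (X.i + X.k)             ≡⟨ ^-distribˡ-+-* X.c X.i X.k ⟩
    X.c ^ X.i * X.c ^ X.k         ≤⟨ *-monoʳ-≤ (X.c ^ X.i) X.cᵏ≤2D ⟩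
    X.c ^ X.i * (2 * X.D)         ≡⟨ rot (X.c ^ X.i) X.D ⟩
    2 * (X.c ^ X.i * X.D)         ≡⟨ cong (2 *_) (sym X.d≡) ⟩
    2 * d                         ∎
    where
    open ≤-Reasoning
    rot : ∀ a b → a * (2 * b) ≡ 2 * (a * b)
    rot = solve-∀

  d≤ : d ≤ 2 * Y.c ^ Y.n
  d≤ = begin
    d                             ≡⟨ Y.d≡ ⟩
    Y.c ^ Y.i * Y.D               ≤⟨ *-monoʳ-≤ (Y.c ^ Y.i) Y.D≤2cᵏ ⟩
    Y.c ^ Y.i * (2 * Y.c ^ Y.k)   ≡⟨ rot (Y.c ^ Y.i) (Y.c ^ Y.k) ⟩
    2 * (Y.c ^ Y.i * Y.c ^ Y.k)   ≡⟨ cong (2 *_) (sym (^-distribˡ-+-* Y.c Y.i Y.k)) ⟩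
    2 * Y.c ^ (Y.i + Y.k)         ∎
    where
    open ≤-Reasoning
    rot : ∀ a b → a * (2 * b) ≡ 2 * (a * b)
    rot = solve-∀

  module _ (bigX : Big κ LX.t) (bigY : Big κ LY.t) where
    -- The primes of cX and DX divide d and hence cY * DY, whose logarithm is about αY + tY.
    N*tX≤ : N * LX.t ≤ N * (LY.α + LY.t) + 10 * LY.t
    N*tX≤ = arith-F N κ LY.t LY.α LX.t (L Y.D) 1≤N bigY
      (≤-trans (*-monoʳ-≤ N LX.t≤Lcᵏ)
        (≤-trans (power-log abc X (Y.c * Y.D) (1≤* Y.1≤c Y.1≤D)
            (⊑-trans (∣⇒⊑ (c∣d X)) (d⊑cD Y)) (⊑-trans (∣⇒⊑ (D∣d X)) (d⊑cD Y)))
          (+-monoˡ-≤ (N * κ) (*-monoʳ-≤ (N + 1) (L-*-≤ Y.1≤c Y.1≤D)))))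
      (LY.N*LD≤ {κ} bigY) (LY.LD≤2t {κ} bigY) LY.α≤t

    tX≤3tY : LX.t ≤ 3 * LY.t
    tX≤3tY = arith-3t N LY.t LY.α LX.t 10≤N N*tX≤ LY.α≤t

    power-ratio : 100 * (X.k * LX.α) ≤ 100 * (LY.α + Y.k * LY.α) + Y.k * LY.α
    power-ratio = scale-error LX.t (LY.α + LY.t) LY.t N*tX≤

    -- In each solution c ^ n and d agree up to a factor of 2.
    size-ratio : 100 * (X.n * LX.α) ≤ 100 * (Y.n * LY.α) + Y.n * LY.α
    size-ratio = scale-error (X.n * LX.α) (Y.n * LY.α) (Y.n * LY.α)
      (arith-E N κ LY.t (X.n * LX.α) (Y.n * LY.α) Y.n bigY h₁
        (subst (_≤ Y.n * LY.α) (*-comm Y.n N) (*-monoʳ-≤ Y.n LY.N≤α)) (*-monoˡ-≤ LY.α (m≤n+m Y.k Y.i)))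
      where
      open ≤-Reasoning
      eq : ∀ n b m → n + 1 + n + (b + m) + 1 ≡ b + m + 2 * n + 2
      eq = solve-∀
      L4≤ : L (2 * 2) ≤ N + 1 + N
      L4≤ = ≤-trans (L-*-≤ {2} {2} (s≤s z≤n) (s≤s z≤n)) (≤-reflexive (trans (cong (λ z → z + z + 1) L2≡N) (eq′ N)))
        where
        eq′ : ∀ n → n + n + 1 ≡ n + 1 + n
        eq′ = solve-∀
      h₁ : X.n * LX.α ≤ Y.n * LY.α + Y.n + 2 * N + 2
      h₁ = begin
        X.n * LX.α                              ≤⟨ L-^-≥ X.n X.1≤c ⟩
        L (X.c ^ X.n)                           ≤⟨ L-mono (≤-trans u≤ (*-monoʳ-≤ 2 d≤)) ⟩
        L (2 * (2 * Y.c ^ Y.n))                 ≡⟨ cong L (sym (*-assoc 2 2 (Y.c ^ Y.n))) ⟩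
        L (2 * 2 * Y.c ^ Y.n)                   ≤⟨ L-*-≤ (s≤s z≤n) (1≤^ Y.n Y.1≤c) ⟩
        L (2 * 2) + L (Y.c ^ Y.n) + 1           ≤⟨ +-monoˡ-≤ 1 (+-mono-≤ L4≤ (L-^-≤ Y.n Y.1≤c)) ⟩
        N + 1 + N + (Y.n * LY.α + Y.n) + 1      ≡⟨ eq N (Y.n * LY.α) Y.n ⟩
        Y.n * LY.α + Y.n + 2 * N + 2            ∎

-- Y is the solution with the larger c ^ i; π, x, y are the logarithms of p, q, r in Common, and η is the error.
record Bounds (iX kX αX iY kY αY : ℕ) : Set where
  field
    π x y e f η : ℕ
    1≤e : 1 ≤ e
    1≤f : 1 ≤ f
    e⊥f : Coprime e f
    ei≡fi : e * iX ≡ f * iY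
    100η≤ : 100 * η ≤ kY * αY
    eπ+x≤ : e * π + x ≤ αX
    fπ+y≤ : f * π + y ≤ αY
    ≤fπ+y : αY ≤ f * π + y + η
    t≤R : kY * αY ≤ π + x + y + η
    iy≤R : iY * y ≤ π + x + y + η
    ix≤t : iX * x ≤ kY * αY + η
    t≤t : kY * αY ≤ kX * αX + η

module Top {d κ : ℕ} (abc : ABCLog κ) (X Y : Sol d) (C : Common X Y)
  (u≢ : Sol.c X ^ Sol.n X ≢ Sol.c Y ^ Sol.n Y) (D≤ : Sol.D Y ≤ Sol.D X)
  (bigX : Big κ (SolLog.t X)) (bigY : Big κ (SolLog.t Y)) where
  private
    module X = Sol X
    module Y = Sol Y
    module LX = SolLog X
    module LY = SolLog Y
    module C = Common C
  open Common C using (p; q; r; e; f; h)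

  π x y R : ℕ
  π = L p
  x = L q
  y = L r
  R = π + x + y

  1≤h : 1 ≤ h
  1≤h = 1≤-*ʳ (q ^ X.i) (subst (1 ≤_) C.DY≡ Y.1≤D)

  Q≤Q : q ^ X.i ≤ r ^ Y.i
  Q≤Q = *-cancelʳ-≤ (q ^ X.i) (r ^ Y.i) h {{>-nonZero 1≤h}} (subst₂ _≤_ C.DY≡ C.DX≡ D≤)

  base-log : ∀ {c} e {q} → c ≡ p ^ e * q → 1 ≤ q → e * π + L q ≤ L c
  base-log e {q} refl 1≤q = ≤-trans (+-monoˡ-≤ (L q) (L-^-≥ e C.1≤p)) (L-*-≥ (1≤^ e C.1≤p) 1≤q)

  base-log≤ : L Y.c ≤ f * π + y + LY.t / 100
  base-log≤ = round (L Y.c) (f * π + y) LY.t (go (m≤n⇒m<n∨m≡n C.1≤p))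
    where
    -- The rounding error `f` is controlled by N * f ≤ f * π when p > 1. For p = 1 there is no such
    -- control, but then cY is just `r`.
    go : 1 < p ⊎ 1 ≡ p → N * L Y.c ≤ N * (f * π + y) + 10 * LY.t
    go (inj₂ 1≡p) = ≤-trans (*-monoʳ-≤ N (≤-trans (≤-reflexive (cong L eq)) (m≤n+m y (f * π)))) (m≤m+n _ _)
      where
      eq : Y.c ≡ r
      eq = trans C.cY≡ (trans (cong (λ z → z ^ f * r) (sym 1≡p)) (trans (cong (_* r) (^-zeroˡ f)) (*-identityˡ r)))
    go (inj₁ 1<p) = arith-E2 N (L Y.c) (f * π) f y LY.t
      (≤-trans (≤-reflexive (cong L C.cY≡)) (≤-trans (L-*-≤ (1≤^ f C.1≤p) C.1≤r) (+-monoˡ-≤ 1 (+-monoˡ-≤ y (L-^-≤ f C.1≤p)))))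
      (≤-trans (≤-reflexive (*-comm N f)) (≤-trans (*-monoʳ-≤ f (L≥N 1<p)) (≤-trans (m≤m+n (f * π) y) (≤-trans (base-log f C.cY≡ C.1≤r) LY.α≤t))))
      (≤-trans LY.N≤α LY.α≤t)

  π+y≤t : π + y ≤ LY.t
  π+y≤t = ≤-trans (+-monoˡ-≤ y (m≤n*m π f {{>-nonZero C.1≤f}})) (≤-trans (base-log f C.cY≡ C.1≤r) LY.α≤t)

  ix≤LD : X.i * x ≤ L Y.D
  ix≤LD = ≤-trans (L-^-≥ X.i C.1≤q) (≤-trans (≤-reflexive (sym (+-identityʳ _)))
    (≤-trans (+-monoʳ-≤ (L (q ^ X.i)) z≤n) (≤-trans (L-*-≥ (1≤^ X.i C.1≤q) 1≤h) (≤-reflexive (cong L (sym C.DY≡))))))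

  LQ+Lh≤ : L (r ^ Y.i) + L h ≤ L X.D
  LQ+Lh≤ = ≤-trans (L-*-≥ (1≤^ Y.i C.1≤r) 1≤h) (≤-reflexive (cong L (sym C.DX≡)))

  R≤3t : R ≤ 3 * LY.t
  R≤3t = begin
    π + x + y          ≡⟨ swap π x y ⟩
    π + y + x          ≤⟨ +-mono-≤ π+y≤t (≤-trans (m≤n*m x X.i {{>-nonZero X.1≤i}}) (≤-trans ix≤LD (LY.LD≤2t {κ} bigY))) ⟩
    LY.t + 2 * LY.t    ∎
    where
    open ≤-Reasoning
    swap : ∀ a b c → a + b + c ≡ a + c + b
    swap = solve-∀

  1≤pqr : 1 ≤ p * q * r
  1≤pqr = 1≤* (1≤* C.1≤p C.1≤q) C.1≤r

  Lpqr≤ : L (p * q * r) ≤ R + 2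
  Lpqr≤ = ≤-trans (L-*-≤ (1≤* C.1≤p C.1≤q) C.1≤r)
    (≤-trans (+-monoˡ-≤ 1 (+-monoˡ-≤ y (L-*-≤ C.1≤p C.1≤q))) (≤-reflexive (eq π x y)))
    where
    eq : ∀ a b c → a + b + 1 + c + 1 ≡ a + b + c + 2
    eq = solve-∀

  cX⊑ : X.c ⊑ p * q * r
  cX⊑ = subst (_⊑ p * q * r) (sym C.cX≡) (⊑-*ʳ r (⊑-* (⊑-^ e (∣⇒⊑ (m∣m*n q))) (∣⇒⊑ (n∣m*n p))))

  cY⊑ : Y.c ⊑ p * q * r
  cY⊑ = subst (_⊑ p * q * r) (sym C.cY≡) (⊑-* (⊑-*ʳ r (⊑-^ f (∣⇒⊑ (m∣m*n q)))) (∣⇒⊑ (n∣m*n (p * q))))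

  -- u X, u Y and d with the common factor `P` removed. `A` and `B` lie at distances q ^ iX ≤ r ^ iY
  -- from `E`, so their difference is small compared with `B`, which is r ^ iY * cY ^ kY.
  A B E : ℕ
  A = q ^ X.i * X.c ^ X.k
  B = r ^ Y.i * Y.c ^ Y.k
  E = q ^ X.i * X.D

  E≡ : E ≡ r ^ Y.i * Y.D
  E≡ = trans (cong (q ^ X.i *_) C.DX≡) (trans (rot (q ^ X.i) (r ^ Y.i) h) (cong (r ^ Y.i *_) (sym C.DY≡)))
    where
    rot : ∀ a b c → a * (b * c) ≡ b * (a * c)
    rot = solve-∀

  A≢B : A ≢ B
  A≢B eq = u≢ (trans (uX X.c X.i X.k C.vX≡) (trans (cong (C.P *_) eq) (sym (uX Y.c Y.i Y.k C.vY≡))))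
    where
    uX : ∀ c i k {Q} → c ^ i ≡ C.P * Q → c ^ (i + k) ≡ C.P * (Q * c ^ k)
    uX c i k {Q} e = trans (^-distribˡ-+-* c i k) (trans (cong (_* c ^ k) e) (*-assoc C.P Q (c ^ k)))

  ∣A-B∣≤ : ∣ A - B ∣ ≤ 2 * r ^ Y.i
  ∣A-B∣≤ = begin
    ∣ A - B ∣                                    ≤⟨ ∣-∣-triangle A E B ⟩
    ∣ A - E ∣ + ∣ E - B ∣                        ≡⟨ cong₂ _+_ (dist (q ^ X.i) X.near) (trans (cong (∣_- B ∣) E≡) (trans (∣-∣-comm (r ^ Y.i * Y.D) B) (dist (r ^ Y.i) Y.near))) ⟩
    q ^ X.i + r ^ Y.i                            ≤⟨ +-monoˡ-≤ (r ^ Y.i) Q≤Q ⟩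
    r ^ Y.i + r ^ Y.i                            ≡⟨ cong (r ^ Y.i +_) (sym (+-identityʳ _)) ⟩
    2 * r ^ Y.i                                  ∎
    where
    open ≤-Reasoning
    dist : ∀ Q {m D} → Near m D → ∣ Q * m - Q * D ∣ ≡ Q
    dist Q {m} {D} nr = trans (sym (*-distribˡ-∣-∣ Q m D)) (trans (cong (Q *_) (Near-∣-∣ nr)) (*-identityʳ Q))

  3t : LX.t ≤ 3 * LY.t
  3t = Ordered.tX≤3tY abc X Y bigX bigY

  -- ABC for `A` and `B`: the factor r ^ iY of the difference cancels against the one in `B`,
  -- leaving cY ^ kY below p q r up to the error.
  N*t≤R : N * LY.t ≤ N * R + 10 * LY.t
  N*t≤R = arith-I N κ LY.t R (L (r ^ Y.i)) 1≤N bigY h₀ R≤3t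
    (≤-trans (m≤m+n _ (L h)) (≤-trans LQ+Lh≤ (≤-trans (LX.LD≤2t {κ} bigX) (≤-trans (*-monoʳ-≤ 2 3t) (≤-reflexive (sym (*-assoc 2 3 LY.t)))))))
    where
    open ≤-Reasoning
    1≤Q = 1≤^ Y.i C.1≤r
    eq : ∀ n r q → r + 2 + (n + q + 1) + 1 ≡ r + q + n + 4
    eq = solve-∀
    h₀ : N * (L (r ^ Y.i) + LY.t) ≤ (N + 1) * (R + L (r ^ Y.i) + N + 4) + N * κ
    h₀ = begin
      N * (L (r ^ Y.i) + LY.t)                                 ≤⟨ *-monoʳ-≤ N (≤-trans (+-monoʳ-≤ (L (r ^ Y.i)) LY.t≤Lcᵏ) (L-*-≥ 1≤Q (<⇒≤ Y.2≤cᵏ))) ⟩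
      N * L B                                                  ≤⟨ proj₂ (abc A B (p * q * r) (1≤* (1≤^ X.i C.1≤q) (<⇒≤ X.2≤cᵏ)) (1≤* 1≤Q (<⇒≤ Y.2≤cᵏ)) 1≤pqr A≢B
                                                                    (⊑-* (⊑-^ X.i (⊑-*ʳ r (∣⇒⊑ (n∣m*n p)))) (⊑-^ X.k cX⊑))
                                                                    (⊑-* (⊑-^ Y.i (∣⇒⊑ (n∣m*n (p * q)))) (⊑-^ Y.k cY⊑))) ⟩
      (N + 1) * L (p * q * r * ∣ A - B ∣) + N * κ              ≤⟨ +-monoˡ-≤ (N * κ) (*-monoʳ-≤ (N + 1) (begin
        L (p * q * r * ∣ A - B ∣)                   ≤⟨ L-mono (*-monoʳ-≤ (p * q * r) ∣A-B∣≤) ⟩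
        L (p * q * r * (2 * r ^ Y.i))               ≤⟨ L-*-≤ 1≤pqr (1≤* {2} (s≤s z≤n) 1≤Q) ⟩
        L (p * q * r) + L (2 * r ^ Y.i) + 1         ≤⟨ +-monoˡ-≤ 1 (+-mono-≤ Lpqr≤ (≤-trans (L-*-≤ (s≤s z≤n) 1≤Q) (≤-reflexive (cong (λ z → z + L (r ^ Y.i) + 1) L2≡N)))) ⟩
        R + 2 + (N + L (r ^ Y.i) + 1) + 1           ≡⟨ eq N R (L (r ^ Y.i)) ⟩
        R + L (r ^ Y.i) + N + 4                     ∎)) ⟩
      (N + 1) * (R + L (r ^ Y.i) + N + 4) + N * κ              ∎

  -- ABC for cX ^ kX and DX = r ^ iY * h, with all primes in p q r h. Now `h` cancels and r ^ iY is
  -- left.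
  N*iy≤R : N * (Y.i * y) ≤ N * R + 10 * LY.t
  N*iy≤R = arith-II N κ LY.t R (L h) (Y.i * y) (L (X.c ^ X.k)) 1≤N bigY
    (≤-trans (power-log abc X (p * q * r * h) (1≤* 1≤pqr 1≤h) (⊑-*ʳ h cX⊑)
        (subst (_⊑ p * q * r * h) (sym C.DX≡) (⊑-* (⊑-*ʳ h (⊑-^ Y.i (∣⇒⊑ (n∣m*n (p * q))))) (∣⇒⊑ (n∣m*n (p * q * r))))))
      (+-monoˡ-≤ (N * κ) (*-monoʳ-≤ (N + 1) (≤-trans (L-*-≤ 1≤pqr 1≤h) (≤-trans (+-monoˡ-≤ 1 (+-monoˡ-≤ (L h) Lpqr≤)) (≤-reflexive (eq R (L h))))))))
    R≤3t
    (≤-trans (L-mono (subst (h ≤_) (sym C.DY≡) (m≤n*m h (q ^ X.i) {{>-nonZero (1≤^ X.i C.1≤q)}}))) (LY.LD≤2t {κ} bigY))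
    (≤-trans (+-monoˡ-≤ (L h) (L-^-≥ Y.i C.1≤r)) (≤-trans LQ+Lh≤ LX.LD≤Lcᵏ))
    where
    eq : ∀ r l → r + 2 + l + 1 ≡ r + l + 3
    eq = solve-∀

  bounds : Bounds X.i X.k LX.α Y.i Y.k LY.α
  bounds = record
    { π = π ; x = x ; y = y ; e = e ; f = f ; η = LY.t / 100
    ; 1≤e = C.1≤e ; 1≤f = C.1≤f ; e⊥f = C.e⊥f ; ei≡fi = C.ei≡fi
    ; 100η≤ = subst (_≤ LY.t) (*-comm (LY.t / 100) 100) (m/n*n≤m LY.t 100)
    ; eπ+x≤ = base-log e C.cX≡ C.1≤q
    ; fπ+y≤ = base-log f C.cY≡ C.1≤r
    ; ≤fπ+y = base-log≤
    ; t≤R = round LY.t R LY.t N*t≤R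
    ; iy≤R = round (Y.i * y) R LY.t N*iy≤R
    ; ix≤t = round (X.i * x) LY.t LY.t
        (≤-trans (*-monoʳ-≤ N ix≤LD) (≤-trans (LY.N*LD≤ {κ} bigY) (+-monoʳ-≤ (N * LY.t) (*-monoˡ-≤ LY.t (m≤m+n 2 8)))))
    ; t≤t = round LY.t LX.t LY.t (arith-T N LY.t LX.t (L X.D) (L Y.D) (LY.N*t≤ {κ} bigY) (L-mono D≤) (LX.N*LD≤ {κ} bigX) 3t)
    }

-- Inequalities between exponents

ratio-F : ∀ kX nX αX kY nY αY →
  1 ≤ αX →
  100 * (kX * αX) ≤ 100 * (αY + kY * αY) + kY * αY →
  100 * (nY * αY) ≤ 100 * (nX * αX) + nX * αX →
  40 * (kX * nY) ≤ 41 * ((1 + kY) * nX)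
ratio-F kX nX αX kY nY αY a p s = ≮⇒≥ λ (hg : suc (41 * ((1 + kY) * nX)) ≤ 40 * (kX * nY)) → sum-absurd (249 + 49 * kY * nX * αX + 150 * nX * αX)
  (250 · a ⊹ (100 * nY) · p ⊹ 100 · s ⊹ (101 * kY) · s ⊹ (250 * αX) · hg)
  (solve (kX ∷ nX ∷ αX ∷ kY ∷ nY ∷ αY ∷ []))

ratio-T : ∀ kX nX αX kY nY αY η →
  1 ≤ αY →
  kY * αY ≤ kX * αX + η →
  100 * η ≤ kY * αY →
  100 * (nX * αX) ≤ 100 * (nY * αY) + nY * αY →
  40 * (kY * nX) ≤ 41 * (kX * nY)
ratio-T kX nX αX kY nY αY η a h e s = ≮⇒≥ λ (hg : suc (41 * (kX * nY)) ≤ 40 * (kY * nX)) → sum-absurd (98 + 19 * kX * nY * αY)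
  (99 · a ⊹ (4000 * nX) · h ⊹ (40 * nX) · e ⊹ (40 * kX) · s ⊹ (99 * αY) · hg)
  (solve (kX ∷ nX ∷ αX ∷ kY ∷ nY ∷ αY ∷ η ∷ []))

ratio-B : ∀ nX αX kY nY αY η →
  1 ≤ αY →
  kY * αY ≤ αX + αY + η →
  100 * η ≤ kY * αY →
  100 * (nX * αX) ≤ 100 * (nY * αY) + nY * αY →
  40 * (kY * nX) ≤ 41 * (nX + nY)
ratio-B nX αX kY nY αY η a h e s = ≮⇒≥ λ (hg : suc (41 * (nX + nY)) ≤ 40 * (kY * nX)) → sum-absurd (98 + 59 * nX * αY + 19 * nY * αY)
  (99 · a ⊹ (4000 * nX) · h ⊹ (40 * nX) · e ⊹ 40 · s ⊹ (99 * αY) · hg)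
  (solve (nX ∷ αX ∷ kY ∷ nY ∷ αY ∷ η ∷ []))

ratio-C : ∀ iX kY αY x η →
  1 ≤ αY →
  kY * αY ≤ x + αY + η →
  iX * x ≤ kY * αY + η →
  100 * η ≤ kY * αY →
  99 * (iX * kY) ≤ 100 * iX + 101 * kY
ratio-C iX kY αY x η a h l e = ≮⇒≥ λ (hg : suc (100 * iX + 101 * kY) ≤ 99 * (iX * kY)) → sum-absurd (0)
  (a ⊹ (100 * iX) · h ⊹ 100 · l ⊹ iX · e ⊹ e ⊹ αY · hg)
  (solve (iX ∷ kY ∷ αY ∷ x ∷ η ∷ []))

cofactor-i≥2-k≥3 : ∀ i k →
  99 * ((2 + i) * (3 + k)) ≤ 100 * (2 + i) + 101 * (3 + k) →
  ⊥
cofactor-i≥2-k≥3 i k h = sum-absurd (90 + 197 * i + 99 * i * k + 97 * k)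
  (h)
  (solve (i ∷ k ∷ []))

cofactor-i≥3-k≡2 : ∀ i →
  99 * ((3 + i) * 2) ≤ 100 * (3 + i) + 101 * 2 →
  ⊥
cofactor-i≥3-k≡2 i h = sum-absurd (91 + 98 * i)
  (h)
  (solve (i ∷ []))

sum-i≡1-k≥3 : ∀ k m →
  40 * ((3 + k) * (3 + m)) ≤ 41 * (3 + m + (1 + (3 + k))) →
  ⊥
sum-i≡1-k≥3 k m h = sum-absurd (72 + 79 * k + 40 * k * m + 79 * m)
  (h)
  (solve (k ∷ m ∷ []))

sum-i≡1-k≡2 : ∀ m →
  40 * (2 * (4 + m)) ≤ 41 * (4 + m + (1 + 2)) →
  ⊥
sum-i≡1-k≡2 m h = sum-absurd (32 + 39 * m)
  (h)
  (solve (m ∷ []))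

sum-i≡2-k≥3 : ∀ k m →
  40 * ((3 + k) * (3 + m)) ≤ 41 * (3 + m + (2 + (3 + k))) →
  ⊥
sum-i≡2-k≥3 k m h = sum-absurd (31 + 79 * k + 40 * k * m + 79 * m)
  (h)
  (solve (k ∷ m ∷ []))

power-i≡1 : ∀ k m →
  40 * ((1 + k) * (5 + m + 2)) ≤ 41 * ((1 + 2) * (1 + (1 + k))) →
  ⊥
power-i≡1 k m h = sum-absurd (33 + 157 * k + 40 * k * m + 40 * m)
  (h)
  (solve (k ∷ m ∷ []))

power-i≡2 : ∀ k m →
  40 * ((2 + k) * (5 + m + 2)) ≤ 41 * ((1 + 2) * (2 + (2 + k))) →
  ⊥
power-i≡2 k m h = sum-absurd (67 + 157 * k + 40 * k * m + 80 * m)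
  (h)
  (solve (k ∷ m ∷ []))

divisible-i≡1-k≡2 : ∀ e →
  40 * ((2) * ((3 + e) * (1) + 1)) ≤ 41 * ((1 + 1) * (1 + (2))) →
  ⊥
divisible-i≡1-k≡2 e h = sum-absurd (73 + 80 * e)
  (h)
  (solve (e ∷ []))

divisible-i≡1-k≥3 : ∀ k e →
  40 * ((3 + k) * ((2 + e) * (1) + 1)) ≤ 41 * ((1 + 1) * (1 + (3 + k))) →
  ⊥
divisible-i≡1-k≥3 k e h = sum-absurd (31 + 120 * e + 40 * e * k + 38 * k)
  (h)
  (solve (k ∷ e ∷ []))

divisible-e≥3 : ∀ k e i →
  40 * ((1 + k) * ((3 + e) * (2 + i) + 1)) ≤ 41 * ((1 + 1) * (2 + i + (1 + k))) →
  ⊥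
divisible-e≥3 k e i h = sum-absurd (33 + 80 * e + 40 * e * i + 40 * e * i * k + 80 * e * k + 38 * i + 120 * i * k + 198 * k)
  (h)
  (solve (k ∷ e ∷ i ∷ []))

divisible-e≡2-k≥2 : ∀ k i →
  40 * ((2 + k) * ((2) * (2 + i) + 1)) ≤ 41 * ((1 + 1) * (2 + i + (2 + k))) →
  ⊥
divisible-e≡2-k≥2 k i h = sum-absurd (71 + 78 * i + 80 * i * k + 118 * k)
  (h)
  (solve (k ∷ i ∷ []))

divisible-e≡1-k≡3 : ∀ i →
  40 * ((3) * ((1) * (4 + i) + 1)) ≤ 41 * ((1 + 1) * (4 + i + (3))) →
  ⊥
divisible-e≡1-k≡3 i h = sum-absurd (25 + 38 * i)
  (h)
  (solve (i ∷ []))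

divisible-e≡1-k≡4 : ∀ i →
  40 * ((4) * ((1) * (3 + i) + 1)) ≤ 41 * ((1 + 1) * (3 + i + (4))) →
  ⊥
divisible-e≡1-k≡4 i h = sum-absurd (65 + 78 * i)
  (h)
  (solve (i ∷ []))

divisible-e≡1-k≥5 : ∀ k i →
  40 * ((5 + k) * ((1) * (2 + i) + 1)) ≤ 41 * ((1 + 1) * (2 + i + (5 + k))) →
  ⊥
divisible-e≡1-k≥5 k i h = sum-absurd (25 + 118 * i + 40 * i * k + 38 * k)
  (h)
  (solve (k ∷ i ∷ []))

-- Up to the error, f ≥ 2 gives 2 π + y ≤ α ≤ π + x + y and hence α ≤ 2 x + y. So x and y cannot
-- both be small, whereas large i and j make them so. The next two lemmas balance the same
-- inequalities for smaller j.
nondivisible-i≥3-j≥4 : ∀ g π x y α η i j →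
  1 ≤ α →
  (2 + g) * π + y ≤ α →
  1 * α ≤ π + x + y + η →
  (4 + j) * y ≤ π + x + y + η →
  (3 + i) * x ≤ 1 * α + η →
  100 * η ≤ 1 * α →
  ⊥
nondivisible-i≥3-j≥4 g π x y α η i j a l t yy xx e = sum-absurd (16 + 300 * g * π + 200 * i * x + 75 * j * y)
  (17 · a ⊹ 300 · l ⊹ 525 · t ⊹ 75 · yy ⊹ 200 · xx ⊹ 8 · e)
  (solve (g ∷ π ∷ x ∷ y ∷ α ∷ η ∷ i ∷ j ∷ []))

nondivisible-i≥4-j≡3 : ∀ g π x y α η i →
  1 ≤ α →
  (2 + g) * π + y ≤ α →
  1 * α ≤ π + x + y + η →
  (3) * y ≤ π + x + y + η →
  (4 + i) * x ≤ 1 * α + η →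
  100 * η ≤ 1 * α →
  ⊥
nondivisible-i≥4-j≡3 g π x y α η i a l t yy xx e = sum-absurd (16 + 120 * g * π + 60 * i * x)
  (17 · a ⊹ 120 · l ⊹ 200 · t ⊹ 40 · yy ⊹ 60 · xx ⊹ 3 · e)
  (solve (g ∷ π ∷ x ∷ y ∷ α ∷ η ∷ i ∷ []))

nondivisible-i≥5-j≡2 : ∀ g π x y α η i →
  1 ≤ α →
  (2 + g) * π + y ≤ α →
  1 * α ≤ π + x + y + η →
  (2) * y ≤ π + x + y + η →
  (5 + i) * x ≤ 1 * α + η →
  100 * η ≤ 1 * α →
  ⊥
nondivisible-i≥5-j≡2 g π x y α η i a l t yy xx e = sum-absurd (18 + 250 * g * π + 100 * i * x)
  (19 · a ⊹ 250 · l ⊹ 375 · t ⊹ 125 · yy ⊹ 100 · xx ⊹ 6 · e)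
  (solve (g ∷ π ∷ x ∷ y ∷ α ∷ η ∷ i ∷ []))

-- The case e = 2, f = 3. Up to the error, y ≤ π + x together with the two lower bounds forces 2 π +
-- x ≥ 2/3 αY, while the sizes allow αX at most 3/5 αY.
nondivisible-i≡3-j≡2 : ∀ π x y αX αY η m →
  1 ≤ αY →
  2 * π + x ≤ αX →
  αY ≤ 3 * π + y + η →
  1 * αY ≤ π + x + y + η →
  2 * y ≤ π + x + y + η →
  100 * η ≤ 1 * αY →
  100 * ((5 + m) * αX) ≤ 100 * (3 * αY) + 3 * αY →
  ⊥
nondivisible-i≡3-j≡2 π x y αX αY η m a lX u t yy e s1 = sum-absurd (70 + 300 * m * αX)
  (71 · a ⊹ 1500 · lX ⊹ 500 · u ⊹ 500 · t ⊹ 1000 · yy ⊹ 20 · e ⊹ 3 · s1)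
  (solve (π ∷ x ∷ y ∷ αX ∷ αY ∷ η ∷ m ∷ []))

nondivisible-i≡4-j≡2 : ∀ π x y αX αY η m →
  1 ≤ αY →
  1 * π + x ≤ αX →
  1 * αY ≤ π + x + y + η →
  2 * y ≤ π + x + y + η →
  100 * η ≤ 1 * αY →
  100 * ((7 + m) * αX) ≤ 100 * (3 * αY) + 3 * αY →
  ⊥
nondivisible-i≡4-j≡2 π x y αX αY η m a lX t yy e s1 = sum-absurd (39 + 100 * m * αX)
  (40 · a ⊹ 700 · lX ⊹ 350 · t ⊹ 350 · yy ⊹ 7 · e ⊹ s1)
  (solve (π ∷ x ∷ y ∷ αX ∷ αY ∷ η ∷ m ∷ []))

nondivisible-i≡2-j≡5 : ∀ π x y αX αY η →
  1 ≤ αY →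
  5 * π + x ≤ αX →
  αY ≤ 2 * π + y + η →
  1 * αY ≤ π + x + y + η →
  5 * y ≤ π + x + y + η →
  100 * η ≤ 1 * αY →
  100 * ((3) * αX) ≤ 100 * (6 * αY) + 6 * αY →
  ⊥
nondivisible-i≡2-j≡5 π x y αX αY η a lX u t yy e s1 = sum-absurd (104)
  (105 · a ⊹ 300 · lX ⊹ 600 · u ⊹ 120 · t ⊹ 180 · yy ⊹ 9 · e ⊹ s1)
  (solve (π ∷ x ∷ y ∷ αX ∷ αY ∷ η ∷ []))

exponents-53-32 : ∀ π x y αX αY η →
  1 ≤ αY →
  2 * π + x ≤ αX →
  αY ≤ 3 * π + y + η →
  1 * αY ≤ π + x + y + η →
  2 * y ≤ π + x + y + η →
  100 * η ≤ 1 * αY →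
  100 * ((5) * αX) ≤ 100 * (3 * αY) + 3 * αY →
  ⊥
exponents-53-32 π x y αX αY η a lX u t yy e s1 = sum-absurd (70)
  (71 · a ⊹ 1500 · lX ⊹ 500 · u ⊹ 500 · t ⊹ 1000 · yy ⊹ 20 · e ⊹ 3 · s1)
  (solve (π ∷ x ∷ y ∷ αX ∷ αY ∷ η ∷ []))

nondivisible-i≡2-j≥6 : ∀ j →
  40 * (1 * (6 + j + 1)) ≤ 41 * ((1 + 1) * (2 + 1)) →
  ⊥
nondivisible-i≡2-j≥6 j h = sum-absurd (33 + 40 * j)
  (h)
  (solve (j ∷ []))

nondivisible-i≡2-k≥3 : ∀ j k →
  40 * ((3 + k) * (3 + j + 1)) ≤ 41 * ((1 + 1) * (2 + (3 + k))) →
  ⊥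
nondivisible-i≡2-k≥3 j k h = sum-absurd (69 + 120 * j + 40 * j * k + 78 * k)
  (h)
  (solve (j ∷ k ∷ []))

-- Exponents of three solutions

¬coprime : ∀ d {m n} → 2 ≤ d → Coprime m n → d ∣ m → d ∣ n → ⊥
¬coprime d 2≤d co x y = <-irrefl (sym (co (x , y))) 2≤d

-- What is kept of a solution with n ≥ 3 once `c` is replaced by its logarithm: from here on only
-- linear inequalities and divisibility of exponents matter.
record Size : Set where
  field
    i k α : ℕ
    1≤i : 1 ≤ i
    1≤k : 1 ≤ k
    1≤α : 1 ≤ α
    i⊥k : Coprime i k
    3≤n : 3 ≤ i + k
  n : ℕ
  n = i + k

record Ratio (X Y : Size) : Set where
  private
    module X = Size X
    module Y = Size Y
  field
    power-ratio : 100 * (X.k * X.α) ≤ 100 * (Y.α + Y.k * Y.α) + Y.k * Y.α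
    size-ratio : 100 * (X.n * X.α) ≤ 100 * (Y.n * Y.α) + Y.n * Y.α

BoundsOf : Size → Size → Set
BoundsOf X Y = Bounds X.i X.k X.α Y.i Y.k Y.α
  where
  module X = Size X
  module Y = Size Y

-- Obtained by eliminating the logarithms through αX : αY = nY : nX. The ratio 41 / 40 covers the
-- accumulated errors of one per cent.
PowerBound OrderBound SumBound : (kX nX kY nY : ℕ) → Set
PowerBound kX nX kY nY = 40 * (kX * nY) ≤ 41 * ((1 + kY) * nX)
OrderBound kX nX kY nY = 40 * (kY * nX) ≤ 41 * (kX * nY)
SumBound kX nX kY nY = 40 * (kY * nX) ≤ 41 * (nX + nY)

CofactorBound : (iX kY : ℕ) → Set
CofactorBound iX kY = 99 * (iX * kY) ≤ 100 * iX + 101 * kY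

module _ {X Y : Size} (XY : Ratio X Y) (YX : Ratio Y X) where
  private
    module X = Size X
    module Y = Size Y

  ratio⇒PowerBound : PowerBound X.k X.n Y.k Y.n
  ratio⇒PowerBound = ratio-F X.k X.n X.α Y.k Y.n Y.α X.1≤α (Ratio.power-ratio XY) (Ratio.size-ratio YX)

  module _ (b : BoundsOf X Y) where
    open Bounds b

    π+y≤ : π + y ≤ Y.α
    π+y≤ = ≤-trans (+-monoˡ-≤ y (m≤n*m π f {{>-nonZero 1≤f}})) fπ+y≤

    x≤ : x ≤ X.α
    x≤ = ≤-trans (m≤n+m x (e * π)) eπ+x≤

    t≤x+α : Y.k * Y.α ≤ x + Y.α + η
    t≤x+α = ≤-trans t≤R (+-monoˡ-≤ η (≤-trans (≤-reflexive (rot π x y)) (+-monoʳ-≤ x π+y≤)))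
      where
      rot : ∀ a b c → a + b + c ≡ b + (a + c)
      rot = solve-∀

    bounds⇒OrderBound : OrderBound X.k X.n Y.k Y.n
    bounds⇒OrderBound = ratio-T X.k X.n X.α Y.k Y.n Y.α η Y.1≤α t≤t 100η≤ (Ratio.size-ratio XY)

    bounds⇒SumBound : SumBound X.k X.n Y.k Y.n
    bounds⇒SumBound = ratio-B X.n X.α Y.k Y.n Y.α η Y.1≤α
      (≤-trans t≤x+α (+-monoˡ-≤ η (+-monoˡ-≤ Y.α x≤))) 100η≤ (Ratio.size-ratio XY)

    bounds⇒CofactorBound : CofactorBound X.i Y.k
    bounds⇒CofactorBound = ratio-C X.i Y.k Y.α x η Y.1≤α t≤x+α ix≤t 100η≤

-- Up to errors i k ≤ i + k, that is (i - 1) (k - 1) ≤ 1.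
cofactor⇒ : ∀ i k → 1 ≤ i → 2 ≤ k → CofactorBound i k → i ≡ 1 ⊎ (i ≡ 2 × k ≡ 2)
cofactor⇒ 1 k _ _ _ = inj₁ refl
cofactor⇒ 2 2 _ _ _ = inj₂ (refl , refl)
cofactor⇒ (suc (suc (suc i))) 2 _ _ h = ⊥-elim (cofactor-i≥3-k≡2 i h)
cofactor⇒ (suc (suc i)) (suc (suc (suc k))) _ _ h = ⊥-elim (cofactor-i≥2-k≥3 i k h)
cofactor⇒ _ 1 _ (s≤s ()) _

-- Up to errors (k - 1) (nX - 1) ≤ i + 1 with i ≤ 2. Beyond k = 1 this leaves only equal sums 3 and
-- the non-coprime exponents (2 , 2).
sum⇒ : ∀ {kX} nX i k → 3 ≤ nX → 3 ≤ i + k → 1 ≤ k → nX ≢ i + k → Coprime i k → SumBound kX nX k (i + k) → i ≡ 1 ⊎ i ≡ 2 → i ≡ 2 × k ≡ 1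
sum⇒ 1 _ _ (s≤s ()) _ _ _ _ _ _
sum⇒ 2 _ _ (s≤s (s≤s ())) _ _ _ _ _ _
sum⇒ nX 1 1 _ (s≤s (s≤s ())) _ _ _ _ (inj₁ refl)
sum⇒ 3 1 2 _ _ _ ne _ _ (inj₁ refl) = ⊥-elim (ne refl)
sum⇒ (suc (suc (suc (suc m)))) 1 2 _ _ _ _ _ h (inj₁ refl) = ⊥-elim (sum-i≡1-k≡2 m h)
sum⇒ (suc (suc (suc m))) 1 (suc (suc (suc k))) (s≤s (s≤s (s≤s _))) _ _ _ _ h (inj₁ refl) = ⊥-elim (sum-i≡1-k≥3 k m h)
sum⇒ nX 2 1 _ _ _ _ _ _ (inj₂ refl) = refl , refl
sum⇒ nX 2 2 _ _ _ _ co _ (inj₂ refl) = ⊥-elim (¬coprime 2 ≤-refl co ∣-refl ∣-refl)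
sum⇒ (suc (suc (suc m))) 2 (suc (suc (suc k))) (s≤s (s≤s (s≤s _))) _ _ _ _ h (inj₂ refl) = ⊥-elim (sum-i≡2-k≥3 k m h)

-- The middle solution has (n , i) = (3 , 2) here.
top-k≢2 : ∀ ia ka ic → 1 ≤ ka → ia + ka ≢ 3 → ia ≡ 1 ⊎ ia ≡ 2 → Coprime ic 2 →
  OrderBound 1 3 2 (ic + 2) → PowerBound ka (ia + ka) 2 (ic + 2) → ⊥
top-k≢2 ia ka 0 _ _ _ _ t _ = <⇒≱ (m≤m+n 83 157) t
top-k≢2 ia ka 1 _ _ _ _ t _ = <⇒≱ (m≤m+n 124 116) t
top-k≢2 ia ka 2 _ _ _ _ t _ = <⇒≱ (m≤m+n 165 75) t
top-k≢2 ia ka 3 _ _ _ _ t _ = <⇒≱ (m≤m+n 206 34) t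
top-k≢2 ia ka 4 _ _ _ co _ _ = ¬coprime 2 ≤-refl co (divides 2 refl) ∣-refl
top-k≢2 1 (suc ka) (suc (suc (suc (suc (suc m))))) _ _ (inj₁ refl) _ _ h = power-i≡1 ka m h
top-k≢2 2 1 (suc (suc (suc (suc (suc m))))) _ ne (inj₂ refl) _ _ _ = ne refl
top-k≢2 2 (suc (suc ka)) (suc (suc (suc (suc (suc m))))) _ _ (inj₂ refl) _ _ h = power-i≡2 ka m h

i≤2-cases : ∀ {i k} → i ≡ 1 ⊎ (i ≡ 2 × k ≡ 2) → i ≡ 1 ⊎ i ≡ 2
i≤2-cases (inj₁ e) = inj₁ e
i≤2-cases (inj₂ (e , _)) = inj₂ e

-- The exponents compatible with those of a solution with i = ic and k = 1 that has the larger c ^ i.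
data Class (iX kX ic : ℕ) : Set where
  equal    : kX ≡ 2 → iX ≡ ic → Class iX kX ic
  five-two : kX ≡ 3 → iX ≡ 2 → ic ≡ 2 → Class iX kX ic
  double   : kX ≡ 1 → ic ≡ 2 * iX → Class iX kX ic
  special  : kX ≡ 1 → iX ≡ 2 → ic ≡ 3 → Class iX kX ic

-- The case f = 1, where iX divides iY. Up to errors the bound reads k (e i + 1) ≤ 2 (i + k), which
-- confines e to 1 or 2.
classify-∣ : ∀ e i k → 1 ≤ e → 1 ≤ i → 1 ≤ k → Coprime i k → 3 ≤ i + k → 2 ≤ e * i → i + k ≢ e * i + 1 →
  PowerBound k (i + k) 1 (e * i + 1) → Class i k (e * i)
classify-∣ e 1 1 _ _ _ _ (s≤s (s≤s ())) _ _ _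
classify-∣ 1 1 k _ _ _ _ _ (s≤s ()) _ _
classify-∣ 2 1 2 _ _ _ _ _ _ ne _ = ⊥-elim (ne refl)
classify-∣ (suc (suc (suc e))) 1 2 _ _ _ _ _ _ _ h = ⊥-elim (divisible-i≡1-k≡2 e h)
classify-∣ (suc (suc e)) 1 (suc (suc (suc k))) _ _ _ _ _ _ _ h = ⊥-elim (divisible-i≡1-k≥3 k e h)
classify-∣ 1 (suc (suc i)) 1 _ _ _ _ _ _ ne _ = ⊥-elim (ne (cong (_+ 1) (sym (+-identityʳ (suc (suc i))))))
classify-∣ 1 (suc (suc i)) 2 _ _ _ _ _ _ _ _ = equal refl (sym (+-identityʳ _))
classify-∣ 1 2 3 _ _ _ _ _ _ _ _ = five-two refl refl refl
classify-∣ 1 3 3 _ _ _ co _ _ _ _ = ⊥-elim (¬coprime 3 (m≤m+n 2 1) co ∣-refl ∣-refl)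
classify-∣ 1 (suc (suc (suc (suc i)))) 3 _ _ _ _ _ _ _ h = ⊥-elim (divisible-e≡1-k≡3 i h)
classify-∣ 1 2 4 _ _ _ co _ _ _ _ = ⊥-elim (¬coprime 2 ≤-refl co ∣-refl (divides 2 refl))
classify-∣ 1 (suc (suc (suc i))) 4 _ _ _ _ _ _ _ h = ⊥-elim (divisible-e≡1-k≡4 i h)
classify-∣ 1 (suc (suc i)) (suc (suc (suc (suc (suc k))))) _ _ _ _ _ _ _ h = ⊥-elim (divisible-e≡1-k≥5 k i h)
classify-∣ 2 (suc (suc i)) 1 _ _ _ _ _ _ _ _ = double refl refl
classify-∣ 2 (suc (suc i)) (suc (suc k)) _ _ _ _ _ _ _ h = ⊥-elim (divisible-e≡2-k≥2 k i h)
classify-∣ (suc (suc (suc e))) (suc (suc i)) (suc k) _ _ _ _ _ _ _ h = ⊥-elim (divisible-e≥3 k e i h)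

module _ {X Y : Size} (XY : Ratio X Y) (YX : Ratio Y X) (b : BoundsOf X Y)
  (kY≡1 : Size.k Y ≡ 1) (n≢ : Size.n X ≢ Size.n Y) where
  private
    module X = Size X
    module Y = Size Y
  open Bounds b

  2≤iY : 2 ≤ Y.i
  2≤iY = s≤s⁻¹ (≤-trans Y.3≤n (≤-reflexive (trans (cong (Y.i +_) kY≡1) (+-comm Y.i 1))))

  FXY : PowerBound X.k X.n 1 (Y.i + 1)
  FXY = subst (λ k → PowerBound X.k X.n k (Y.i + k)) kY≡1 (ratio⇒PowerBound XY YX)

  TXY : OrderBound X.k X.n 1 (Y.i + 1)
  TXY = subst (λ k → OrderBound X.k X.n k (Y.i + k)) kY≡1 (bounds⇒OrderBound XY YX b)

  sr : 100 * (X.n * X.α) ≤ 100 * ((Y.i + 1) * Y.α) + (Y.i + 1) * Y.α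
  sr = subst (λ k → 100 * (X.n * X.α) ≤ 100 * ((Y.i + k) * Y.α) + (Y.i + k) * Y.α) kY≡1 (Ratio.size-ratio XY)

  h-t : 1 * Y.α ≤ π + x + y + η
  h-t = subst (λ k → k * Y.α ≤ π + x + y + η) kY≡1 t≤R

  h-x : X.i * x ≤ 1 * Y.α + η
  h-x = subst (λ k → X.i * x ≤ k * Y.α + η) kY≡1 ix≤t

  h-η : 100 * η ≤ 1 * Y.α
  h-η = subst (λ k → 100 * η ≤ k * Y.α) kY≡1 100η≤

  classify : Class X.i X.k Y.i
  classify = go e f X.i X.k Y.i 1≤e 1≤f X.1≤i X.1≤k X.i⊥k X.3≤n 2≤iY
    (λ eq → n≢ (trans eq (cong (Y.i +_) (sym kY≡1)))) e⊥f ei≡fi FXY TXY eπ+x≤ fπ+y≤ ≤fπ+y iy≤R h-x sr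
    where
    Sizes : (iX kX iY : ℕ) → Set
    Sizes iX kX iY = 100 * ((iX + kX) * X.α) ≤ 100 * ((iY + 1) * Y.α) + (iY + 1) * Y.α
    go : ∀ e f iX kX iY → 1 ≤ e → 1 ≤ f → 1 ≤ iX → 1 ≤ kX → Coprime iX kX → 3 ≤ iX + kX → 2 ≤ iY →
      iX + kX ≢ iY + 1 → Coprime e f → e * iX ≡ f * iY → PowerBound kX (iX + kX) 1 (iY + 1) → OrderBound kX (iX + kX) 1 (iY + 1) →
      e * π + x ≤ X.α → f * π + y ≤ Y.α → Y.α ≤ f * π + y + η → iY * y ≤ π + x + y + η → iX * x ≤ 1 * Y.α + η →
      Sizes iX kX iY → Class iX kX iY
    go e 1 iX kX iY 1≤e _ 1≤iX 1≤kX co 3≤n 2≤iY ne _ eq hF _ _ _ _ _ _ _ =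
      subst (Class iX kX) eq′ (classify-∣ e iX kX 1≤e 1≤iX 1≤kX co 3≤n (subst (2 ≤_) (sym eq′) 2≤iY)
        (λ h → ne (trans h (cong (_+ 1) eq′))) (subst (λ z → PowerBound kX (iX + kX) 1 (z + 1)) (sym eq′) hF))
      where
      eq′ : e * iX ≡ iY
      eq′ = trans eq (*-identityˡ iY)
    -- Now f ≥ 2, and coprimality with `e` makes `f` divide iX.
    go e f@(suc (suc g)) iX kX iY _ _ 1≤iX 1≤kX co 3≤n 2≤iY _ e⊥f eq hF hT lX lY u hy hx s =
      nondivisible iX iY (coprime-divisor (Cop.sym e⊥f) (divides iY (trans eq (*-comm f iY)))) 1≤iX 2≤iY eq hF hT hy hx s co 3≤n
      where
      nondivisible : ∀ iX iY → f ∣ iX → 1 ≤ iX → 2 ≤ iY → e * iX ≡ f * iY → PowerBound kX (iX + kX) 1 (iY + 1) → OrderBound kX (iX + kX) 1 (iY + 1) →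
        iY * y ≤ π + x + y + η → iX * x ≤ 1 * Y.α + η → Sizes iX kX iY →
        Coprime iX kX → 3 ≤ iX + kX → Class iX kX iY
      nondivisible 1 iY f∣ _ _ _ _ _ _ _ _ _ _ with ∣⇒≤ f∣
      ... | s≤s ()
      nondivisible _ 1 _ _ (s≤s ()) _ _ _ _ _ _ _ _
      nondivisible (suc (suc (suc i))) (suc (suc (suc (suc j)))) _ _ _ _ _ _ hy hx _ _ _ =
        ⊥-elim (nondivisible-i≥3-j≥4 g π x y Y.α η i j Y.1≤α lY h-t hy hx h-η)
      nondivisible (suc (suc (suc (suc i)))) 3 _ _ _ _ _ _ hy hx _ _ _ =
        ⊥-elim (nondivisible-i≥4-j≡3 g π x y Y.α η i Y.1≤α lY h-t hy hx h-η)
      nondivisible (suc (suc (suc (suc (suc i))))) 2 _ _ _ _ _ _ hy hx _ _ _ =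
        ⊥-elim (nondivisible-i≥5-j≡2 g π x y Y.α η i Y.1≤α lY h-t hy hx h-η)
      nondivisible 3 3 _ _ _ eq _ _ _ _ _ _ _ =
        ⊥-elim (¬coprime f (s≤s (s≤s z≤n)) e⊥f (∣-reflexive (sym (*-cancelʳ-≡ e f 3 eq))) ∣-refl)
      nondivisible 3 2 f∣ _ _ eq _ hT hy _ s _ _ = three-two g e kX f∣ eq hT hy s lX u
        where
        three-two : ∀ g e kX → suc (suc g) ∣ 3 → e * 3 ≡ suc (suc g) * 2 → OrderBound kX (3 + kX) 1 3 →
          2 * y ≤ π + x + y + η → Sizes 3 kX 2 →
          e * π + x ≤ X.α → Y.α ≤ suc (suc g) * π + y + η → Class 3 kX 2
        three-two 0 e kX f∣ _ _ _ _ _ _ = ⊥-elim (from-no (2 ∣? 3) f∣)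
        three-two (suc (suc g)) e kX f∣ _ _ _ _ _ _ with ∣⇒≤ f∣
        ... | s≤s (s≤s (s≤s ()))
        three-two 1 e 0 _ _ hT _ _ _ _ = ⊥-elim (<⇒≱ (m≤m+n 1 119) hT)
        three-two 1 e 1 _ _ hT _ _ _ _ = ⊥-elim (<⇒≱ (m≤m+n 124 36) hT)
        three-two 1 e (suc (suc m)) _ eq _ hy s lX u with *-cancelʳ-≡ e 2 3 eq
        ... | refl = ⊥-elim (nondivisible-i≡3-j≡2 π x y X.α Y.α η m Y.1≤α lX u h-t hy h-η s)
      nondivisible 4 2 f∣ _ _ eq _ hT hy _ s co _ = four-two g e kX f∣ e⊥f co eq hT hy s lX
        where
        four-two : ∀ g e kX → suc (suc g) ∣ 4 → Coprime e (suc (suc g)) → Coprime 4 kX → e * 4 ≡ suc (suc g) * 2 →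
          OrderBound kX (4 + kX) 1 3 → 2 * y ≤ π + x + y + η → Sizes 4 kX 2 → e * π + x ≤ X.α → Class 4 kX 2
        four-two 1 e kX f∣ _ _ _ _ _ _ _ = ⊥-elim (from-no (3 ∣? 4) f∣)
        four-two 2 e kX _ e⊥f _ eq _ _ _ _ with *-cancelʳ-≡ e 2 4 eq
        ... | refl = ⊥-elim (¬coprime 2 ≤-refl e⊥f ∣-refl (divides 2 refl))
        four-two (suc (suc (suc g))) e kX f∣ _ _ _ _ _ _ _ with ∣⇒≤ f∣
        ... | s≤s (s≤s (s≤s (s≤s ())))
        four-two 0 e 0 _ _ _ _ hT _ _ _ = ⊥-elim (<⇒≱ (m≤m+n 1 159) hT)
        four-two 0 e 1 _ _ _ _ hT _ _ _ = ⊥-elim (<⇒≱ (m≤m+n 124 76) hT)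
        four-two 0 e 2 _ _ co _ _ _ _ _ = ⊥-elim (¬coprime 2 ≤-refl co (divides 2 refl) ∣-refl)
        four-two 0 e (suc (suc (suc m))) _ _ _ eq _ hy s lX with *-cancelʳ-≡ e 1 4 eq
        ... | refl = ⊥-elim (nondivisible-i≡4-j≡2 π x y X.α Y.α η m Y.1≤α lX h-t hy h-η s)
      nondivisible 2 iY f∣ _ 2≤iY eq hF _ hy _ s co 3≤n = two iY g kX f∣ 2≤iY e⊥f co 3≤n eq hF hy s lX u
        where
        two : ∀ iY g kX → suc (suc g) ∣ 2 → 2 ≤ iY → Coprime e (suc (suc g)) → Coprime 2 kX → 3 ≤ 2 + kX →
          e * 2 ≡ suc (suc g) * iY → PowerBound kX (2 + kX) 1 (iY + 1) → iY * y ≤ π + x + y + η → Sizes 2 kX iY →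
          e * π + x ≤ X.α → Y.α ≤ suc (suc g) * π + y + η → Class 2 kX iY
        two iY (suc g) kX f∣ _ _ _ _ _ _ _ _ _ _ with ∣⇒≤ f∣
        ... | s≤s (s≤s ())
        two iY 0 0 _ _ _ _ (s≤s (s≤s ())) _ _ _ _ _ _
        two iY 0 2 _ _ _ co _ _ _ _ _ _ _ = ⊥-elim (¬coprime 2 ≤-refl co ∣-refl ∣-refl)
        -- Here (e , f) = (3 , 2). The two solutions alone give no contradiction, so this case is
        -- kept for the comparison with the third.
        two 3 0 1 _ _ _ _ _ _ _ _ _ _ _ = special refl refl refl
        two 5 0 1 _ _ _ _ _ eq _ hy s lX u with *-cancelʳ-≡ e 5 2 eq
        ... | refl = ⊥-elim (nondivisible-i≡2-j≡5 π x y X.α Y.α η Y.1≤α lX u h-t hy h-η s)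
        two (suc (suc (suc (suc (suc (suc j)))))) 0 1 _ _ _ _ _ _ hF _ _ _ _ = ⊥-elim (nondivisible-i≡2-j≥6 j hF)
        two (suc (suc (suc j))) 0 (suc (suc (suc k))) _ _ _ _ _ _ hF _ _ _ _ = ⊥-elim (nondivisible-i≡2-k≥3 j k hF)
        two 4 0 1 _ _ e⊥f _ _ eq _ _ _ _ _ with *-cancelʳ-≡ e 4 2 eq
        ... | refl = ⊥-elim (¬coprime 2 ≤-refl e⊥f (divides 2 refl) ∣-refl)
        two 2 0 kX _ _ e⊥f _ _ eq _ _ _ _ _ with *-cancelʳ-≡ e 2 2 eq
        ... | refl = ⊥-elim (¬coprime 2 ≤-refl e⊥f ∣-refl ∣-refl)
        two 1 _ _ _ (s≤s ()) _ _ _ _ _ _ _ _ _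

-- If the top solution `c` had k ≥ 2, the cofactor bounds would put the `i` of `a` and of `b` into
-- {1 , 2}. The sum bound for `a` and `b` then makes the exponents of `b` equal to (2 , 1) and k of
-- `c` equal to 2, which `top-k≢2` refutes.
top-k≡1 : ∀ {a b c : Size} → Size.n a ≢ Size.n b → Ratio a b → Ratio b a → Ratio a c → Ratio c a → Ratio b c → Ratio c b →
  BoundsOf a b → BoundsOf a c → BoundsOf b c → Size.k c ≡ 1
top-k≡1 {a} {b} {c} na≢nb ab ba ac ca bc cb Bab Bac Bbc with Size.k c ≟ 1
... | yes k≡1 = k≡1
... | no k≢1 = ⊥-elim (absurd (cofactor⇒ a.i c.k a.1≤i 2≤k (bounds⇒CofactorBound ac ca Bac)) (cofactor⇒ b.i c.k b.1≤i 2≤k (bounds⇒CofactorBound bc cb Bbc)))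
  where
  module a = Size a
  module b = Size b
  module c = Size c
  2≤k : 2 ≤ c.k
  2≤k = ≤∧≢⇒< c.1≤k (k≢1 ∘ sym)
  absurd : a.i ≡ 1 ⊎ (a.i ≡ 2 × c.k ≡ 2) → b.i ≡ 1 ⊎ (b.i ≡ 2 × c.k ≡ 2) → ⊥
  absurd ca′ cb′ = absurd′ cb′
    (sum⇒ {a.k} a.n b.i b.k a.3≤n b.3≤n b.1≤k na≢nb b.i⊥k (bounds⇒SumBound ab ba Bab) (i≤2-cases cb′))
    where
    absurd′ : b.i ≡ 1 ⊎ (b.i ≡ 2 × c.k ≡ 2) → b.i ≡ 2 × b.k ≡ 1 → ⊥
    absurd′ (inj₁ ib≡1) (ib≡2 , _) = from-no (1 ≟ 2) (trans (sym ib≡1) ib≡2)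
    absurd′ (inj₂ (_ , kc≡2)) (ib≡2 , kb≡1) =
      top-k≢2 a.i a.k c.i a.1≤k (λ e → na≢nb (trans e (sym nb≡3))) (i≤2-cases ca′) (subst (Coprime c.i) kc≡2 c.i⊥k)
        (subst₂ (λ kb nb → OrderBound kb nb 2 (c.i + 2)) kb≡1 nb≡3 (subst (λ k → OrderBound b.k b.n k (c.i + k)) kc≡2 (bounds⇒OrderBound bc cb Bbc)))
        (subst (λ k → PowerBound a.k a.n k (c.i + k)) kc≡2 (ratio⇒PowerBound ac ca))
      where
      nb≡3 : b.n ≡ 3
      nb≡3 = cong₂ _+_ ib≡2 kb≡1

-- Both `a` and `b` are classified against the same `c`. Equal classes give equal `n`. Unequal
-- classes clash through parity, coprimality or n ≥ 3, except when the exponents are (3 , 2) and (2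
-- , 1); these need the inequalities between `a` and `b` themselves.
no-three-sizes : ∀ {a b c : Size} → Size.n a ≢ Size.n b → Size.n a ≢ Size.n c → Size.n b ≢ Size.n c →
  Ratio a b → Ratio b a → Ratio a c → Ratio c a → Ratio b c → Ratio c b →
  BoundsOf a b → BoundsOf a c → BoundsOf b c → ⊥
no-three-sizes {a} {b} {c} na≢nb na≢nc nb≢nc ab ba ac ca bc cb Bab Bac Bbc =
  absurd (classify ac ca Bac kc≡1 na≢nc) (classify bc cb Bbc kc≡1 nb≢nc)
  where
  module a = Size a
  module b = Size b
  module c = Size c
  kc≡1 = top-k≡1 na≢nb ab ba ac ca bc cb Bab Bac Bbc
  2∤3 : ∀ {m} → 3 ≡ 2 * m → ⊥
  2∤3 {m} eq = from-no (2 ∣? 3) (divides m (trans eq (*-comm 2 m)))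
  not-two : ∀ {m i k} → Coprime i k → k ≡ 2 → i ≡ 2 * m → ⊥
  not-two {m} co refl refl = ¬coprime 2 ≤-refl co (m∣m*n m) ∣-refl
  not-one : ∀ {i k} → 3 ≤ i + k → k ≡ 1 → 2 ≡ 2 * i → ⊥
  not-one {i} 3≤ refl eq with *-cancelˡ-≡ 1 i 2 eq
  not-one (s≤s (s≤s ())) refl eq | refl
  absurd : Class a.i a.k c.i → Class b.i b.k c.i → ⊥
  absurd (equal ka ia) (equal kb ib) = na≢nb (cong₂ _+_ (trans ia (sym ib)) (trans ka (sym kb)))
  absurd (equal ka ia) (five-two _ _ ic) = not-two {1} a.i⊥k ka (trans ia ic)
  absurd (equal ka ia) (double _ ic) = not-two {b.i} a.i⊥k ka (trans ia ic)
  -- `a` has exponents (3 , 2) and `b` has (2 , 1), so e = 2 and f = 3 between them.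
  absurd (equal ka ia) (special kb ib ic) = five-three-two Bab (ei≡fi Bab)
    where
    open Bounds
    ia≡3 = trans ia ic
    five-three-two : (β : BoundsOf a b) → e β * a.i ≡ f β * b.i → ⊥
    five-three-two β eq = go (e β) (f β) a.i b.i b.k ia≡3 ib kb eq (e⊥f β) (eπ+x≤ β) (≤fπ+y β) (t≤R β) (iy≤R β) (100η≤ β)
        (subst₂ (λ p q → 100 * (p * a.α) ≤ 100 * (q * b.α) + q * b.α) na≡5 nb≡3 (Ratio.size-ratio ab))
      where
      na≡5 : a.n ≡ 5
      na≡5 = cong₂ _+_ ia≡3 ka
      nb≡3 : b.n ≡ 3
      nb≡3 = cong₂ _+_ ib kb
      go : ∀ e f ia ib kb → ia ≡ 3 → ib ≡ 2 → kb ≡ 1 → e * ia ≡ f * ib → Coprime e f →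
        e * π β + x β ≤ a.α → b.α ≤ f * π β + y β + η β →
        kb * b.α ≤ π β + x β + y β + η β → ib * y β ≤ π β + x β + y β + η β → 100 * η β ≤ kb * b.α →
        100 * (5 * a.α) ≤ 100 * (3 * b.α) + 3 * b.α → ⊥
      go e f _ _ _ refl refl refl eq co lX u t yy η≤ s =
        two-three e f (∣⇒≤ (coprime-divisor co (divides 3 (trans (sym eq) (*-comm e 3))))) eq co lX u
        where
        two-three : ∀ e f → e ≤ 2 → e * 3 ≡ f * 2 → Coprime e f →
          e * π β + x β ≤ a.α → b.α ≤ f * π β + y β + η β → ⊥
        two-three 0 f _ eq co _ _ with *-cancelʳ-≡ 0 f 2 eq
        ... | refl = ¬coprime 2 ≤-refl co (divides 0 refl) (divides 0 refl)
        two-three 1 f _ eq _ _ _ = 2∤3 {f} (trans eq (*-comm f 2))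
        two-three 2 f _ eq _ lX u with *-cancelʳ-≡ 3 f 2 eq
        ... | refl = exponents-53-32 (π β) (x β) (y β) a.α b.α (η β) b.1≤α lX u t yy η≤ s
        two-three (suc (suc (suc _))) _ (s≤s (s≤s ()))
  absurd (five-two _ _ ic) (equal kb ib) = not-two {1} b.i⊥k kb (trans ib ic)
  absurd (five-two ka ia _) (five-two kb ib _) = na≢nb (cong₂ _+_ (trans ia (sym ib)) (trans ka (sym kb)))
  absurd (five-two _ _ ic) (double kb ic′) = not-one b.3≤n kb (trans (sym ic) ic′)
  absurd (five-two _ _ ic) (special _ _ ic′) = from-no (2 ≟ 3) (trans (sym ic) ic′)
  absurd (double _ ic) (equal kb ib) = not-two {a.i} b.i⊥k kb (trans ib ic)
  absurd (double ka ic′) (five-two _ _ ic) = not-one a.3≤n ka (trans (sym ic) ic′)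
  absurd (double ka ic) (double kb ic′) = na≢nb (cong₂ _+_ (*-cancelˡ-≡ a.i b.i 2 (trans (sym ic) ic′)) (trans ka (sym kb)))
  absurd (double _ ic) (special _ _ ic′) = 2∤3 {a.i} (trans (sym ic′) ic)
  -- The same exponents interchanged violate the order of the `D`: 40 · 2 · 3 exceeds 41 · 1 · 5.
  absurd (special ka ia ic) (equal kb ib) = <⇒≱ (m≤m+n 206 34)
    (subst₂ (λ ka na → 40 * (2 * na) ≤ 41 * (ka * 5)) ka (cong₂ _+_ ia ka)
      (subst₂ (λ kb nb → OrderBound a.k a.n kb nb) kb (cong₂ _+_ (trans ib ic) kb) (bounds⇒OrderBound ab ba Bab)))
  absurd (special _ _ ic) (five-two _ _ ic′) = from-no (2 ≟ 3) (trans (sym ic′) ic)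
  absurd (special _ _ ic) (double _ ic′) = 2∤3 {b.i} (trans (sym ic) ic′)
  absurd (special ka ia _) (special kb ib _) = na≢nb (cong₂ _+_ (trans ia (sym ib)) (trans ka (sym kb)))

-- Solutions with equal n and solutions with bounded D

u : ∀ {d} → Sol d → ℕ
u S = Sol.c S ^ Sol.n S

module _ {d : ℕ} (S : Sol d) where
  open Sol S

  u≡ : u S ≡ c ^ i * c ^ k
  u≡ = ^-distribˡ-+-* c i k

  private
    Near-≤suc : ∀ {m D} → Near m D → m ≤ suc D × D ≤ suc m
    Near-≤suc (inj₁ refl) = ≤-trans (n≤1+n _) (n≤1+n _) , ≤-refl
    Near-≤suc (inj₂ refl) = ≤-refl , ≤-trans (n≤1+n _) (n≤1+n _)

    vm≤ : ∀ v {m n} → m ≤ suc n → v * m ≤ v * n + v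
    vm≤ v {m} {n} h = ≤-trans (*-monoʳ-≤ v h) (≤-reflexive (trans (*-suc v n) (+-comm v (v * n))))

  u≤d+v : u S ≤ d + c ^ i
  u≤d+v = subst₂ (λ a b → a ≤ b + c ^ i) (sym u≡) (sym d≡) (vm≤ (c ^ i) (proj₁ (Near-≤suc near)))

  d≤u+v : d ≤ u S + c ^ i
  d≤u+v = subst₂ (λ a b → a ≤ b + c ^ i) (sym d≡) (sym u≡) (vm≤ (c ^ i) (proj₂ (Near-≤suc near)))

  v≤cⁿ⁻¹ : c ^ i ≤ c ^ (n ∸ 1)
  v≤cⁿ⁻¹ = ^-monoʳ-≤ c {{>-nonZero 1≤c}} (subst (i ≤_) (sym (+-∸-assoc i 1≤k)) (m≤m+n i (k ∸ 1)))

-- The exponent must be at least 3: for exponent 2 and C = c + 1 both sides are equal, which is the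
-- pronic case with its two solutions.
power-gap : ∀ c C m → 1 ≤ c → c < C → c ^ (3 + m) + c ^ (2 + m) + C ^ (2 + m) < C ^ (3 + m)
power-gap c C m 1≤c c<C = begin-strict
  c ^ (3 + m) + c ^ (2 + m) + C ^ (2 + m)       ≡⟨ eq₁ c (c ^ (1 + m)) (C ^ (2 + m)) ⟩
  c * (c * P) + c * P + C ^ (2 + m)             <⟨ +-monoˡ-< (C ^ (2 + m)) (+-mono-≤-< (*-monoʳ-≤ c (*-monoʳ-≤ c (<⇒≤ P<Q))) (*-monoʳ-< c {{>-nonZero 1≤c}} P<Q)) ⟩
  c * (c * Q) + c * Q + C ^ (2 + m)             ≡⟨ eq₂ c Q (C ^ (2 + m)) ⟩
  c * (suc c * Q) + C ^ (2 + m)                 ≤⟨ +-monoˡ-≤ (C ^ (2 + m)) (*-monoʳ-≤ c (*-monoˡ-≤ Q c<C)) ⟩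
  c * (C * Q) + C ^ (2 + m)                     ≡⟨ +-comm (c * (C * Q)) (C ^ (2 + m)) ⟩
  suc c * C ^ (2 + m)                           ≤⟨ *-monoˡ-≤ (C ^ (2 + m)) c<C ⟩
  C ^ (3 + m)                                   ∎
  where
  open ≤-Reasoning
  P = c ^ (1 + m)
  Q = C ^ (1 + m)
  P<Q : P < Q
  P<Q = ^-monoˡ-< (1 + m) c<C
  eq₁ : ∀ c p r → c * (c * p) + c * p + r ≡ c * (c * p) + c * p + r
  eq₁ = solve-∀
  eq₂ : ∀ c q r → c * (c * q) + c * q + r ≡ c * (suc c * q) + r
  eq₂ = solve-∀

same-n⇒c≮c : ∀ {d} (X Y : Sol d) → 3 ≤ Sol.n X → Sol.n X ≡ Sol.n Y → ¬ (Sol.c X < Sol.c Y)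
same-n⇒c≮c {d} X Y 3≤n n≡ c<c with m≤n⇒∃[o]m+o≡n 3≤n
... | m , 3+m≡n = <⇒≱ (power-gap X.c Y.c m X.1≤c c<c) (begin
    Y.c ^ (3 + m)                                       ≡⟨ cong (Y.c ^_) 3+m≡nY ⟩
    u Y                                                 ≤⟨ u≤d+v Y ⟩
    d + Y.c ^ Y.i                                       ≤⟨ +-mono-≤ (d≤u+v X) (v≤cⁿ⁻¹ Y) ⟩
    u X + X.c ^ X.i + Y.c ^ (Y.n ∸ 1)                   ≤⟨ +-monoˡ-≤ (Y.c ^ (Y.n ∸ 1)) (+-monoʳ-≤ (u X) (v≤cⁿ⁻¹ X)) ⟩
    u X + X.c ^ (X.n ∸ 1) + Y.c ^ (Y.n ∸ 1)             ≡⟨ cong₂ (λ p q → X.c ^ p + X.c ^ (p ∸ 1) + Y.c ^ (q ∸ 1)) (sym 3+m≡n) (sym 3+m≡nY) ⟩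
    X.c ^ (3 + m) + X.c ^ (2 + m) + Y.c ^ (2 + m)       ∎)
  where
  open ≤-Reasoning
  module X = Sol X
  module Y = Sol Y
  3+m≡nY = trans 3+m≡n n≡

same-n⇒same-u : ∀ {d} (X Y : Sol d) → 3 ≤ Sol.n X → Sol.n X ≡ Sol.n Y → u X ≡ u Y
same-n⇒same-u X Y 3≤n n≡ with <-cmp (Sol.c X) (Sol.c Y)
... | tri< c<c _ _ = ⊥-elim (same-n⇒c≮c X Y 3≤n n≡ c<c)
... | tri≈ _ c≡c _ = cong₂ _^_ c≡c n≡
... | tri> _ _ c>c = ⊥-elim (same-n⇒c≮c Y X (subst (3 ≤_) n≡ 3≤n) (sym n≡) c>c)

size : ∀ {d} (S : Sol d) → 3 ≤ Sol.n S → Size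
size S 3≤n = record
  { i = i ; k = k ; α = L c ; 1≤i = 1≤i ; 1≤k = 1≤k ; 1≤α = ≤-trans 1≤N (L≥N 2≤c) ; i⊥k = i⊥k ; 3≤n = 3≤n }
  where open Sol S

-- Solutions are told apart by `u` because the pairs that they account for depend on nothing else.
Distinct : ∀ {d} → Sol d → Sol d → Sol d → Set
Distinct a b c = u a ≢ u b × u a ≢ u c × u b ≢ u c

no-three-big : ∀ {d κ} → ABCLog κ → (a b c : Sol d) → 3 ≤ Sol.n a → 3 ≤ Sol.n b → 3 ≤ Sol.n c → Distinct a b c →
  Big κ (SolLog.t a) → Big κ (SolLog.t b) → Big κ (SolLog.t c) → Sol.D b ≤ Sol.D a → Sol.D c ≤ Sol.D b → ⊥
no-three-big {d} {κ} abc a b c 3a 3b 3c (ab , ac , bc) Ba Bb Bc Db≤Da Dc≤Db = no-three-sizes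
  {size a 3a} {size b 3b} {size c 3c}
  (λ e → ab (same-n⇒same-u a b 3a e)) (λ e → ac (same-n⇒same-u a c 3a e)) (λ e → bc (same-n⇒same-u b c 3b e))
  (ratio a b 3a 3b Ba Bb) (ratio b a 3b 3a Bb Ba) (ratio a c 3a 3c Ba Bc) (ratio c a 3c 3a Bc Ba) (ratio b c 3b 3c Bb Bc) (ratio c b 3c 3b Bc Bb)
  (Top.bounds abc a b (common a b) ab Db≤Da Ba Bb)
  (Top.bounds abc a c (common a c) ac (≤-trans Dc≤Db Db≤Da) Ba Bc)
  (Top.bounds abc b c (common b c) bc Dc≤Db Bb Bc)
  where
  ratio : ∀ (X Y : Sol d) 3X 3Y → Big κ (SolLog.t X) → Big κ (SolLog.t Y) → Ratio (size X 3X) (size Y 3Y)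
  ratio X Y _ _ BX BY = record
    { power-ratio = Ordered.power-ratio abc X Y BX BY ; size-ratio = Ordered.size-ratio abc X Y BX BY }

-- Bounded `D` bounds `c`, so a large d forces i > B. A part q > 1 of one base would then have q ^ i
-- > B, although q ^ i divides the other `D`. Hence q = r = 1 and both powers equal `P`.
same-v : ∀ {d} B (X Y : Sol d) → Sol.D X < B → Sol.D Y < B → (2 * B) ^ B * B ≤ d → Sol.c X ^ Sol.i X ≡ Sol.c Y ^ Sol.i Y
same-v {d} B X Y DX<B DY<B d≥ = trans C.vX≡ (trans (cong (C.P *_) (trans (Q≡1 X C.q (^≤ C.DY≡) DX<B DY<B C.1≤q) (sym (Q≡1 Y C.r (^≤ C.DX≡) DY<B DX<B C.1≤r)))) (sym C.vY≡))
  where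
  module X = Sol X
  module Y = Sol Y
  module C = Common (common X Y)
  ^≤ : ∀ {D Q} → D ≡ Q * C.h → Q ≤ D
  ^≤ {D} {Q} refl = m≤m*n Q C.h {{>-nonZero (1≤-*ʳ (C.q ^ X.i) (subst (1 ≤_) C.DY≡ Y.1≤D))}}
  n<2^n : ∀ n → n < 2 ^ n
  n<2^n zero = s≤s z≤n
  n<2^n (suc n) = ≤-trans (+-mono-≤ (1≤^ n (s≤s z≤n)) (n<2^n n)) (≤-reflexive (cong (2 ^ n +_) (sym (+-identityʳ (2 ^ n)))))
  B<i : (S : Sol d) → Sol.D S < B → B < Sol.i S
  B<i S D<B = ≰⇒> λ i≤B → <⇒≱ (begin-strict
    d                        ≡⟨ Sol.d≡ S ⟩
    S.c ^ S.i * S.D          <⟨ *-monoʳ-< (S.c ^ S.i) {{>-nonZero (1≤^ S.i S.1≤c)}} D<B ⟩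
    S.c ^ S.i * B            ≤⟨ *-monoˡ-≤ B (^-monoˡ-≤ S.i c≤2B) ⟩
    (2 * B) ^ S.i * B        ≤⟨ *-monoˡ-≤ B (^-monoʳ-≤ (2 * B) {{>-nonZero (≤-trans S.1≤c c≤2B)}} i≤B) ⟩
    (2 * B) ^ B * B          ∎) d≥
    where
    open ≤-Reasoning
    module S = Sol S
    c≤2B : S.c ≤ 2 * B
    c≤2B = ≤-trans (∣⇒≤ {{>-nonZero (<⇒≤ S.2≤cᵏ)}} (m∣m^n S.c S.1≤k)) (≤-trans S.cᵏ≤2D (*-monoʳ-≤ 2 (<⇒≤ D<B)))
  Q≡1 : (S : Sol d) → ∀ q {D} → q ^ Sol.i S ≤ D → Sol.D S < B → D < B → 1 ≤ q → q ^ Sol.i S ≡ 1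
  Q≡1 S q {D} h DS<B D<B 1≤q with q ≟ 1
  ... | yes refl = ^-zeroˡ (Sol.i S)
  ... | no q≢1 = ⊥-elim (<⇒≱ (begin-strict
      q ^ Sol.i S     ≤⟨ h ⟩
      D               <⟨ D<B ⟩
      B               <⟨ n<2^n B ⟩
      2 ^ B           ≤⟨ ^-monoʳ-≤ 2 (<⇒≤ (B<i S DS<B)) ⟩
      2 ^ Sol.i S     ∎) (^-monoˡ-≤ (Sol.i S) (≤∧≢⇒< 1≤q (q≢1 ∘ sym))))
    where open ≤-Reasoning

-- For bounded D all values of c ^ i coincide, and only the two choices of sign remain.
no-three-small : ∀ {d} B (a b c : Sol d) → Distinct a b c → Sol.D a < B → Sol.D b < B → Sol.D c < B → (2 * B) ^ B * B ≤ d → ⊥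
no-three-small {d} B a b c (ab , ac , bc) Da Db Dc d≥ = go (Sol.near a) (Sol.near b) (Sol.near c)
  where
  D≡ : (X Y : Sol d) → Sol.D X < B → Sol.D Y < B → Sol.D X ≡ Sol.D Y
  D≡ X Y DX DY = *-cancelˡ-≡ _ _ (Sol.c X ^ Sol.i X) {{>-nonZero (1≤^ (Sol.i X) (Sol.1≤c X))}}
    (trans (sym (Sol.d≡ X)) (trans (Sol.d≡ Y) (cong (_* Sol.D Y) (sym (same-v B X Y DX DY d≥)))))
  ↑↑ : (X Y : Sol d) → Sol.D X < B → Sol.D Y < B → Sol.c X ^ Sol.k X ≡ Sol.c Y ^ Sol.k Y → u X ≡ u Y
  ↑↑ X Y DX DY e = trans (u≡ X) (trans (cong₂ _*_ (same-v B X Y DX DY d≥) e) (sym (u≡ Y)))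
  plus : (X Y : Sol d) → Sol.D X < B → Sol.D Y < B → Sol.D X ≡ suc (Sol.c X ^ Sol.k X) → Sol.D Y ≡ suc (Sol.c Y ^ Sol.k Y) → u X ≡ u Y
  plus X Y DX DY eX eY = ↑↑ X Y DX DY (suc-injective (trans (sym eX) (trans (D≡ X Y DX DY) eY)))
  minus : (X Y : Sol d) → Sol.D X < B → Sol.D Y < B → Sol.c X ^ Sol.k X ≡ suc (Sol.D X) → Sol.c Y ^ Sol.k Y ≡ suc (Sol.D Y) → u X ≡ u Y
  minus X Y DX DY eX eY = ↑↑ X Y DX DY (trans eX (trans (cong suc (D≡ X Y DX DY)) (sym eY)))
  go : Near (Sol.c a ^ Sol.k a) (Sol.D a) → Near (Sol.c b ^ Sol.k b) (Sol.D b) → Near (Sol.c c ^ Sol.k c) (Sol.D c) → ⊥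
  go (inj₁ x) (inj₁ y) _ = ab (plus a b Da Db x y)
  go (inj₂ x) (inj₂ y) _ = ab (minus a b Da Db x y)
  go (inj₁ x) (inj₂ _) (inj₁ z) = ac (plus a c Da Dc x z)
  go (inj₂ x) (inj₁ _) (inj₂ z) = ac (minus a c Da Dc x z)
  go (inj₁ _) (inj₂ y) (inj₂ z) = bc (minus b c Db Dc y z)
  go (inj₂ _) (inj₁ y) (inj₁ z) = bc (plus b c Db Dc y z)

-- If one D is bounded then all are, since rad d ≤ c * D.

private
  small-t : ∀ n t m κ l → n * t ≤ (n + 1) * l + n * κ → l ≤ m → 1 ≤ n → t ≤ 2 * m + κ
  small-t n t m κ l h l≤m 1≤n = *-cancelˡ-≤ n {{>-nonZero 1≤n}} (begin
    n * t                      ≤⟨ h ⟩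
    (n + 1) * l + n * κ        ≤⟨ +-monoˡ-≤ (n * κ) (*-mono-≤ (+-monoʳ-≤ n 1≤n) l≤m) ⟩
    (n + n) * m + n * κ        ≡⟨ eq n m κ ⟩
    n * (2 * m + κ)            ∎)
    where
    open ≤-Reasoning
    eq : ∀ n m κ → (n + n) * m + n * κ ≡ n * (2 * m + κ)
    eq = solve-∀

  m≤L2^m : ∀ m → m ≤ L (2 ^ m)
  m≤L2^m m = ≤-trans (≤-trans (≤-reflexive (sym (*-identityʳ m))) (*-monoʳ-≤ m (≤-trans 1≤N (≤-reflexive (sym L2≡N))))) (L-^-≥ m (s≤s z≤n))

bounded-t⇒bounded-D : ∀ {d κ} → ABCLog κ → (S X : Sol d) → ∀ Z → SolLog.t S ≤ Z → Sol.D X < 2 ^ suc (N + (2 * (Z + (N + (Z + Z) + 1) + 1) + κ) + 1 + (2 * (Z + (N + (Z + Z) + 1) + 1) + κ))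
bounded-t⇒bounded-D {d} {κ} abc S X Z tS≤Z = ≰⇒> λ 2^≤D → 1+n≰n (begin
    suc W                       ≤⟨ m≤L2^m (suc W) ⟩
    L (2 ^ suc W)               ≤⟨ L-mono 2^≤D ⟩
    L X.D                       ≤⟨ LX.LD≤Lcᵏ ⟩
    N + L (X.c ^ X.k) + 1       ≤⟨ +-monoˡ-≤ 1 (+-monoʳ-≤ N tX≤) ⟩
    N + V + 1                   ≤⟨ m≤m+n (N + V + 1) V ⟩
    W                           ∎)
  where
  open ≤-Reasoning
  module S = Sol S
  module X = Sol X
  module LS = SolLog S
  module LX = SolLog X
  m = Z + (N + (Z + Z) + 1) + 1
  V = 2 * m + κ
  W = N + V + 1 + V
  LcD≤ : L (S.c * S.D) ≤ m
  LcD≤ = begin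
    L (S.c * S.D)                       ≤⟨ L-*-≤ S.1≤c S.1≤D ⟩
    L S.c + L S.D + 1                   ≤⟨ +-monoˡ-≤ 1 (+-mono-≤ (≤-trans LS.α≤t tS≤Z) (≤-trans LS.LD≤Lcᵏ (+-monoˡ-≤ 1 (+-monoʳ-≤ N (≤-trans (L-^-≤ S.k S.1≤c) (+-mono-≤ tS≤Z k≤Z)))))) ⟩
    m                                   ∎
    where
    k≤Z : S.k ≤ Z
    k≤Z = ≤-trans (m≤n*m S.k N {{>-nonZero 1≤N}}) (≤-trans LS.Nk≤t tS≤Z)
  tX≤ : L (X.c ^ X.k) ≤ V
  tX≤ = small-t N (L (X.c ^ X.k)) m κ (L (S.c * S.D))
    (power-log abc X (S.c * S.D) (1≤* S.1≤c S.1≤D) (⊑-trans (∣⇒⊑ (c∣d X)) (d⊑cD S)) (⊑-trans (∣⇒⊑ (D∣d X)) (d⊑cD S)))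
    LcD≤ 1≤N

-- As soon as one `t` is below the threshold `Z`, every `D` is below `B₀`. So either all three
-- solutions are big, or the elementary argument applies to all three.
no-three-n≥3 : ∀ {κ} → ABCLog κ → ∃[ D₀ ] ∀ {d} → D₀ ≤ d → (a b c : Sol d) → 3 ≤ Sol.n a → 3 ≤ Sol.n b → 3 ≤ Sol.n c → Distinct a b c → ⊥
no-three-n≥3 {κ} abc = (2 * B₀) ^ B₀ * B₀ , λ {d} → main {d}
  where
  Z = N * κ + 3 * N * N + 20 * N
  B₀ = 2 ^ suc (N + (2 * (Z + (N + (Z + Z) + 1) + 1) + κ) + 1 + (2 * (Z + (N + (Z + Z) + 1) + 1) + κ))
  module _ {d : ℕ} (d≥ : (2 * B₀) ^ B₀ * B₀ ≤ d) where
    small : (S a b c : Sol d) → Distinct a b c → SolLog.t S < Z → ⊥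
    small S a b c dist t<Z = no-three-small B₀ a b c dist (f a) (f b) (f c) d≥
      where
      f : (X : Sol d) → Sol.D X < B₀
      f X = bounded-t⇒bounded-D abc S X Z (<⇒≤ t<Z)
    sorted : (a b c : Sol d) → 3 ≤ Sol.n a → 3 ≤ Sol.n b → 3 ≤ Sol.n c → Distinct a b c → Sol.D b ≤ Sol.D a → Sol.D c ≤ Sol.D b → ⊥
    sorted a b c 3a 3b 3c dist h₁ h₂ with Z ≤? SolLog.t a | Z ≤? SolLog.t b | Z ≤? SolLog.t c
    ... | no t≱ | _ | _ = small a a b c dist (≰⇒> t≱)
    ... | yes _ | no t≱ | _ = small b a b c dist (≰⇒> t≱)
    ... | yes _ | yes _ | no t≱ = small c a b c dist (≰⇒> t≱)
    ... | yes Ba | yes Bb | yes Bc = no-three-big abc a b c 3a 3b 3c dist Ba Bb Bc h₁ h₂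
    main : (a b c : Sol d) → 3 ≤ Sol.n a → 3 ≤ Sol.n b → 3 ≤ Sol.n c → Distinct a b c → ⊥
    main a b c 3a 3b 3c dist@(ab , ac , bc) with ≤-total (Sol.D a) (Sol.D b) | ≤-total (Sol.D b) (Sol.D c) | ≤-total (Sol.D a) (Sol.D c)
    ... | inj₁ a≤b | inj₁ b≤c | _        = sorted c b a 3c 3b 3a (bc ∘ sym , ac ∘ sym , ab ∘ sym) b≤c a≤b
    ... | inj₁ a≤b | inj₂ c≤b | inj₁ a≤c = sorted b c a 3b 3c 3a (bc , ab ∘ sym , ac ∘ sym) c≤b a≤c
    ... | inj₁ a≤b | inj₂ c≤b | inj₂ c≤a = sorted b a c 3b 3a 3c (ab ∘ sym , bc , ac) a≤b c≤a
    ... | inj₂ b≤a | inj₁ b≤c | inj₁ a≤c = sorted c a b 3c 3a 3b (ac ∘ sym , bc ∘ sym , ab) a≤c b≤a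
    ... | inj₂ b≤a | inj₁ b≤c | inj₂ c≤a = sorted a c b 3a 3c 3b (ac , ab , bc ∘ sym) c≤a b≤c
    ... | inj₂ b≤a | inj₂ c≤b | _        = sorted a b c 3a 3b 3c dist b≤a c≤b

-- Radicals at four points

^-expand : ∀ (s z : ℤ) n → ∃[ w ] ((s Z.+ z) Z.^ suc n ≡ s Z.^ suc n Z.+ pos (suc n) Z.* s Z.^ n Z.* z Z.+ z Z.* z Z.* w)
^-expand s z zero = Z.0ℤ , base s z
  where
  base : ∀ s z → (s Z.+ z) Z.* pos 1 ≡ s Z.* pos 1 Z.+ pos 1 Z.* pos 1 Z.* z Z.+ z Z.* z Z.* pos 0
  base = ℤS.solve-∀
^-expand s z (suc n) with ^-expand s z n
... | w , eq = s Z.* w Z.+ pos (suc n) Z.* s Z.^ n Z.+ z Z.* w ,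
  trans (cong ((s Z.+ z) Z.*_) eq)
    (trans (step s z (s Z.^ n) (pos (suc n)) w)
      (cong (λ m → s Z.* (s Z.* s Z.^ n) Z.+ m Z.* (s Z.* s Z.^ n) Z.* z Z.+ z Z.* z Z.* (s Z.* w Z.+ pos (suc n) Z.* s Z.^ n Z.+ z Z.* w)) (ℤP.+-comm (pos (suc n)) (pos 1))))
  where
  step : ∀ s z p m w → (s Z.+ z) Z.* (s Z.* p Z.+ m Z.* p Z.* z Z.+ z Z.* z Z.* w)
    ≡ s Z.* (s Z.* p) Z.+ (m Z.+ pos 1) Z.* (s Z.* p) Z.* z Z.+ z Z.* z Z.* (s Z.* w Z.+ m Z.* p Z.+ z Z.* w)
  step = ℤS.solve-∀

-- When base point and exponent are both s, the linear coefficient s * s ^ (s - 1) equals the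
-- constant term s ^ s. In `critical-point` the factors 1 + z and 1 - z then multiply to 1 - z ^ 2,
-- without a linear term.
self-power : ∀ n z → ∃[ w ] ((pos (suc n) Z.+ z) Z.^ suc n ≡ (pos (suc n)) Z.^ suc n Z.* (pos 1 Z.+ z) Z.+ z Z.* z Z.* w)
self-power n z with ^-expand (pos (suc n)) z n
... | w , eq = w , trans eq (lem (pos (suc n)) ((pos (suc n)) Z.^ n) z w)
  where
  lem : ∀ s p z w → s Z.* p Z.+ s Z.* p Z.* z Z.+ z Z.* z Z.* w ≡ s Z.* p Z.* (pos 1 Z.+ z) Z.+ z Z.* z Z.* w
  lem = ℤS.solve-∀

-- The polynomial (a + z) ^ a * (b - z) ^ b has a critical point at z = 0, hence so does its square.
critical-point : ∀ a b z → 1 ≤ a → 1 ≤ b → ∃[ w ]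
  (((pos a Z.+ z) Z.^ a Z.* (pos b Z.- z) Z.^ b) Z.* ((pos a Z.+ z) Z.^ a Z.* (pos b Z.- z) Z.^ b)
   Z.- ((pos a) Z.^ a Z.* (pos b) Z.^ b) Z.* ((pos a) Z.^ a Z.* (pos b) Z.^ b) ≡ z Z.* z Z.* w)
critical-point (suc a) (suc b) z _ _ with self-power a z | self-power b (Z.- z)
... | w₁ , eq₁ | w₂ , eq₂ = _ , trans
  (cong₂ (λ p q → (p Z.* q) Z.* (p Z.* q) Z.- (A Z.* B) Z.* (A Z.* B)) eq₁ eq₂)
  (lem A B z w₁ w₂)
  where
  A = (pos (suc a)) Z.^ suc a
  B = (pos (suc b)) Z.^ suc b
  lem : ∀ A B z w₁ w₂ →
    (A Z.* (pos 1 Z.+ z) Z.+ z Z.* z Z.* w₁) Z.* (B Z.* (pos 1 Z.+ Z.- z) Z.+ (Z.- z) Z.* (Z.- z) Z.* w₂)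
      Z.* ((A Z.* (pos 1 Z.+ z) Z.+ z Z.* z Z.* w₁) Z.* (B Z.* (pos 1 Z.+ Z.- z) Z.+ (Z.- z) Z.* (Z.- z) Z.* w₂))
      Z.- (A Z.* B) Z.* (A Z.* B)
    ≡ z Z.* z Z.* ((w₁ Z.* B Z.* (pos 1 Z.- z) Z.+ w₂ Z.* A Z.* (pos 1 Z.+ z) Z.+ z Z.* z Z.* w₁ Z.* w₂ Z.- A Z.* B)
        Z.* ((A Z.* (pos 1 Z.+ z) Z.+ z Z.* z Z.* w₁) Z.* (B Z.* (pos 1 Z.+ Z.- z) Z.+ (Z.- z) Z.* (Z.- z) Z.* w₂) Z.+ A Z.* B))
  lem = ℤS.solve-∀

pos-^ : ∀ m n → pos (m ^ n) ≡ (pos m) Z.^ n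
pos-^ m zero = refl
pos-^ m (suc n) = trans (ℤP.pos-* m (m ^ n)) (cong (pos m Z.*_) (pos-^ m n))

∣^∣ : ∀ x n → (abs (x Z.^ n)) ≡ (abs x) ^ n
∣^∣ x zero = refl
∣^∣ x (suc n) = trans (ℤP.abs-* x (x Z.^ n)) (cong ((abs x) *_) (∣^∣ x n))

sq≡∣∣² : ∀ x → x Z.* x ≡ pos ((abs x) * (abs x))
sq≡∣∣² x = sym (trans (ℤP.pos-* (abs x) (abs x)) (∣x∣² x))
  where
  ∣x∣² : ∀ x → pos (abs x) Z.* pos (abs x) ≡ x Z.* x
  ∣x∣² (pos n) = refl
  ∣x∣² Z.-[1+ n ] = refl

∣⊖∣≡∣-∣ : ∀ m n → (abs (pos m Z.- pos n)) ≡ ∣ m - n ∣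
∣⊖∣≡∣-∣ m n = trans (cong abs (ℤP.m-n≡m⊖n m n)) (go (≤-total m n))
  where
  go : m ≤ n ⊎ n ≤ m → (abs (m Z.⊖ n)) ≡ ∣ m - n ∣
  go (inj₁ h) = trans (ℤP.∣⊖∣-≤ h) (sym (m≤n⇒∣m-n∣≡n∸m h))
  go (inj₂ h) = trans (cong abs (ℤP.⊖-≥ h)) (sym (m≤n⇒∣n-m∣≡n∸m h))

self : ℕ → ℕ → ℕ
self a b = a ^ a * b ^ b

-- Squaring removes the sign of (b - z) ^ b, so the statement can be made in ℕ with absolute
-- differences.
critical-∣ : ∀ a b z → 1 ≤ a → 1 ≤ b →
  z * z ∣ ∣ ((a + z) ^ a * ∣ b - z ∣ ^ b) * ((a + z) ^ a * ∣ b - z ∣ ^ b) - self a b * self a b ∣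
critical-∣ a b z 1≤a 1≤b with critical-point a b (pos z) 1≤a 1≤b
... | w , eq = divides (abs w) (begin
    ∣ F * F - self a b * self a b ∣                          ≡⟨ sym (∣⊖∣≡∣-∣ (F * F) (self a b * self a b)) ⟩
    (abs (pos (F * F) Z.- pos (self a b * self a b)))              ≡⟨ cong₂ (λ p q → (abs (p Z.- q))) F² G² ⟩
    (abs (f Z.* f Z.- g Z.* g))                                ≡⟨ cong abs eq ⟩
    (abs (pos z Z.* pos z Z.* w))                                  ≡⟨ ℤP.abs-* (pos z Z.* pos z) w ⟩
    (abs (pos z Z.* pos z)) * (abs w)                              ≡⟨ cong (_* (abs w)) (ℤP.abs-* (pos z) (pos z)) ⟩
    z * z * (abs w)                                          ≡⟨ *-comm (z * z) (abs w) ⟩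
    (abs w) * (z * z)                                        ∎)
  where
  open ≡-Reasoning
  F = (a + z) ^ a * ∣ b - z ∣ ^ b
  f = (pos a Z.+ pos z) Z.^ a Z.* (pos b Z.- pos z) Z.^ b
  g = (pos a) Z.^ a Z.* (pos b) Z.^ b
  ∣f∣ : (abs f) ≡ F
  ∣f∣ = trans (ℤP.abs-* ((pos a Z.+ pos z) Z.^ a) _)
    (cong₂ _*_ (∣^∣ (pos a Z.+ pos z) a) (trans (∣^∣ (pos b Z.- pos z) b) (cong (_^ b) (∣⊖∣≡∣-∣ b z))))
  F² : pos (F * F) ≡ f Z.* f
  F² = sym (trans (sq≡∣∣² f) (cong (λ m → pos (m * m)) ∣f∣))
  G² : pos (self a b * self a b) ≡ g Z.* g
  G² = trans (ℤP.pos-* (self a b) (self a b)) (cong (λ m → m Z.* m) (trans (ℤP.pos-* (a ^ a) (b ^ b)) (cong₂ Z._*_ (pos-^ a a) (pos-^ b b))))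
arith-four : ∀ M n m A B W H z U κ →
  M * A ≤ (M + 1) * (B + W + 1 + H + 1) + M * κ →
  H + (z + z) ≤ A →
  A ≤ m * U + m + (m * U + m) + 1 →
  U ≤ n + z + 1 →
  2 * M * U ≤ (M + 1) * W + 2 * m * U + (2 * m + 1 + (M + 1) * (B + 2) + M * κ + 2 * M * (n + 1))
arith-four M n m A B W H z U κ h1 h2 h3 h4 = ≮⇒≥ λ (hg : suc ((M + 1) * W + 2 * m * U + (2 * m + 1 + (M + 1) * (B + 2) + M * κ + 2 * M * (n + 1))) ≤ 2 * M * U) → sum-absurd (2 * z)
  (h1 ⊹ h2 ⊹ M · h2 ⊹ h3 ⊹ (2 * M) · h4 ⊹ hg)
  (solve (M ∷ n ∷ m ∷ A ∷ B ∷ W ∷ H ∷ z ∷ U ∷ κ ∷ []))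

-- A lower bound for the radical at four points 0, m₁, m₂, ∞: apply ABC to the polynomial with zeros at
-- 0 and m₂ whose derivative vanishes at m₁.
four-points : ABC → ∀ m₁ m₂ M → 1 ≤ m₁ → m₁ < m₂ → 1 ≤ M → ∃[ C ] ∀ U U₁ X₁ V₁ → 2 * m₂ ≤ U →
  1 ≤ U₁ → 1 ≤ X₁ → 1 ≤ V₁ → U ⊑ U₁ → U ∸ m₁ ⊑ X₁ → U ∸ m₂ ⊑ V₁ →
  2 * M * L U ≤ (M + 1) * L (U₁ * X₁ * V₁) + 2 * m₂ * L U + C
four-points abc m₁ m₂ M 1≤m₁ m₁<m₂ 1≤M with ABC-radical abc M 1≤M
... | K , h = 2 * m₂ + 1 + (M + 1) * (L B₀ + 2) + M * (L (suc K * B₀) + 4) + 2 * M * (N + 1) , bound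
  where
  b = m₂ ∸ m₁
  B₀ = self m₁ b * self m₁ b
  1≤b : 1 ≤ b
  1≤b = m<n⇒0<n∸m m₁<m₂
  1≤m₂ = ≤-trans 1≤m₁ (<⇒≤ m₁<m₂)
  1≤self : 1 ≤ self m₁ b
  1≤self = 1≤* (1≤^ m₁ 1≤m₁) (1≤^ b 1≤b)
  1≤B₀ : 1 ≤ B₀
  1≤B₀ = 1≤* 1≤self 1≤self
  m₁+b : m₁ + b ≡ m₂
  m₁+b = m+[n∸m]≡n (<⇒≤ m₁<m₂)
  bound : ∀ U U₁ X₁ V₁ → 2 * m₂ ≤ U → 1 ≤ U₁ → 1 ≤ X₁ → 1 ≤ V₁ → U ⊑ U₁ → U ∸ m₁ ⊑ X₁ → U ∸ m₂ ⊑ V₁ →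
    2 * M * L U ≤ (M + 1) * L (U₁ * X₁ * V₁) + 2 * m₂ * L U + (2 * m₂ + 1 + (M + 1) * (L B₀ + 2) + M * (L (suc K * B₀) + 4) + 2 * M * (N + 1))
  bound U U₁ X₁ V₁ 2m₂≤U 1≤U₁ 1≤X₁ 1≤V₁ fU fX fV =
    arith-four M N m₂ (L A) (L B₀) (L W) (L H) (L z) (L U) (L (suc K * B₀) + 4) h₁ h₂ h₃ h₄
    where
    z = U ∸ m₁
    W = U₁ * X₁ * V₁
    -- The polynomial of `critical-∣` with a = m₁, because m₁ + z = U and z - b = U - m₂.
    F = U ^ m₁ * (U ∸ m₂) ^ b
    A = F * F
    δ = A ∸ B₀
    m₂≤U : m₂ ≤ U
    m₂≤U = ≤-trans (m≤m+n m₂ _) 2m₂≤U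
    m₁≤U : m₁ ≤ U
    m₁≤U = ≤-trans (<⇒≤ m₁<m₂) m₂≤U
    1≤U : 1 ≤ U
    1≤U = ≤-trans 1≤m₁ m₁≤U
    m₂≤U∸m₂ : m₂ ≤ U ∸ m₂
    m₂≤U∸m₂ = ≤-trans (≤-reflexive (sym (trans (cong (_∸ m₂) (cong (_+_ m₂) (+-identityʳ m₂))) (m+n∸n≡m m₂ m₂)))) (∸-monoˡ-≤ m₂ 2m₂≤U)
    m₂≤z : m₂ ≤ z
    m₂≤z = ≤-trans m₂≤U∸m₂ (∸-monoʳ-≤ U (<⇒≤ m₁<m₂))
    m₁+z : m₁ + z ≡ U
    m₁+z = m+[n∸m]≡n m₁≤U
    ∣b-z∣ : ∣ b - z ∣ ≡ U ∸ m₂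
    ∣b-z∣ = trans (m≤n⇒∣m-n∣≡n∸m (≤-trans (m∸n≤m m₂ m₁) m₂≤z)) (trans (∸-+-assoc U m₁ b) (cong (U ∸_) m₁+b))
    1≤F : 1 ≤ F
    1≤F = 1≤* (1≤^ m₁ 1≤U) (1≤^ b (≤-trans 1≤m₂ m₂≤U∸m₂))
    self<F : self m₁ b < F
    self<F = ≤-trans (*-monoˡ-< (b ^ b) {{>-nonZero (1≤^ b 1≤b)}} (^-monoˡ-< m₁ {{>-nonZero 1≤m₁}} (≤-trans m₁<m₂ m₂≤U)))
      (*-monoʳ-≤ (U ^ m₁) (^-monoˡ-≤ b (≤-trans (m∸n≤m m₂ m₁) m₂≤U∸m₂)))
    B₀<A : B₀ < A
    B₀<A = *-mono-< self<F self<F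
    1≤δ : 1 ≤ δ
    1≤δ = m<n⇒0<n∸m B₀<A
    B₀+δ : B₀ + δ ≡ A
    B₀+δ = m+[n∸m]≡n (<⇒≤ B₀<A)
    z²∣δ : z * z ∣ δ
    z²∣δ = subst (z * z ∣_) (m≤n⇒∣n-m∣≡n∸m (<⇒≤ B₀<A))
      (subst₂ (λ p q → z * z ∣ ∣ (p ^ m₁ * q ^ b) * (p ^ m₁ * q ^ b) - B₀ ∣) m₁+z ∣b-z∣ (critical-∣ m₁ b z 1≤m₁ 1≤b))
    -- `H` enters the radical at full size, but `z * z` only through `X₁`. This saves 2 L z against
    -- L A, and z is about U: hence the exponent 2 in the bound.
    H = quotient z²∣δ
    δ≡ : δ ≡ H * (z * z)
    δ≡ = m∣n⇒n≡quotient*m z²∣δ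
    1≤H : 1 ≤ H
    1≤H = 1≤-*ˡ (z * z) (subst (1 ≤_) δ≡ 1≤δ)
    1≤z : 1 ≤ z
    1≤z = ≤-trans 1≤m₂ m₂≤z
    1≤W : 1 ≤ W
    1≤W = 1≤* (1≤* 1≤U₁ 1≤X₁) 1≤V₁
    R = B₀ * W * H
    1≤R : 1 ≤ R
    1≤R = 1≤* (1≤* 1≤B₀ 1≤W) 1≤H
    W∣ : ∀ {m} → m ⊑ W → m ⊑ R
    W∣ f = ⊑-*ʳ H (⊑-*ˡ B₀ f)
    fF : F ⊑ R
    fF = ⊑-* (⊑-^ m₁ (W∣ (⊑-*ʳ V₁ (⊑-*ʳ X₁ fU)))) (⊑-^ b (W∣ (⊑-*ˡ (U₁ * X₁) fV)))
    fz : z ⊑ R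
    fz = W∣ (⊑-*ʳ V₁ (⊑-*ˡ U₁ fX))
    f : B₀ * δ * (B₀ + δ) ⊑ R
    f = ⊑-* (⊑-* (⊑-*ʳ H (⊑-*ʳ {B₀} {B₀} W (∣⇒⊑ ∣-refl))) (subst (_⊑ R) (sym δ≡) (⊑-* (⊑-*ˡ (B₀ * W) (∣⇒⊑ ∣-refl)) (⊑-* fz fz))))
      (subst (_⊑ R) (sym B₀+δ) (⊑-* fF fF))
    h₁ : M * L A ≤ (M + 1) * (L B₀ + L W + 1 + L H + 1) + M * (L (suc K * B₀) + 4)
    h₁ = ≤-trans (L-ABC M 1≤M (1≤* 1≤F 1≤F) (1≤* {suc K} (s≤s z≤n) 1≤B₀) 1≤R
        (≤-trans (subst (λ A → A ^ M ≤ (K * B₀) ^ M * R ^ (M + 1)) B₀+δ (h B₀ δ R 1≤B₀ 1≤δ 1≤R f))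
          (*-monoˡ-≤ (R ^ (M + 1)) (^-monoˡ-≤ M (*-monoˡ-≤ B₀ (n≤1+n K))))))
      (+-monoˡ-≤ (M * (L (suc K * B₀) + 4)) (*-monoʳ-≤ (M + 1)
        (≤-trans (L-*-≤ (1≤* 1≤B₀ 1≤W) 1≤H) (+-monoˡ-≤ 1 (+-monoˡ-≤ (L H) (L-*-≤ 1≤B₀ 1≤W))))))
    h₂ : L H + (L z + L z) ≤ L A
    h₂ = ≤-trans (+-monoʳ-≤ (L H) (L-*-≥ 1≤z 1≤z)) (≤-trans (L-*-≥ 1≤H (1≤* 1≤z 1≤z))
      (L-mono (≤-trans (≤-reflexive (sym δ≡)) (m∸n≤m A B₀))))
    F≤ : F ≤ U ^ m₂
    F≤ = ≤-trans (*-monoʳ-≤ (U ^ m₁) (^-monoˡ-≤ b (m∸n≤m U m₂)))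
      (≤-reflexive (trans (sym (^-distribˡ-+-* U m₁ b)) (cong (U ^_) m₁+b)))
    LF≤ : L F ≤ m₂ * L U + m₂
    LF≤ = ≤-trans (L-mono F≤) (L-^-≤ m₂ 1≤U)
    h₃ : L A ≤ m₂ * L U + m₂ + (m₂ * L U + m₂) + 1
    h₃ = ≤-trans (L-*-≤ 1≤F 1≤F) (+-monoˡ-≤ 1 (+-mono-≤ LF≤ LF≤))
    h₄ : L U ≤ N + L z + 1
    h₄ = ≤-trans (L-mono U≤2z) (≤-trans (L-*-≤ (s≤s z≤n) 1≤z) (≤-reflexive (cong (λ t → t + L z + 1) L2≡N)))
      where
      U≤2z : U ≤ 2 * z
      U≤2z = ≤-trans (≤-reflexive (sym m₁+z)) (≤-trans (+-monoˡ-≤ z (≤-trans (<⇒≤ m₁<m₂) m₂≤z)) (≤-reflexive (cong (_+_ z) (sym (+-identityʳ z)))))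

arith-fixed₁ : ∀ M m U W X V y Y E C₀ →
  2 * M * U ≤ (M + 1) * W + 2 * m * U + C₀ →
  W ≤ E + X + V + 2 →
  y + X ≤ U →
  Y + V ≤ U →
  2 * (M + 1) * (y + Y) ≤ 2 * (M + 1) * (E + 2) + (4 * (1 + m) * U + 2 * C₀)
arith-fixed₁ M m U W X V y Y E C₀ g1 g2 g3 g4 = ≮⇒≥ λ (hg : suc (2 * (M + 1) * (E + 2) + (4 * (1 + m) * U + 2 * C₀)) ≤ 2 * (M + 1) * (y + Y)) → sum-absurd (0)
  (2 · g1 ⊹ (2 * (M + 1)) · g2 ⊹ (2 * (M + 1)) · g3 ⊹ (2 * (M + 1)) · g4 ⊹ hg)
  (solve (M ∷ m ∷ U ∷ W ∷ X ∷ V ∷ y ∷ Y ∷ E ∷ C₀ ∷ []))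

arith-fixed₂ : ∀ M n k α y Y E D c₃ ν T →
  2 * (M + 1) * (y + Y) ≤ 2 * (M + 1) * (E + 2) + T →
  E ≤ c₃ + α + D + 2 →
  D ≤ ν + k * α + k + 1 →
  k * α ≤ Y →
  n * α ≤ y + y + 1 →
  (M + 1) * (n * α) ≤ (M + 1) * (2 * α + 1 + 2 * (c₃ + ν + k + 5)) + T
arith-fixed₂ M n k α y Y E D c₃ ν T g1 g5 g6 g7 g8 = ≮⇒≥ λ (hg : suc ((M + 1) * (2 * α + 1 + 2 * (c₃ + ν + k + 5)) + T) ≤ (M + 1) * (n * α)) → sum-absurd (0)
  (g1 ⊹ (2 * (M + 1)) · g5 ⊹ (2 * (M + 1)) · g6 ⊹ (2 * (M + 1)) · g7 ⊹ (M + 1) · g8 ⊹ hg)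
  (solve (M ∷ n ∷ k ∷ α ∷ y ∷ Y ∷ E ∷ D ∷ c₃ ∷ ν ∷ T ∷ []))

arith-fixed₃ : ∀ M m n k α U d c₄ ν →
  8 * (1 + m) * (k * n) ≤ M →
  U ≤ 2 * (c₄ + k * d + k + 1) + 1 →
  d ≤ ν + n * α + n + 1 →
  4 * (1 + m) * U ≤ M * α + 4 * (1 + m) * (2 * c₄ + 2 * k * (ν + n + 1) + 2 * k + 3)
arith-fixed₃ M m n k α U d c₄ ν gM g9 g10 = ≮⇒≥ λ (hg : suc (M * α + 4 * (1 + m) * (2 * c₄ + 2 * k * (ν + n + 1) + 2 * k + 3)) ≤ 4 * (1 + m) * U) → sum-absurd (0)
  (α · gM ⊹ (4 * (1 + m)) · g9 ⊹ (8 * (k * (1 + m))) · g10 ⊹ hg)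
  (solve (M ∷ m ∷ n ∷ k ∷ α ∷ U ∷ d ∷ c₄ ∷ ν ∷ []))

arith-fixed₄ : ∀ M n α A T B C₀ →
  3 ≤ n →
  (M + 1) * (n * α) ≤ (M + 1) * (2 * α + A) + (T + C₀) →
  T ≤ M * α + B →
  α ≤ (M + 1) * A + (B + C₀)
arith-fixed₄ M n α A T B C₀ h3 g1 g2 = ≮⇒≥ λ (hg : suc ((M + 1) * A + (B + C₀)) ≤ α) → sum-absurd (0)
  ((α * (M + 1)) · h3 ⊹ g1 ⊹ g2 ⊹ hg)
  (solve (M ∷ n ∷ α ∷ A ∷ T ∷ B ∷ C₀ ∷ []))

-- Pronic d with fixed exponents

square-part : ∀ {T y} → 1 ≤ T → y * y ∣ T → ∃[ T₁ ] (1 ≤ T₁ × T ⊑ T₁ × L y + L T₁ ≤ L T)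
square-part {T} {y} 1≤T (divides q refl) = y * q , 1≤* 1≤y 1≤q ,
  ⊑-* (∣⇒⊑ (n∣m*n y)) (⊑-* (∣⇒⊑ (m∣m*n {y} q)) (∣⇒⊑ (m∣m*n {y} q))) ,
  ≤-trans (L-*-≥ 1≤y (1≤* 1≤y 1≤q)) (≤-reflexive (cong L (rot y q)))
  where
  1≤q = 1≤-*ˡ (y * y) 1≤T
  1≤y = 1≤-*ˡ y (1≤-*ʳ q 1≤T)
  rot : ∀ y q → y * (y * q) ≡ q * (y * y)
  rot = solve-∀

q∣[1+q]^k∸1 : ∀ q k → q ∣ suc q ^ k ∸ 1
q∣[1+q]^k∸1 q k = subst (λ z → q ∣ z ∸ 1) (sym (proj₂ (go k))) (divides (proj₁ (go k)) refl)
  where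
  go : ∀ k → ∃[ m ] suc q ^ k ≡ suc (m * q)
  go zero = 0 , refl
  go (suc k) with go k
  ... | m , eq = suc (m * q) + m , trans (cong (suc q *_) eq) (lem q m)
    where
    lem : ∀ q m → suc q * suc (m * q) ≡ suc ((suc (m * q) + m) * q)
    lem = solve-∀

1+n∸1 : ∀ {w} → 1 ≤ w → suc (w ∸ 1) ≡ w
1+n∸1 h = m+[n∸m]≡n h

-- 4 d is -1 modulo 4 d + 1, so its even powers are 1. For pronic d the divisor is the square (2 x +
-- 1) ^ 2.
[4d+1]∣[4d]²ᵏ∸1 : ∀ k d → 1 ≤ d → 4 * d + 1 ∣ (4 * d) ^ k * (4 * d) ^ k ∸ 1
[4d+1]∣[4d]²ᵏ∸1 k d 1≤d = ∣-trans y²∣q (subst (λ z → q ∣ z ∸ 1) eq (q∣[1+q]^k∸1 q k))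
  where
  w = 4 * d
  1≤w : 1 ≤ w
  1≤w = 1≤* {4} (s≤s z≤n) 1≤d
  q = w * w ∸ 1
  q+1 : suc q ≡ w * w
  q+1 = 1+n∸1 (1≤* 1≤w 1≤w)
  eq : suc q ^ k ≡ w ^ k * w ^ k
  eq = trans (cong (_^ k) q+1) (^-distribʳ-* w w k)
  y²∣q : w + 1 ∣ q
  y²∣q = divides (w ∸ 1) (suc-injective (trans q+1 (subst (λ w → w * w ≡ suc ((w ∸ 1) * (w + 1))) (1+n∸1 1≤w) (lem (w ∸ 1)))))
    where
    lem : ∀ v → suc v * suc v ≡ suc (v * (suc v + 1))
    lem = solve-∀

-- G = n ^ n * d ^ k, as a polynomial in c ^ k, has critical value ± i ^ i * k ^ k.
critical-value : ∀ i k c D → 1 ≤ i → 1 ≤ k → Near (c ^ k) D → ∃[ Y ] (c ^ k ≤ Y ×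
  Y * Y ∣ ∣ ((i + k) ^ (i + k) * (c ^ i * D) ^ k) * ((i + k) ^ (i + k) * (c ^ i * D) ^ k) - self i k * self i k ∣)
critical-value i k c D 1≤i 1≤k nr = go nr
  where
  n = i + k
  z = c ^ k
  G = n ^ n * (c ^ i * D) ^ k
  [cⁱ]ᵏ≡zⁱ : (c ^ i) ^ k ≡ z ^ i
  [cⁱ]ᵏ≡zⁱ = trans (^-*-assoc c i k) (trans (cong (c ^_) (*-comm i k)) (sym (^-*-assoc c k i)))
  G≡ : G ≡ (n * D) ^ k * (n * z) ^ i
  G≡ = trans (cong₂ _*_ (^-distribˡ-+-* n i k) (trans (^-distribʳ-* (c ^ i) D k) (cong (_* D ^ k) [cⁱ]ᵏ≡zⁱ)))
    (trans (rot (n ^ i) (n ^ k) (z ^ i) (D ^ k)) (sym (cong₂ _*_ (^-distribʳ-* n D k) (^-distribʳ-* n z i))))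
    where
    rot : ∀ a b c d → a * b * (c * d) ≡ b * d * (a * c)
    rot = solve-∀
  go : Near z D → ∃[ Y ] (z ≤ Y × Y * Y ∣ ∣ G * G - self i k * self i k ∣)
  -- `Y` is the distance from the critical point: k + Y = n * D and Y - i = n * z, which turns the
  -- polynomial into `G`. For the other sign `i` and `k` change places.
  go (inj₁ refl) = Y , ≤-trans (m≤n*m z n {{>-nonZero (≤-trans 1≤i (m≤m+n i k))}}) (m≤n+m (n * z) i) ,
    subst₂ (λ g s → Y * Y ∣ ∣ g * g - s * s ∣)
      (trans (cong₂ (λ a b → a ^ k * b ^ i) (lem i k z) (∣m-m+n∣≡n i (n * z))) (sym G≡)) (*-comm (k ^ k) (i ^ i))
      (critical-∣ k i Y 1≤k 1≤i)
    where
    Y = i + n * z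
    lem : ∀ i k z → k + (i + (i + k) * z) ≡ (i + k) * suc z
    lem = solve-∀
  go (inj₂ eq) = Y , subst (_≤ Y) (sym eq) (+-mono-≤ 1≤k (m≤n*m D n {{>-nonZero (≤-trans 1≤i (m≤m+n i k))}})) ,
    subst (λ g → Y * Y ∣ ∣ g * g - self i k * self i k ∣)
      (trans (cong₂ (λ a b → a ^ i * b ^ k) (trans (lem i k D) (cong (n *_) (sym eq))) (∣m-m+n∣≡n k (n * D))) (trans (*-comm _ ((n * D) ^ k)) (sym G≡)))
      (critical-∣ i k Y 1≤i 1≤k)
    where
    Y = k + n * D
    lem : ∀ i k D → i + (k + (i + k) * D) ≡ (i + k) * suc D
    lem = solve-∀

i^i∣⇒i≡1 : ∀ i n m → 1 ≤ i → Coprime i n → i ^ i ∣ n ^ m → i ≡ 1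
i^i∣⇒i≡1 i n m 1≤i co h with m^n≡1⇒n≡0∨m≡1 i i (coprime-∣⇒≡1 (coprime-^ i m 1≤i co) h)
... | inj₁ refl = ⊥-elim (1+n≰n 1≤i)
... | inj₂ e = e

-- Both i and k are coprime to i + k, so equality would force i = k = 1.
points-distinct : ∀ i k → 1 ≤ i → 1 ≤ k → Coprime i k → 3 ≤ i + k → (i + k) ^ (i + k) ≢ 4 ^ k * self i k
points-distinct i k 1≤i 1≤k co 3≤n eq = <⇒≱ 3≤n (≤-reflexive (cong₂ _+_ i≡1 k≡1))
  where
  n = i + k
  i⊥n : Coprime i n
  i⊥n (x , y) = co (x , ∣m+n∣m⇒∣n y x)
  k⊥n : Coprime k n
  k⊥n {d} (x , y) = co (∣m+n∣m⇒∣n (subst (d ∣_) (+-comm i k) y) x , x)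
  i≡1 = i^i∣⇒i≡1 i n n 1≤i i⊥n (subst (i ^ i ∣_) (sym eq) (∣n⇒∣m*n (4 ^ k) (m∣m*n (k ^ k))))
  k≡1 = i^i∣⇒i≡1 k n n 1≤k k⊥n (subst (k ^ k ∣_) (sym eq) (∣n⇒∣m*n (4 ^ k) (n∣m*n (i ^ i))))

FourPoints : ℕ → ℕ → ℕ → Set
FourPoints m₁ m₂ M = ∃[ C ] ∀ U U₁ X₁ V₁ → 2 * m₁ ≤ U → 2 * m₂ ≤ U →
  1 ≤ U₁ → 1 ≤ X₁ → 1 ≤ V₁ → U ⊑ U₁ → U ∸ m₁ ⊑ X₁ → U ∸ m₂ ⊑ V₁ →
  2 * M * L U ≤ (M + 1) * L (U₁ * X₁ * V₁) + 2 * (m₁ + m₂) * L U + C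

-- Which of the two values is larger depends on the exponents, so the error term is made symmetric
-- in them.
four-points′ : ABC → ∀ m₁ m₂ M → 1 ≤ m₁ → 1 ≤ m₂ → m₁ ≢ m₂ → 1 ≤ M → FourPoints m₁ m₂ M
four-points′ abc m₁ m₂ M 1≤m₁ 1≤m₂ m₁≢m₂ 1≤M = go (≤-total m₁ m₂)
  where
  rot : ∀ a b c → a * b * c ≡ a * c * b
  rot = solve-∀
  go : m₁ ≤ m₂ ⊎ m₂ ≤ m₁ → FourPoints m₁ m₂ M
  go (inj₁ m₁≤m₂) = proj₁ fp , λ U U₁ X₁ V₁ _ g a b c d e f → ≤-trans (proj₂ fp U U₁ X₁ V₁ g a b c d e f)
      (+-monoˡ-≤ (proj₁ fp) (+-monoʳ-≤ ((M + 1) * L (U₁ * X₁ * V₁)) (*-monoˡ-≤ (L U) (*-monoʳ-≤ 2 (m≤n+m m₂ m₁)))))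
    where fp = four-points abc m₁ m₂ M 1≤m₁ (≤∧≢⇒< m₁≤m₂ m₁≢m₂) 1≤M
  go (inj₂ m₂≤m₁) = proj₁ fp , λ U U₁ X₁ V₁ g _ a b c d e f → ≤-trans (proj₂ fp U U₁ V₁ X₁ g a c b d f e)
      (+-monoˡ-≤ (proj₁ fp) (+-mono-≤ (≤-reflexive (cong (λ z → (M + 1) * L z) (rot U₁ V₁ X₁))) (*-monoˡ-≤ (L U) (*-monoʳ-≤ 2 (m≤m+n m₁ m₂)))))
    where fp = four-points abc m₂ m₁ M 1≤m₂ (≤∧≢⇒< m₂≤m₁ (m₁≢m₂ ∘ sym)) 1≤M

-- Write X₁ and V₁ for the radicals at the two values. The four-point bound says 2 L U ≤ L U₁ + L X₁
-- + L V₁ up to errors, and the squares give L X₁ ≤ L U - L y and L V₁ ≤ L U - L Y. So L y + L Y ≤ L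
-- U₁, that is (n / 2 + k) α ≤ (1 + k) α up to errors, which bounds α when n ≥ 3.
fixed-shape : ABC → ∀ i k → 1 ≤ i → 1 ≤ k → Coprime i k → 3 ≤ i + k →
  ∃[ C ] ∀ c D x → 2 ≤ c → Near (c ^ k) D → c ^ i * D ≡ x * suc x → L c ≤ C
fixed-shape abc i k 1≤i 1≤k i⊥k 3≤n = L (2 * m) + ((M + 1) * A + (B + 2 * C₀)) , bound
  where
  n E m₁ w₀ m₂ m M : ℕ
  n = i + k
  E = n ^ n
  m₁ = E * E
  -- With U = (E * (4 d) ^ k) ^ 2, the value `m₁` belongs to 4 d = -1, where (2 x + 1) ^ 2 vanishes,
  -- and `m₂` is the square of the critical value from `critical-value`, scaled by 4 ^ k.
  w₀ = 4 ^ k * self i k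
  m₂ = w₀ * w₀
  m = m₁ + m₂
  -- Since L U is about 2 k n α, the loss 4 (1 + m) L U is then about M α. This is less than the
  -- surplus (M + 1) (n - 2) α by at least α.
  M = 8 * (1 + m) * (k * n)
  1≤n : 1 ≤ n
  1≤n = ≤-trans 1≤i (m≤m+n i k)
  1≤E : 1 ≤ E
  1≤E = 1≤^ n 1≤n
  1≤w₀ : 1 ≤ w₀
  1≤w₀ = 1≤* (1≤^ k (s≤s z≤n)) (1≤* (1≤^ i 1≤i) (1≤^ k 1≤k))
  E≢w₀ : m₁ ≢ m₂
  E≢w₀ eq = points-distinct i k 1≤i 1≤k i⊥k 3≤n (^-injective 2 (s≤s z≤n) 1≤E 1≤w₀
    (trans (cong (E *_) (*-identityʳ E)) (trans eq (cong (w₀ *_) (sym (*-identityʳ w₀))))))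
  fp : FourPoints m₁ m₂ M
  fp = four-points′ abc m₁ m₂ M (1≤* 1≤E 1≤E) (1≤* 1≤w₀ 1≤w₀) E≢w₀ (1≤* {8 * (1 + m)} (s≤s z≤n) (1≤* 1≤k 1≤n))
  C₀ c₃ c₄ A B : ℕ
  C₀ = proj₁ fp
  c₃ = L (2 * n)
  c₄ = L (4 ^ k * E)
  A = 1 + 2 * (c₃ + N + k + 5)
  B = 4 * (1 + m) * (2 * c₄ + 2 * k * (N + n + 1) + 2 * k + 3)
  module _ (c D x : ℕ) (2≤c : 2 ≤ c) (nr : Near (c ^ k) D) (d≡ : c ^ i * D ≡ x * suc x) where
    1≤c = <⇒≤ 2≤c
    1≤D : 1 ≤ D
    1≤D = Near-1≤ (≤-trans 2≤c (∣⇒≤ {{>-nonZero (1≤^ k 1≤c)}} (m∣m^n c 1≤k))) nr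
    d w y G U : ℕ
    d = c ^ i * D
    w = (4 * d) ^ k
    y = 2 * x + 1
    G = E * d ^ k
    U = (E * w) * (E * w)
    1≤d : 1 ≤ d
    1≤d = 1≤* (1≤^ i 1≤c) 1≤D
    1≤4d : 1 ≤ 4 * d
    1≤4d = 1≤* {4} (s≤s z≤n) 1≤d
    1≤w : 1 ≤ w
    1≤w = 1≤^ k 1≤4d
    Ew≡ : E * w ≡ 4 ^ k * E * d ^ k
    Ew≡ = trans (cong (E *_) (^-distribʳ-* 4 d k)) (rot E (4 ^ k) (d ^ k))
      where
      rot : ∀ a b c → a * (b * c) ≡ b * a * c
      rot = solve-∀
    c≤U : c ≤ U
    c≤U = begin
      c                      ≤⟨ ∣⇒≤ {{>-nonZero 1≤d}} (∣m⇒∣m*n D (m∣m^n c 1≤i)) ⟩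
      d                      ≤⟨ m≤n*m d 4 ⟩
      4 * d                  ≤⟨ ∣⇒≤ {{>-nonZero 1≤w}} (m∣m^n (4 * d) 1≤k) ⟩
      w                      ≤⟨ m≤n*m w E {{>-nonZero 1≤E}} ⟩
      E * w                  ≤⟨ m≤m*n (E * w) (E * w) {{>-nonZero (1≤* 1≤E 1≤w)}} ⟩
      U                      ∎
      where open ≤-Reasoning
    y²≡ : y * y ≡ 4 * d + 1
    y²≡ = trans (lem x) (cong (λ z → 4 * z + 1) (sym d≡))
      where
      lem : ∀ x → (2 * x + 1) * (2 * x + 1) ≡ 4 * (x * suc x) + 1
      lem = solve-∀
    y²∣ : y * y ∣ U ∸ m₁
    y²∣ = subst (y * y ∣_) (trans (*-distribˡ-∸ (E * E) (w * w) 1) (cong₂ _∸_ (rot E w) (*-identityʳ (E * E))))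
      (∣n⇒∣m*n (E * E) (subst (_∣ w * w ∸ 1) (sym y²≡) ([4d+1]∣[4d]²ᵏ∸1 k d 1≤d)))
      where
      rot : ∀ a b → a * a * (b * b) ≡ a * b * (a * b)
      rot = solve-∀
    Y = proj₁ (critical-value i k c D 1≤i 1≤k nr)
    cᵏ≤Y = proj₁ (proj₂ (critical-value i k c D 1≤i 1≤k nr))
    Y²∣ : m₂ ≤ U → Y * Y ∣ U ∸ m₂
    Y²∣ h = subst (Y * Y ∣_) (trans (*-distribˡ-∣-∣ (4 ^ k * 4 ^ k) (G * G) (self i k * self i k))
        (trans (cong₂ ∣_-_∣ (trans (rot (4 ^ k) G) (cong (λ z → z * z) (trans (sym (*-assoc (4 ^ k) E (d ^ k))) (sym Ew≡)))) (rot (4 ^ k) (self i k))) (m≤n⇒∣n-m∣≡n∸m h)))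
      (∣n⇒∣m*n (4 ^ k * 4 ^ k) (proj₂ (proj₂ (critical-value i k c D 1≤i 1≤k nr))))
      where
      rot : ∀ a b → a * a * (b * b) ≡ a * b * (a * b)
      rot = solve-∀
    1≤n′ : 1 ≤ 2 * n
    1≤n′ = 1≤* {2} (s≤s z≤n) 1≤n
    U₁ : ℕ
    U₁ = 2 * n * (c * D)
    U⊑ : U ⊑ U₁
    U⊑ = ⊑-* fEw fEw
      where
      f2 : 2 ⊑ U₁
      f2 = ⊑-*ʳ (c * D) (⊑-*ʳ n (∣⇒⊑ ∣-refl))
      fEw : E * w ⊑ U₁
      fEw = ⊑-* (⊑-^ n (⊑-*ʳ (c * D) (⊑-*ˡ 2 (∣⇒⊑ ∣-refl))))
        (⊑-^ k (⊑-* (⊑-* {2} {2} f2 f2) (⊑-* (⊑-^ i (⊑-*ˡ (2 * n) (⊑-*ʳ D (∣⇒⊑ ∣-refl)))) (⊑-*ˡ (2 * n) (⊑-*ˡ c (∣⇒⊑ ∣-refl))))))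
    LU₁≤ : L U₁ ≤ c₃ + L c + L D + 2
    LU₁≤ = ≤-trans (L-*-≤ 1≤n′ (1≤* 1≤c 1≤D)) (≤-trans (+-monoˡ-≤ 1 (+-monoʳ-≤ c₃ (L-*-≤ 1≤c 1≤D))) (≤-reflexive (lem c₃ (L c) (L D))))
      where
      lem : ∀ a b c → a + (b + c + 1) + 1 ≡ a + b + c + 2
      lem = solve-∀
    L2*≤ : ∀ {a} → 1 ≤ a → L (2 * a) ≤ N + L a + 1
    L2*≤ {a} 1≤a = ≤-trans (L-*-≤ (s≤s z≤n) 1≤a) (≤-reflexive (cong (λ z → z + L a + 1) L2≡N))
    LD≤ : L D ≤ N + k * L c + k + 1
    LD≤ = ≤-trans (L-mono (Near-≤ (1≤^ k 1≤c) nr)) (≤-trans (L2*≤ (1≤^ k 1≤c)) (≤-trans (+-monoˡ-≤ 1 (+-monoʳ-≤ N (L-^-≤ k 1≤c))) (≤-reflexive (lem N (k * L c) k))))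
      where
      lem : ∀ a b c → a + (b + c) + 1 ≡ a + b + c + 1
      lem = solve-∀
    cⁿ≡ : c ^ n ≡ c ^ i * c ^ k
    cⁿ≡ = ^-distribˡ-+-* c i k
    cⁿ≤2d : c ^ n ≤ 2 * d
    cⁿ≤2d = ≤-trans (≤-reflexive cⁿ≡) (≤-trans (*-monoʳ-≤ (c ^ i) (Near-≥ 1≤D nr)) (≤-reflexive (rot (c ^ i) D)))
      where
      rot : ∀ a b → a * (2 * b) ≡ 2 * (a * b)
      rot = solve-∀
    d≤2cⁿ : d ≤ 2 * c ^ n
    d≤2cⁿ = ≤-trans (*-monoʳ-≤ (c ^ i) (Near-≤ (1≤^ k 1≤c) nr)) (≤-reflexive (trans (rot (c ^ i) (c ^ k)) (cong (2 *_) (sym cⁿ≡))))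
      where
      rot : ∀ a b → a * (2 * b) ≡ 2 * (a * b)
      rot = solve-∀
    1≤y : 1 ≤ y
    1≤y = m≤n+m 1 (2 * x)
    nα≤ : n * L c ≤ L y + L y + 1
    nα≤ = ≤-trans (L-^-≥ n 1≤c) (≤-trans (L-mono (≤-trans cⁿ≤2d (≤-trans (*-monoˡ-≤ d (m≤m+n 2 2)) (≤-trans (m≤m+n (4 * d) 1) (≤-reflexive (sym y²≡)))))) (L-*-≤ 1≤y 1≤y))
    Ld≤ : L d ≤ N + n * L c + n + 1
    Ld≤ = ≤-trans (L-mono d≤2cⁿ) (≤-trans (L2*≤ (1≤^ n 1≤c)) (≤-trans (+-monoˡ-≤ 1 (+-monoʳ-≤ N (L-^-≤ n 1≤c))) (≤-reflexive (lem N (n * L c) n))))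
      where
      lem : ∀ a b c → a + (b + c) + 1 ≡ a + b + c + 1
      lem = solve-∀
    LU≤ : L U ≤ 2 * (c₄ + k * L d + k + 1) + 1
    LU≤ = ≤-trans (L-*-≤ (1≤* 1≤E 1≤w) (1≤* 1≤E 1≤w)) (+-monoˡ-≤ 1 (≤-trans (+-mono-≤ LEw≤ LEw≤) (≤-reflexive (cong (c₄ + k * L d + k + 1 +_) (sym (+-identityʳ _))))))
      where
      lem : ∀ a b c → a + (b + c) + 1 ≡ a + b + c + 1
      lem = solve-∀
      LEw≤ : L (E * w) ≤ c₄ + k * L d + k + 1
      LEw≤ = ≤-trans (≤-reflexive (cong L Ew≡)) (≤-trans (L-*-≤ (1≤* (1≤^ k (s≤s z≤n)) 1≤E) (1≤^ k 1≤d)) (≤-trans (+-monoˡ-≤ 1 (+-monoʳ-≤ c₄ (L-^-≤ k 1≤d))) (≤-reflexive (lem c₄ (k * L d) k))))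
    large : 2 * m ≤ U → L c ≤ (M + 1) * A + (B + 2 * C₀)
    large 2m≤U = arith-fixed₄ M n (L c) A (4 * (1 + m) * L U) B (2 * C₀) 3≤n
      (≤-trans (arith-fixed₂ M n k (L c) (L y) (L Y) (L U₁) (L D) c₃ N (4 * (1 + m) * L U + 2 * C₀)
        (arith-fixed₁ M m (L U) (L (U₁ * X₁ * V₁)) (L X₁) (L V₁) (L y) (L Y) (L U₁) C₀
          (proj₂ fp U U₁ X₁ V₁ 2m₁≤U 2m₂≤U 1≤U₁ 1≤X₁ 1≤V₁ U⊑ X⊑ V⊑)
          (≤-trans (L-*-≤ (1≤* 1≤U₁ 1≤X₁) 1≤V₁) (≤-trans (+-monoˡ-≤ 1 (+-monoˡ-≤ (L V₁) (L-*-≤ 1≤U₁ 1≤X₁))) (≤-reflexive (lem (L U₁) (L X₁) (L V₁)))))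
          (≤-trans LX≤ (L-mono (m∸n≤m U m₁))) (≤-trans LV≤ (L-mono (m∸n≤m U m₂))))
        LU₁≤ LD≤ (≤-trans (L-^-≥ k 1≤c) (L-mono cᵏ≤Y)) nα≤)
        (≤-reflexive (cong (λ z → (M + 1) * z + (4 * (1 + m) * L U + 2 * C₀)) (+-assoc (2 * L c) 1 _))))
      (arith-fixed₃ M m n k (L c) (L U) (L d) c₄ N ≤-refl LU≤ Ld≤)
      where
      lem : ∀ a b c → a + b + 1 + c + 1 ≡ a + b + c + 2
      lem = solve-∀
      2m₁≤U : 2 * m₁ ≤ U
      2m₁≤U = ≤-trans (*-monoʳ-≤ 2 (m≤m+n m₁ m₂)) 2m≤U
      2m₂≤U : 2 * m₂ ≤ U
      2m₂≤U = ≤-trans (*-monoʳ-≤ 2 (m≤n+m m₂ m₁)) 2m≤U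
      1≤U∸ : ∀ {p} → 1 ≤ p → 2 * p ≤ U → 1 ≤ U ∸ p
      1≤U∸ {p} 1≤p 2p≤U = m<n⇒0<n∸m (≤-trans (subst (suc p ≤_) (cong (p +_) (sym (+-identityʳ p))) (+-monoˡ-≤ p 1≤p)) 2p≤U)
      1≤U₁ : 1 ≤ U₁
      1≤U₁ = 1≤* 1≤n′ (1≤* 1≤c 1≤D)
      spX = square-part {U ∸ m₁} {y} (1≤U∸ (1≤* 1≤E 1≤E) 2m₁≤U) y²∣
      spV = square-part {U ∸ m₂} {Y} (1≤U∸ (1≤* 1≤w₀ 1≤w₀) 2m₂≤U) (Y²∣ (≤-trans (m≤m+n m₂ _) 2m₂≤U))
      X₁ = proj₁ spX
      V₁ = proj₁ spV
      1≤X₁ = proj₁ (proj₂ spX)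
      1≤V₁ = proj₁ (proj₂ spV)
      X⊑ = proj₁ (proj₂ (proj₂ spX))
      V⊑ = proj₁ (proj₂ (proj₂ spV))
      LX≤ = proj₂ (proj₂ (proj₂ spX))
      LV≤ = proj₂ (proj₂ (proj₂ spV))
    bound : L c ≤ L (2 * m) + ((M + 1) * A + (B + 2 * C₀))
    bound = [ (λ 2m≤U → ≤-trans (large 2m≤U) (m≤n+m _ (L (2 * m)))) ,
              (λ U≤2m → ≤-trans (L-mono (≤-trans c≤U U≤2m)) (m≤m+n _ _)) ]′ (≤-total (2 * m) U)

arith-a₁ : ∀ ν κ m i α y →
  1 ≤ ν →
  ν * κ + 30 * ν * ν + 100 * ν ≤ m * α →
  ν ≤ α →
  3 ≤ m →
  i ≤ m →
  ν * (m * α) ≤ (ν + 1) * (4 * ν + α + y + i * α + i + 7) + ν * κ →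
  y + y ≤ 4 * ν + m * α + m + 5 →
  ν * (m * α) ≤ ν * ((2 * i + 2) * α) + 20 * (m * α)
arith-a₁ ν κ m i α y hν hb hα h3 hi h0 h1 = ≮⇒≥ λ (hg : suc (ν * ((2 * i + 2) * α) + 20 * (m * α)) ≤ ν * (m * α)) → sum-absurd (2 + 25 * m * α + 450 * ν + 144 * ν * ν)
  (57 · hν ⊹ (3 * m) · hν ⊹ (6 * i) · hν ⊹ 6 · hb ⊹ (6 * m) · hα ⊹ (12 * i) · hα ⊹ (2 * α) · h3 ⊹ (18 * α) · hi ⊹ 6 · h0 ⊹ (3 * (ν + 1)) · h1 ⊹ 3 · hg)
  (solve (ν ∷ κ ∷ m ∷ i ∷ α ∷ y ∷ []))

arith-a₂ : ∀ ν κ m k α X D →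
  1 ≤ ν →
  ν * κ + 30 * ν * ν + 100 * ν ≤ m * α →
  ν ≤ α →
  3 ≤ m →
  k ≤ m →
  ν * X ≤ (ν + 1) * (α + D + 1) + ν * κ →
  D ≤ ν + k * α + k + 1 →
  m * α ≤ ν + (X + X + 1) + 1 →
  ν * (m * α) ≤ ν * ((2 * k + 2) * α) + 20 * (m * α)
arith-a₂ ν κ m k α X D hν hb hα h3 hi h0 h2 h1 = ≮⇒≥ λ (hg : suc (ν * ((2 * k + 2) * α) + 20 * (m * α)) ≤ ν * (m * α)) → sum-absurd (2 + 34 * m * α + 564 * ν + 171 * ν * ν)
  (12 · hν ⊹ (6 * k) · hν ⊹ 6 · hb ⊹ (12 * k) · hα ⊹ (2 * α) · h3 ⊹ (18 * α) · hi ⊹ 6 · h0 ⊹ (6 * (ν + 1)) · h2 ⊹ (3 * ν) · h1 ⊹ 3 · hg)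
  (solve (ν ∷ κ ∷ m ∷ k ∷ α ∷ X ∷ D ∷ []))

arith-a₃ : ∀ ν κ α A A′ a b s t μ l D →
  ν * A ≤ (ν + 1) * (α + t + 1 + μ + 1) + ν * κ →
  ν * A′ ≤ (ν + 1) * (α + s + 1 + l + 1) + ν * κ →
  a * α + (D + D) ≤ A + A′ + 1 →
  t + s ≤ D →
  μ + l ≤ (a + b) * α + (a + b) →
  ν * D ≤ ν * (2 * α + b * α) + ((2 + a + b) * α + D + (ν + 1) * (a + b + 4) + 2 * ν * κ + ν)
arith-a₃ ν κ α A A′ a b s t μ l D h1 h2 h3 h4 h5 = ≮⇒≥ λ (hg : suc (ν * (2 * α + b * α) + ((2 + a + b) * α + D + (ν + 1) * (a + b + 4) + 2 * ν * κ + ν)) ≤ ν * D) → sum-absurd (0)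
  (h1 ⊹ h2 ⊹ ν · h3 ⊹ (ν + 1) · h4 ⊹ (ν + 1) · h5 ⊹ hg)
  (solve (ν ∷ κ ∷ α ∷ A ∷ A′ ∷ a ∷ b ∷ s ∷ t ∷ μ ∷ l ∷ D ∷ []))

arith-a₄ : ∀ ν κ m k α a b D →
  1 ≤ ν →
  ν * κ + 30 * ν * ν + 100 * ν ≤ m * α →
  ν ≤ α →
  3 ≤ m →
  k ≤ m →
  a + b ≤ 3 * m →
  ν * D ≤ ν * (2 * α + b * α) + ((2 + a + b) * α + D + (ν + 1) * (a + b + 4) + 2 * ν * κ + ν) →
  D ≤ ν + k * α + k + 1 →
  k * α ≤ ν + D + 1 →
  ν * (k * α) ≤ ν * ((2 + b) * α) + 20 * (m * α)
arith-a₄ ν κ m k α a b D hν hb hα h3 hi ha h1 h2 h6 = ≮⇒≥ λ (hg : suc (ν * ((2 + b) * α) + 20 * (m * α)) ≤ ν * (k * α)) → sum-absurd (2 + 19 * m * α + 564 * ν + 177 * ν * ν)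
  (15 · hν ⊹ (3 * k) · hν ⊹ (3 * a) · hν ⊹ (3 * b) · hν ⊹ 6 · hb ⊹ (18 * m) · hα ⊹ (3 * k) · hα ⊹ (2 * α) · h3 ⊹ (6 * α) · hi ⊹ (3 * α) · ha ⊹ (6 * ν) · ha ⊹ 3 · h1 ⊹ 3 · h2 ⊹ (3 * ν) · h6 ⊹ 3 · hg)
  (solve (ν ∷ κ ∷ m ∷ k ∷ α ∷ a ∷ b ∷ D ∷ []))

arith-50 : ∀ ν m k p →
  1000 ≤ ν →
  ν * k ≤ ν * p + 20 * m →
  50 * k ≤ 50 * p + m
arith-50 ν m k p hν h = ≮⇒≥ λ (hg : suc (50 * p + m) ≤ 50 * k) → sum-absurd (999)
  (m · hν ⊹ hν ⊹ 50 · h ⊹ ν · hg)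
  (solve (ν ∷ m ∷ k ∷ p ∷ []))

shape-≥ : ∀ i δ →
  50 * (i + (i + δ)) ≤ 50 * (2 * i + 2) + (i + (i + δ)) →
  50 * (i + δ) ≤ 50 * (2 + δ) + (i + (i + δ)) →
  i + (i + δ) ≤ 6
shape-≥ i δ h1 h3 = ≮⇒≥ λ (hg : suc 6 ≤ i + (i + δ)) → sum-absurd (28)
  (h1 ⊹ 2 · h3 ⊹ 47 · hg)
  (solve (i ∷ δ ∷ []))

shape-≤ : ∀ k δ →
  50 * (k + δ + k) ≤ 50 * (2 * k + 2) + (k + δ + k) →
  50 * k ≤ 50 * (2 + 0) + (k + δ + k) →
  k + δ + k ≤ 6
shape-≤ k δ h2 h3 = ≮⇒≥ λ (hg : suc 6 ≤ k + δ + k) → sum-absurd (28)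
  (h2 ⊹ 2 · h3 ⊹ 47 · hg)
  (solve (k ∷ δ ∷ []))

-- Pronic d with large exponents

BigA : ℕ → ℕ → Set
BigA κ t = N * κ + 30 * N * N + 100 * N ≤ t

cancel-α : ∀ ν k p m α → 1 ≤ α → ν * (k * α) ≤ ν * (p * α) + 20 * (m * α) → ν * k ≤ ν * p + 20 * m
cancel-α ν k p m α 1≤α h = *-cancelʳ-≤ _ _ α {{>-nonZero 1≤α}}
  (subst₂ _≤_ (sym (*-assoc ν k α)) (sym (eq ν p m α)) h)
  where
  eq : ∀ ν p m α → (ν * p + 20 * m) * α ≡ ν * (p * α) + 20 * (m * α)
  eq = solve-∀

module Pronic {d κ : ℕ} (abc : ABCLog κ) (S : Sol d) (x : ℕ) (d≡x : d ≡ x * suc x) (3≤n : 3 ≤ Sol.n S)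
  (big : BigA κ (Sol.n S * L (Sol.c S))) where
  open Sol S
  open SolLog S using (α; N≤α; t≤Lcᵏ; Lcᵏ≤; LD≤Lcᵏ)

  v y : ℕ
  v = c ^ i
  y = 2 * x + 1

  1≤α : 1 ≤ α
  1≤α = ≤-trans 1≤N N≤α
  1≤v : 1 ≤ v
  1≤v = 1≤^ i 1≤c
  1≤u : 1 ≤ u S
  1≤u = 1≤^ n 1≤c
  1≤d : 1 ≤ d
  1≤d = subst (1 ≤_) (sym d≡) (1≤* 1≤v 1≤D)
  1≤x : 1 ≤ x
  1≤x = 1≤-*ˡ (suc x) (subst (1 ≤_) d≡x 1≤d)
  1≤y : 1 ≤ y
  1≤y = m≤n+m 1 (2 * x)
  i≤n : i ≤ n
  i≤n = m≤m+n i k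
  k≤n : k ≤ n
  k≤n = m≤n+m k i

  u≤2d : u S ≤ 2 * d
  u≤2d = Ordered.u≤ abc S S
  d≤2u : d ≤ 2 * u S
  d≤2u = Ordered.d≤ abc S S

  LD≤ : L D ≤ N + k * α + k + 1
  LD≤ = ≤-trans LD≤Lcᵏ (≤-trans (+-monoˡ-≤ 1 (+-monoʳ-≤ N (L-^-≤ k 1≤c))) (≤-reflexive (eq N (k * α) k)))
    where
    eq : ∀ a b c → a + (b + c) + 1 ≡ a + b + c + 1
    eq = solve-∀

  y²≡ : y * y ≡ 4 * d + 1
  y²≡ = trans (lem x) (cong (λ z → 4 * z + 1) (sym d≡x))
    where
    lem : ∀ x → (2 * x + 1) * (2 * x + 1) ≡ 4 * (x * suc x) + 1
    lem = solve-∀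

  L2^≤ : ∀ m {a} → 1 ≤ a → L (2 ^ m * a) ≤ m * N + m + L a + 1
  L2^≤ m {a} 1≤a = ≤-trans (L-*-≤ (1≤^ m (s≤s z≤n)) 1≤a) (+-monoˡ-≤ 1 (+-monoˡ-≤ (L a) (≤-trans (L-^-≤ m (s≤s z≤n)) (≤-reflexive (cong (λ z → m * z + m) L2≡N)))))

  -- 4 u and (2 x + 1) ^ 2 = 4 d + 1 differ by at most 8 c ^ i and have their primes in 2 c (2 x +
  -- 1). As 2 x + 1 is about c ^ (n / 2), up to a constant factor, n ≤ 1 + n / 2 + i up to errors.
  step₁ : 50 * n ≤ 50 * (2 * i + 2) + n
  step₁ = arith-50 N n n (2 * i + 2) 1000≤N (cancel-α N n (2 * i + 2) n α 1≤α (arith-a₁ N κ n i α (L y) 1≤N big N≤α 3≤n i≤n h₀ h₁))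
    where
    A B R : ℕ
    A = 4 * u S
    B = y * y
    R = 2 * (c * y)
    1≤R : 1 ≤ R
    1≤R = 1≤* {2} (s≤s z≤n) (1≤* 1≤c 1≤y)
    A≢B : A ≢ B
    A≢B eq = ¬4∣1 (∣m+n∣m⇒∣n (subst (4 ∣_) (trans eq y²≡) (m∣m*n (u S))) (m∣m*n d))
      where
      ¬4∣1 : ¬ (4 ∣ 1)
      ¬4∣1 h with ∣⇒≤ h
      ... | s≤s ()
    ∣u-d∣≤v : ∣ u S - d ∣ ≤ v
    ∣u-d∣≤v = [ (λ h → ≤-trans (≤-reflexive (m≤n⇒∣m-n∣≡n∸m h)) (m≤n+o⇒m∸n≤o d (u S) (d≤u+v S)))
              , (λ h → ≤-trans (≤-reflexive (m≤n⇒∣n-m∣≡n∸m h)) (m≤n+o⇒m∸n≤o (u S) d (u≤d+v S))) ]′ (≤-total (u S) d)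
    ∣A-B∣≤ : ∣ A - B ∣ ≤ 2 ^ 3 * v
    ∣A-B∣≤ = begin
      ∣ 4 * u S - y * y ∣                          ≡⟨ cong (∣ 4 * u S -_∣) y²≡ ⟩
      ∣ 4 * u S - 4 * d + 1 ∣                      ≤⟨ ∣-∣-triangle (4 * u S) (4 * d) (4 * d + 1) ⟩
      ∣ 4 * u S - 4 * d ∣ + ∣ 4 * d - 4 * d + 1 ∣  ≡⟨ cong₂ _+_ (sym (*-distribˡ-∣-∣ 4 (u S) d)) (∣m-m+n∣≡n (4 * d) 1) ⟩
      4 * ∣ u S - d ∣ + 1                          ≤⟨ +-mono-≤ (*-monoʳ-≤ 4 ∣u-d∣≤v) 1≤v ⟩
      4 * v + v                                    ≤⟨ +-monoʳ-≤ (4 * v) (m≤n*m v 4) ⟩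
      4 * v + 4 * v                                ≡⟨ sym (*-distribʳ-+ v 4 4) ⟩
      8 * v                                        ∎
      where open ≤-Reasoning
    h₀ : N * (n * α) ≤ (N + 1) * (4 * N + α + L y + i * α + i + 7) + N * κ
    h₀ = begin
      N * (n * α)                                   ≤⟨ *-monoʳ-≤ N (≤-trans (L-^-≥ n 1≤c) (L-mono (m≤n*m (u S) 4))) ⟩
      N * L A                                       ≤⟨ proj₁ (abc A B R (1≤* {4} (s≤s z≤n) 1≤u) (1≤* 1≤y 1≤y) 1≤R A≢B fA fB) ⟩
      (N + 1) * L (R * ∣ A - B ∣) + N * κ           ≤⟨ +-monoˡ-≤ (N * κ) (*-monoʳ-≤ (N + 1) (begin
        L (R * ∣ A - B ∣)                           ≤⟨ L-mono (*-monoʳ-≤ R ∣A-B∣≤) ⟩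
        L (R * (2 ^ 3 * v))                         ≤⟨ L-*-≤ 1≤R (1≤* {2 ^ 3} (s≤s z≤n) 1≤v) ⟩
        L R + L (2 ^ 3 * v) + 1                     ≤⟨ +-monoˡ-≤ 1 (+-mono-≤ LR≤ (≤-trans (L2^≤ 3 1≤v) (+-monoˡ-≤ 1 (+-monoʳ-≤ (3 * N + 3) (L-^-≤ i 1≤c))))) ⟩
        N + (α + L y + 1) + 1 + (3 * N + 3 + (i * α + i) + 1) + 1  ≡⟨ eq N α (L y) (i * α) i ⟩
        4 * N + α + L y + i * α + i + 7             ∎)) ⟩
      (N + 1) * (4 * N + α + L y + i * α + i + 7) + N * κ  ∎
      where
      open ≤-Reasoning
      eq : ∀ n a y b i → n + (a + y + 1) + 1 + (3 * n + 3 + (b + i) + 1) + 1 ≡ 4 * n + a + y + b + i + 7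
      eq = solve-∀
      LR≤ : L R ≤ N + (α + L y + 1) + 1
      LR≤ = ≤-trans (L-*-≤ (s≤s z≤n) (1≤* 1≤c 1≤y)) (+-monoˡ-≤ 1 (+-mono-≤ (≤-reflexive L2≡N) (L-*-≤ 1≤c 1≤y)))
      fA : A ⊑ R
      fA = ⊑-* (⊑-* {2} {2} f2 f2) (⊑-^ n (⊑-*ˡ 2 (⊑-*ʳ y (∣⇒⊑ ∣-refl))))
        where
        f2 : 2 ⊑ R
        f2 = ⊑-*ʳ (c * y) (∣⇒⊑ ∣-refl)
      fB : B ⊑ R
      fB = ⊑-* fy fy
        where
        fy : y ⊑ R
        fy = ⊑-*ˡ 2 (⊑-*ˡ c (∣⇒⊑ ∣-refl))
    h₁ : L y + L y ≤ 4 * N + n * α + n + 5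
    h₁ = begin
      L y + L y                              ≤⟨ L-*-≥ 1≤y 1≤y ⟩
      L (y * y)                              ≤⟨ L-mono y²≤ ⟩
      L (2 ^ 4 * u S)                        ≤⟨ L2^≤ 4 1≤u ⟩
      4 * N + 4 + L (u S) + 1                ≤⟨ +-monoˡ-≤ 1 (+-monoʳ-≤ (4 * N + 4) (L-^-≤ n 1≤c)) ⟩
      4 * N + 4 + (n * α + n) + 1            ≡⟨ eq (4 * N) (n * α) n ⟩
      4 * N + n * α + n + 5                  ∎
      where
      open ≤-Reasoning
      eq : ∀ a b c → a + 4 + (b + c) + 1 ≡ a + b + c + 5
      eq = solve-∀
      y²≤ : y * y ≤ 16 * u S
      y²≤ = begin
        y * y              ≡⟨ y²≡ ⟩
        4 * d + 1          ≤⟨ +-monoʳ-≤ (4 * d) (≤-trans 1≤d (m≤n*m d 4)) ⟩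
        4 * d + 4 * d      ≡⟨ sym (*-distribʳ-+ d 4 4) ⟩
        8 * d              ≤⟨ *-monoʳ-≤ 8 d≤2u ⟩
        8 * (2 * u S)      ≡⟨ sym (*-assoc 8 2 (u S)) ⟩
        16 * u S           ∎

  -- The neighbours x and x + 1 are about c ^ (n / 2) and have their primes in c * D, so n / 2 ≤ 1 +
  -- k up to errors.
  step₂ : 50 * n ≤ 50 * (2 * k + 2) + n
  step₂ = arith-50 N n n (2 * k + 2) 1000≤N (cancel-α N n (2 * k + 2) n α 1≤α (arith-a₂ N κ n k α (L (suc x)) (L D) 1≤N big N≤α 3≤n k≤n h₀ LD≤ h₁))
    where
    1≤R = 1≤* 1≤c 1≤D
    f : ∀ {m} → m ∣ d → m ⊑ c * D
    f m∣d = ⊑-trans (∣⇒⊑ m∣d) (d⊑cD S)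
    ∣x-sx∣ : ∣ x - suc x ∣ ≡ 1
    ∣x-sx∣ = Near-∣-∣ {x} {suc x} (inj₁ refl)
    h₀ : N * L (suc x) ≤ (N + 1) * (α + L D + 1) + N * κ
    h₀ = ≤-trans (proj₂ (abc x (suc x) (c * D) 1≤x (s≤s z≤n) 1≤R (λ e → 1+n≢n (sym e))
        (f (subst (x ∣_) (sym d≡x) (m∣m*n (suc x)))) (f (subst (suc x ∣_) (sym d≡x) (n∣m*n x)))))
      (+-monoˡ-≤ (N * κ) (*-monoʳ-≤ (N + 1) (≤-trans (≤-reflexive (cong L (trans (cong (c * D *_) ∣x-sx∣) (*-identityʳ (c * D))))) (L-*-≤ 1≤c 1≤D))))
    h₁ : n * α ≤ N + (L (suc x) + L (suc x) + 1) + 1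
    h₁ = begin
      n * α                            ≤⟨ L-^-≥ n 1≤c ⟩
      L (u S)                          ≤⟨ L-mono (≤-trans u≤2d (*-monoʳ-≤ 2 (≤-trans (≤-reflexive d≡x) (*-monoˡ-≤ (suc x) (n≤1+n x))))) ⟩
      L (2 * (suc x * suc x))          ≤⟨ L-*-≤ (s≤s z≤n) (1≤* {suc x} (s≤s z≤n) (s≤s z≤n)) ⟩
      L 2 + L (suc x * suc x) + 1      ≤⟨ +-monoˡ-≤ 1 (+-mono-≤ (≤-reflexive L2≡N) (L-*-≤ {suc x} (s≤s z≤n) (s≤s z≤n))) ⟩
      N + (L (suc x) + L (suc x) + 1) + 1 ∎
      where open ≤-Reasoning

  x⊥sx : Coprime x (suc x)
  x⊥sx {e} (p , q) = ∣1⇒≡1 (∣m+n∣m⇒∣n (subst (e ∣_) (+-comm 1 x) q) p)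

  -- c ^ i divides x (x + 1) with coprime factors. So `c` splits into the part `q` with primes in x
  -- and the part `r` coprime to x, and q ^ i and r ^ i divide one factor each.
  record Split : Set where
    field
      q r s t : ℕ
      c≡ : c ≡ q * r
      x≡ : x ≡ s * q ^ i
      sx≡ : suc x ≡ t * r ^ i
      D≡ : D ≡ s * t

  split : Split
  split with coprime-part c x 1≤c
  ... | q , r , c≡ , q⊑x , r⊥x = build q∣x r∣sx
    where
    1≤q = 1≤-*ˡ r (subst (1 ≤_) c≡ 1≤c)
    1≤r = 1≤-*ʳ q (subst (1 ≤_) c≡ 1≤c)
    v≡ : v ≡ q ^ i * r ^ i
    v≡ = trans (cong (_^ i) c≡) (^-distribʳ-* q r i)
    v∣ : v ∣ x * suc x
    v∣ = subst (v ∣_) (trans (sym d≡) d≡x) (m∣m*n D)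
    q∣x : q ^ i ∣ x
    q∣x = coprime-divisor (coprime-⊑ (1≤^ i 1≤q) (⊑-^ i q⊑x) (∣⇒⊑ ∣-refl) x⊥sx)
      (∣-trans (subst (q ^ i ∣_) (sym v≡) (m∣m*n (r ^ i))) (subst (v ∣_) (*-comm x (suc x)) v∣))
    r∣sx : r ^ i ∣ suc x
    r∣sx = coprime-divisor (coprime-⊑ (1≤^ i 1≤r) (⊑-^ i (∣⇒⊑ ∣-refl)) (∣⇒⊑ ∣-refl) r⊥x)
      (∣-trans (subst (r ^ i ∣_) (sym v≡) (n∣m*n (q ^ i))) v∣)
    build : q ^ i ∣ x → r ^ i ∣ suc x → Split
    build (divides s x≡) (divides t sx≡) = record { q = q ; r = r ; s = s ; t = t ; c≡ = c≡ ; x≡ = x≡ ; sx≡ = sx≡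
      ; D≡ = *-cancelˡ-≡ D (s * t) v {{>-nonZero 1≤v}} (trans (sym d≡) (trans d≡x (trans (cong₂ _*_ x≡ sx≡) (trans (rot s (q ^ i) t (r ^ i)) (cong (_* (s * t)) (sym v≡)))))) }
      where
      rot : ∀ a b c d → a * b * (c * d) ≡ b * d * (a * c)
      rot = solve-∀

  -- As u = x ^ 2 + x ∓ v, the differences are x + 1 ± v and, in absolute value, x ∓ v; their
  -- product differs from v ^ 2 only by u. Neither factor need be small, but the product is
  -- controlled.
  product-of-differences : ∣ suc x * suc x - u S ∣ * ∣ x * x - u S ∣ ≡ ∣ v * v - u S ∣
  product-of-differences = go near
    where
    dm≡ : ∀ {m} → d ≡ v * m → x * x + x ≡ v * m
    dm≡ e = trans (lem x) (trans (sym d≡x) e)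
      where
      lem : ∀ x → x * x + x ≡ x * suc x
      lem = solve-∀
    go : Near (c ^ k) D → ∣ suc x * suc x - u S ∣ * ∣ x * x - u S ∣ ≡ ∣ v * v - u S ∣
    go (inj₁ D≡) = begin
      ∣ suc x * suc x - U ∣ * ∣ x * x - U ∣               ≡⟨ cong₂ _*_ e₁ e₂ ⟩
      (x + 1 + v) * ∣ v - x ∣                             ≡⟨ *-distribˡ-∣-∣ (x + 1 + v) v x ⟩
      ∣ (x + 1 + v) * v - (x + 1 + v) * x ∣               ≡⟨ cong₂ ∣_-_∣ (l₁ x v) (trans (l₂ x v) (trans (cong (_+ x * v) U+v) (l₃ U v (x * v)))) ⟩
      ∣ (x * v + v) + v * v - (x * v + v) + U ∣           ≡⟨ ∣m+n-m+o∣≡∣n-o∣ (x * v + v) (v * v) U ⟩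
      ∣ v * v - U ∣                                       ∎
      where
      open ≡-Reasoning
      U = u S
      U+v : x * x + x ≡ U + v
      U+v = trans (dm≡ d≡) (trans (cong (v *_) D≡) (trans (*-suc v (c ^ k)) (trans (+-comm v (v * c ^ k)) (cong (_+ v) (sym (u≡ S))))))
      e₁ : ∣ suc x * suc x - U ∣ ≡ x + 1 + v
      e₁ = trans (cong (∣_- U ∣) (trans (l x) (trans (cong (_+ (x + 1)) U+v) (l′ U v (x + 1))))) (trans (∣-∣-comm (U + (x + 1 + v)) U) (∣m-m+n∣≡n U (x + 1 + v)))
        where
        l : ∀ x → suc x * suc x ≡ x * x + x + (x + 1)
        l = solve-∀
        l′ : ∀ u v w → u + v + w ≡ u + (w + v)
        l′ = solve-∀
      e₂ : ∣ x * x - U ∣ ≡ ∣ v - x ∣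
      e₂ = trans (sym (∣m+n-m+o∣≡∣n-o∣ x (x * x) U)) (trans (cong₂ ∣_-_∣ (trans (+-comm x (x * x)) U+v) (+-comm x U)) (∣m+n-m+o∣≡∣n-o∣ U v x))
      l₁ : ∀ x v → (x + 1 + v) * v ≡ x * v + v + v * v
      l₁ = solve-∀
      l₂ : ∀ x v → (x + 1 + v) * x ≡ x * x + x + x * v
      l₂ = solve-∀
      l₃ : ∀ u v w → u + v + w ≡ w + v + u
      l₃ = solve-∀
    go (inj₂ cᵏ≡) = begin
      ∣ suc x * suc x - U ∣ * ∣ x * x - U ∣               ≡⟨ cong₂ _*_ e₁ e₂ ⟩
      ∣ x + 1 - v ∣ * (x + v)                             ≡⟨ *-comm ∣ x + 1 - v ∣ (x + v) ⟩
      (x + v) * ∣ x + 1 - v ∣                             ≡⟨ *-distribˡ-∣-∣ (x + v) (x + 1) v ⟩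
      ∣ (x + v) * (x + 1) - (x + v) * v ∣                 ≡⟨ cong₂ ∣_-_∣ (trans (l₁ x v) (cong (x * v +_) (sym U≡))) (*-distribʳ-+ v x v) ⟩
      ∣ x * v + U - x * v + v * v ∣                       ≡⟨ ∣m+n-m+o∣≡∣n-o∣ (x * v) U (v * v) ⟩
      ∣ U - v * v ∣                                       ≡⟨ ∣-∣-comm U (v * v) ⟩
      ∣ v * v - U ∣                                       ∎
      where
      open ≡-Reasoning
      U = u S
      U≡ : U ≡ x * x + x + v
      U≡ = trans (u≡ S) (trans (cong (v *_) cᵏ≡) (trans (*-suc v D) (trans (+-comm v (v * D)) (cong (_+ v) (sym (dm≡ d≡))))))
      e₁ : ∣ suc x * suc x - U ∣ ≡ ∣ x + 1 - v ∣
      e₁ = trans (cong₂ ∣_-_∣ (l x) U≡) (∣m+n-m+o∣≡∣n-o∣ (x * x + x) (x + 1) v)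
        where
        l : ∀ x → suc x * suc x ≡ x * x + x + (x + 1)
        l = solve-∀
      e₂ : ∣ x * x - U ∣ ≡ x + v
      e₂ = trans (cong (∣ x * x -_∣) (trans U≡ (+-assoc (x * x) x v))) (∣m-m+n∣≡n (x * x) (x + v))
      l₁ : ∀ x v → (x + v) * (x + 1) ≡ x * v + (x * x + x + v)
      l₁ = solve-∀

  -- c ^ m is a common factor of v ^ 2 = c ^ (2 i) and u = c ^ n. Its part r ^ m is cancelled from
  -- (x + 1) ^ 2 and u, its part q ^ m from x ^ 2 and u.
  module _ (m a b : ℕ) (2i≡ : i + i ≡ m + a) (n≡ : n ≡ m + b) (a≢b : a ≢ b) (a+b≤ : a + b ≤ 3 * n) where
    private
      module Sp = Split split
    open Sp using (q; r; s; t)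

    private
      1≤qr : 1 ≤ q * r
      1≤qr = subst (1 ≤_) Sp.c≡ 1≤c
      1≤q : 1 ≤ q
      1≤q = 1≤-*ˡ r 1≤qr
      1≤r : 1 ≤ r
      1≤r = 1≤-*ʳ q 1≤qr
      1≤st : 1 ≤ s * t
      1≤st = subst (1 ≤_) Sp.D≡ 1≤D
      1≤s : 1 ≤ s
      1≤s = 1≤-*ˡ t 1≤st
      1≤t : 1 ≤ t
      1≤t = 1≤-*ʳ s 1≤st

    A B A′ B′ μ l : ℕ
    A = r ^ a * (t * t)
    B = r ^ b * q ^ n
    A′ = q ^ a * (s * s)
    B′ = q ^ b * r ^ n
    μ = ∣ A - B ∣
    l = ∣ A′ - B′ ∣

    square-split : ∀ z w X → X ≡ w * z ^ i → z ^ m * (z ^ a * (w * w)) ≡ X * X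
    square-split z w X refl = begin
      z ^ m * (z ^ a * (w * w))        ≡⟨ sym (*-assoc (z ^ m) (z ^ a) (w * w)) ⟩
      z ^ m * z ^ a * (w * w)          ≡⟨ cong (_* (w * w)) (trans (sym (^-distribˡ-+-* z m a)) (trans (cong (z ^_) (sym 2i≡)) (^-distribˡ-+-* z i i))) ⟩
      z ^ i * z ^ i * (w * w)          ≡⟨ rot (z ^ i) w ⟩
      w * z ^ i * (w * z ^ i)          ∎
      where
      open ≡-Reasoning
      rot : ∀ a b → a * a * (b * b) ≡ b * a * (b * a)
      rot = solve-∀

    power-split : ∀ z w → c ≡ z * w → z ^ m * (z ^ b * w ^ n) ≡ u S
    power-split z w c≡ = trans (sym (*-assoc (z ^ m) (z ^ b) (w ^ n))) (trans (cong (_* w ^ n) (trans (sym (^-distribˡ-+-* z m b)) (cong (z ^_) (sym n≡)))) (trans (sym (^-distribʳ-* z w n)) (cong (_^ n) (sym c≡))))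

    difference-split : ∀ z {P Q X Y} → z ^ m * P ≡ X → z ^ m * Q ≡ Y → z ^ m * ∣ P - Q ∣ ≡ ∣ X - Y ∣
    difference-split z {P} {Q} eP eQ = trans (*-distribˡ-∣-∣ (z ^ m) P Q) (cong₂ ∣_-_∣ eP eQ)

    μl≡ : μ * l ≡ ∣ c ^ a - c ^ b ∣
    μl≡ = *-cancelˡ-≡ (μ * l) _ (c ^ m) {{>-nonZero (1≤^ m 1≤c)}} (begin
      c ^ m * (μ * l)                                    ≡⟨ cong (_* (μ * l)) (trans (cong (_^ m) Sp.c≡) (^-distribʳ-* q r m)) ⟩
      q ^ m * r ^ m * (μ * l)                            ≡⟨ rot (q ^ m) (r ^ m) μ l ⟩
      r ^ m * μ * (q ^ m * l)                            ≡⟨ cong₂ _*_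
          (difference-split r (square-split r t (suc x) Sp.sx≡) (power-split r q (trans Sp.c≡ (*-comm q r))))
          (difference-split q (square-split q s x Sp.x≡) (power-split q r Sp.c≡)) ⟩
      ∣ suc x * suc x - u S ∣ * ∣ x * x - u S ∣          ≡⟨ product-of-differences ⟩
      ∣ v * v - u S ∣                                    ≡⟨ cong₂ ∣_-_∣ (trans (sym (^-distribˡ-+-* c i i)) (trans (cong (c ^_) 2i≡) (^-distribˡ-+-* c m a))) (trans (cong (c ^_) n≡) (^-distribˡ-+-* c m b)) ⟩
      ∣ c ^ m * c ^ a - c ^ m * c ^ b ∣                  ≡⟨ sym (*-distribˡ-∣-∣ (c ^ m) (c ^ a) (c ^ b)) ⟩
      c ^ m * ∣ c ^ a - c ^ b ∣                          ∎)
      where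
      open ≡-Reasoning
      rot : ∀ a b c d → a * b * (c * d) ≡ b * c * (a * d)
      rot = solve-∀

    1≤μl : 1 ≤ μ * l
    1≤μl = subst (1 ≤_) (sym μl≡) (n≢0⇒n>0 λ e → [ (λ h → <⇒≢ (^-monoʳ-< c 2≤c h) (∣m-n∣≡0⇒m≡n e)) , (λ h → <⇒≢ (^-monoʳ-< c 2≤c h) (sym (∣m-n∣≡0⇒m≡n e))) ]′ (≢⇒<⊎> a≢b))
      where
      ≢⇒<⊎> : ∀ {p q} → p ≢ q → p < q ⊎ q < p
      ≢⇒<⊎> {p} {q} ne with <-cmp p q
      ... | tri< h _ _ = inj₁ h
      ... | tri≈ _ h _ = ⊥-elim (ne h)
      ... | tri> _ _ h = inj₂ h

    μl≤ : μ * l ≤ c ^ (a + b)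
    μl≤ = ≤-trans (≤-reflexive μl≡) (≤-trans (∣m-n∣≤m⊔n (c ^ a) (c ^ b)) (⊔-lub (^-monoʳ-≤ c {{>-nonZero 1≤c}} (m≤m+n a b)) (^-monoʳ-≤ c {{>-nonZero 1≤c}} (m≤n+m b a))))

    abc-bound : ∀ P Q w → 1 ≤ P → 1 ≤ Q → 1 ≤ w → 1 ≤ ∣ P - Q ∣ → P ⊑ c * w → Q ⊑ c * w →
      N * L P ≤ (N + 1) * (α + L w + 1 + L ∣ P - Q ∣ + 1) + N * κ
    abc-bound P Q w 1≤P 1≤Q 1≤w 1≤δ fP fQ = ≤-trans
      (proj₁ (abc P Q (c * w) 1≤P 1≤Q (1≤* 1≤c 1≤w) (λ e → <⇒≢ 1≤δ (sym (m≡n⇒∣m-n∣≡0 e))) fP fQ))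
      (+-monoˡ-≤ (N * κ) (*-monoʳ-≤ (N + 1) (≤-trans (L-*-≤ (1≤* 1≤c 1≤w) 1≤δ) (+-monoˡ-≤ 1 (+-monoˡ-≤ (L ∣ P - Q ∣) (L-*-≤ 1≤c 1≤w))))))

    private
      ⊑cw : ∀ z {w} → z ∣ c → z ⊑ c * w
      ⊑cw z {w} h = ⊑-*ʳ w (∣⇒⊑ h)
      w⊑cw : ∀ w → w ⊑ c * w
      w⊑cw w = ∣⇒⊑ (n∣m*n c)
      q∣c : q ∣ c
      q∣c = subst (q ∣_) (sym Sp.c≡) (m∣m*n r)
      r∣c : r ∣ c
      r∣c = subst (r ∣_) (sym Sp.c≡) (n∣m*n q)
      1≤μ : 1 ≤ μ
      1≤μ = 1≤-*ˡ l 1≤μl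
      1≤l : 1 ≤ l
      1≤l = 1≤-*ʳ μ 1≤μl
      1≤A : 1 ≤ A
      1≤A = 1≤* (1≤^ a 1≤r) (1≤* 1≤t 1≤t)
      1≤A′ : 1 ≤ A′
      1≤A′ = 1≤* (1≤^ a 1≤q) (1≤* 1≤s 1≤s)

    -- ABC for (A , B) and for (A′ , B′), multiplied: A * A′ = c ^ a * D ^ 2, the radicals
    -- contribute c ^ 2 * s * t = c ^ 2 * D, and the differences at most c ^ (a + b). So D is at
    -- most about c ^ (2 + b).
    step₃ : 50 * k ≤ 50 * (2 + b) + n
    step₃ = arith-50 N n k (2 + b) 1000≤N (cancel-α N k (2 + b) n α 1≤α
      (arith-a₄ N κ n k α a b (L D) 1≤N big N≤α 3≤n k≤n a+b≤
        (arith-a₃ N κ α (L A) (L A′) a b (L s) (L t) (L μ) (L l) (L D)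
          (abc-bound A B t 1≤A (1≤* (1≤^ b 1≤r) (1≤^ n 1≤q)) 1≤t 1≤μ
            (⊑-* (⊑-^ a (⊑cw r r∣c)) (⊑-* (w⊑cw t) (w⊑cw t))) (⊑-* (⊑-^ b (⊑cw r r∣c)) (⊑-^ n (⊑cw q q∣c))))
          (abc-bound A′ B′ s 1≤A′ (1≤* (1≤^ b 1≤q) (1≤^ n 1≤r)) 1≤s 1≤l
            (⊑-* (⊑-^ a (⊑cw q q∣c)) (⊑-* (w⊑cw s) (w⊑cw s))) (⊑-* (⊑-^ b (⊑cw q q∣c)) (⊑-^ n (⊑cw r r∣c))))
          h₃
          (≤-trans (L-*-≥ 1≤t 1≤s) (≤-reflexive (cong L (trans (*-comm t s) (sym Sp.D≡)))))
          (≤-trans (L-*-≥ 1≤μ 1≤l) (≤-trans (L-mono μl≤) (L-^-≤ (a + b) 1≤c))))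
        LD≤ (≤-trans t≤Lcᵏ Lcᵏ≤)))
      where
      AA′≡ : A * A′ ≡ c ^ a * (D * D)
      AA′≡ = trans (rot (r ^ a) t (q ^ a) s) (sym (cong₂ _*_ (trans (cong (_^ a) Sp.c≡) (^-distribʳ-* q r a)) (cong₂ _*_ Sp.D≡ Sp.D≡)))
        where
        rot : ∀ a b c d → a * (b * b) * (c * (d * d)) ≡ c * a * (d * b * (d * b))
        rot = solve-∀
      h₃ : a * α + (L D + L D) ≤ L A + L A′ + 1
      h₃ = begin
        a * α + (L D + L D)          ≤⟨ +-mono-≤ (L-^-≥ a 1≤c) (L-*-≥ 1≤D 1≤D) ⟩
        L (c ^ a) + L (D * D)        ≤⟨ L-*-≥ (1≤^ a 1≤c) (1≤* 1≤D 1≤D) ⟩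
        L (c ^ a * (D * D))          ≡⟨ cong L (sym AA′≡) ⟩
        L (A * A′)                   ≤⟨ L-*-≤ 1≤A 1≤A′ ⟩
        L A + L A′ + 1               ∎
        where open ≤-Reasoning

  i≢k : i ≢ k
  i≢k i≡k = <⇒≱ 3≤n (≤-reflexive (cong₂ _+_ i≡1 (trans (sym i≡k) i≡1)))
    where
    i≡1 : i ≡ 1
    i≡1 = i⊥k (∣-refl , ∣-reflexive i≡k)

  -- `m` is taken as the smaller of 2 i and n. For i ≤ k this makes b = k - i, so `step₃` says i ≤ 2
  -- up to errors and `step₁` bounds n. For k ≤ i it makes b = 0, so k ≤ 2 up to errors and `step₂`
  -- bounds n.
  n≤6 : n ≤ 6
  n≤6 = go (≤-total i k)
    where
    go : i ≤ k ⊎ k ≤ i → n ≤ 6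
    go (inj₁ i≤k) with m≤n⇒∃[o]m+o≡n i≤k
    ... | δ , eq = subst (λ k → i + k ≤ 6) eq (shape-≥ i δ
        (subst (λ k → 50 * (i + k) ≤ 50 * (2 * i + 2) + (i + k)) (sym eq) step₁)
        (subst (λ k → 50 * k ≤ 50 * (2 + δ) + (i + k)) (sym eq)
          (step₃ (i + i) 0 δ (sym (+-identityʳ (i + i))) n≡ (λ e → i≢k (trans (sym (+-identityʳ i)) (trans (cong (i +_) e) eq)))
            (≤-trans (m≤n+m δ (i + i)) (≤-trans (≤-reflexive (sym n≡)) (m≤m+n n _))))))
      where
      n≡ : n ≡ i + i + δ
      n≡ = trans (cong (i +_) (sym eq)) (sym (+-assoc i i δ))
    go (inj₂ k≤i) with m≤n⇒∃[o]m+o≡n k≤i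
    ... | δ , eq = subst (λ i → i + k ≤ 6) eq (shape-≤ k δ
        (subst (λ i → 50 * (i + k) ≤ 50 * (2 * k + 2) + (i + k)) (sym eq) step₂)
        (subst (λ i → 50 * k ≤ 50 * (2 + 0) + (i + k)) {i} {k + δ} (sym eq)
          (step₃ n δ 0 (trans (cong (i +_) (sym eq)) (sym (+-assoc i k δ))) (sym (+-identityʳ n)) (λ e → i≢k (trans (sym eq) (trans (cong (k +_) e) (+-identityʳ k))))
            (≤-trans (≤-reflexive (+-identityʳ δ)) (≤-trans (m≤n+m δ k) (≤-trans (≤-reflexive eq) (≤-trans i≤n (m≤m+n n _))))))))

-- Exclusion of n ≥ 3 for large pronic d

uniform-bound : ∀ {P : ℕ → ℕ → Set} → (∀ {i C C′} → C ≤ C′ → P i C → P i C′) → (∀ i → ∃ (P i)) →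
  ∀ m → ∃[ C ] ∀ i → i ≤ m → P i C
uniform-bound mono f zero = proj₁ (f 0) , λ { .0 z≤n → proj₂ (f 0) }
uniform-bound {P} mono f (suc m) with uniform-bound {P} mono f m
... | C , h = C + proj₁ (f (suc m)) , λ i i≤ → [ (λ i<1+m → mono (m≤m+n C _) (h i (s≤s⁻¹ i<1+m)))
    , (λ { refl → mono (m≤n+m _ C) (proj₂ (f (suc m))) }) ]′ (m≤n⇒m<n∨m≡n i≤)

FixedShape : ℕ → ℕ → ℕ → Set
FixedShape i k C = 1 ≤ i → 1 ≤ k → Coprime i k → 3 ≤ i + k →
  ∀ c D x → 2 ≤ c → Near (c ^ k) D → c ^ i * D ≡ x * suc x → L c ≤ C

bounded-shapes : ABC → ∀ m → ∃[ C ] ∀ i → i ≤ m → ∀ k → k ≤ m → FixedShape i k C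
bounded-shapes abc m = uniform-bound {λ i C → ∀ k → k ≤ m → FixedShape i k C}
  (λ C≤ h k k≤m a b c d x y z p q r → ≤-trans (h k k≤m a b c d x y z p q r) C≤)
  (λ i → uniform-bound {FixedShape i} (λ C≤ h a b c d x y z p q r → ≤-trans (h a b c d x y z p q r) C≤) (shape i) m) m
  where
  shape : ∀ i k → ∃ (FixedShape i k)
  shape i k with 1 ≤? i | 1 ≤? k | coprime? i k | 3 ≤? i + k
  ... | no ¬p | _ | _ | _ = 0 , λ p → ⊥-elim (¬p p)
  ... | yes _ | no ¬p | _ | _ = 0 , λ _ p → ⊥-elim (¬p p)
  ... | yes _ | yes _ | no ¬p | _ = 0 , λ _ _ p → ⊥-elim (¬p (λ {d} → p {d}))
  ... | yes _ | yes _ | yes _ | no ¬p = 0 , λ _ _ _ p → ⊥-elim (¬p p)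
  ... | yes a | yes b | yes c | yes d = proj₁ fs , λ _ _ _ _ → proj₂ fs
    where fs = fixed-shape abc i k a b c d

m≤L : ∀ {m d} → 2 ^ m ≤ d → m ≤ L d
m≤L {m} h = ≤-trans (m≤L2^m m) (L-mono h)

-- N + 1 is lost between L d and n α + n; twice the threshold of `BigA` makes n α big; and 6 C + 7
-- exceeds what n ≤ 6 and α ≤ C allow.
pronic-exponent : ℕ → ℕ → ℕ
pronic-exponent κ C = N + 1 + (2 * (N * κ + 30 * N * N + 100 * N) + suc (6 * C + 6))

pronic-absurd : ∀ {κ} → ABCLog κ → ∀ C → (∀ i → i ≤ 6 → ∀ k → k ≤ 6 → FixedShape i k C) →
  ∀ {d} → 2 ^ pronic-exponent κ C ≤ d → (S : Sol d) → 3 ≤ Sol.n S → ∀ x → d ≢ x * suc x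
pronic-absurd {κ} abcLog C shapes = absurd
  where
  Z E : ℕ
  Z = N * κ + 30 * N * N + 100 * N
  E = pronic-exponent κ C
  absurd : ∀ {d} → 2 ^ E ≤ d → (S : Sol d) → 3 ≤ Sol.n S → ∀ x → d ≢ x * suc x
  absurd {d} d≥ S 3≤n x d≡x = 1+n≰n (begin
    suc (6 * C + 6)           ≤⟨ m≤n+m _ (2 * Z) ⟩
    2 * Z + suc (6 * C + 6)   ≤⟨ E≤ ⟩
    n * α + n                 ≤⟨ +-mono-≤ (*-mono-≤ n≤6 α≤C) n≤6 ⟩
    6 * C + 6                 ∎)
    where
    open ≤-Reasoning
    open Sol S
    open SolLog S using (α; N≤α)
    Ld≤ : L d ≤ N + 1 + (n * α + n)
    Ld≤ = begin
      L d                      ≤⟨ L-mono (Ordered.d≤ abcLog S S) ⟩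
      L (2 * u S)              ≤⟨ L-*-≤ (s≤s z≤n) (1≤^ n 1≤c) ⟩
      L 2 + L (u S) + 1        ≤⟨ +-monoˡ-≤ 1 (+-mono-≤ (≤-reflexive L2≡N) (L-^-≤ n 1≤c)) ⟩
      N + (n * α + n) + 1      ≡⟨ eq N (n * α + n) ⟩
      N + 1 + (n * α + n)      ∎
      where
      eq : ∀ a b → a + b + 1 ≡ a + 1 + b
      eq = solve-∀
    E≤ : 2 * Z + suc (6 * C + 6) ≤ n * α + n
    E≤ = +-cancelˡ-≤ (N + 1) _ _ (≤-trans (m≤L {E} d≥) Ld≤)
    n≤nα : n ≤ n * α
    n≤nα = m≤m*n n α {{>-nonZero (≤-trans 1≤N N≤α)}}
    big : BigA κ (n * α)
    big = *-cancelˡ-≤ 2 (≤-trans (m≤m+n (2 * Z) _) (≤-trans E≤ (≤-trans (+-monoʳ-≤ (n * α) n≤nα) (≤-reflexive (cong (n * α +_) (sym (+-identityʳ (n * α))))))))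
    n≤6 : n ≤ 6
    n≤6 = Pronic.n≤6 abcLog S x d≡x 3≤n big
    α≤C : α ≤ C
    α≤C = shapes i (≤-trans (m≤m+n i k) n≤6) k (≤-trans (m≤n+m k i) n≤6) 1≤i 1≤k i⊥k 3≤n c D x 2≤c near (trans (sym d≡) d≡x)

pronic-excluded : ABC → ∀ {κ} → ABCLog κ → ∃[ D₀ ] ∀ {d} → D₀ ≤ d → (S : Sol d) → 3 ≤ Sol.n S → ∀ x → d ≢ x * suc x
pronic-excluded abc {κ} abcLog = combine (bounded-shapes abc 6)
  where
  combine : (∃[ C ] ∀ i → i ≤ 6 → ∀ k → k ≤ 6 → FixedShape i k C) → ∃[ D₀ ] ∀ {d} → D₀ ≤ d → (S : Sol d) → 3 ≤ Sol.n S → ∀ x → d ≢ x * suc x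
  combine (C , h) = 2 ^ pronic-exponent κ C , pronic-absurd abcLog C h

-- n = 2 means i = k = 1, so d = c (c ± 1) is pronic. Then x is determined by d, and `u` is x ^ 2 or
-- (x + 1) ^ 2: at most two values. Mixtures of n = 2 and n ≥ 3 are what the pronic case excludes.
no-three-combine : ∀ D₁ D₂ → (∀ {d} → D₁ ≤ d → (a b c : Sol d) → 3 ≤ Sol.n a → 3 ≤ Sol.n b → 3 ≤ Sol.n c → Distinct a b c → ⊥) →
  (∀ {d} → D₂ ≤ d → (S : Sol d) → 3 ≤ Sol.n S → ∀ x → d ≢ x * suc x) →
  ∀ {d} → D₁ + D₂ ≤ d → (a b c : Sol d) → ¬ Distinct a b c
no-three-combine D₁ D₂ three pronic = absurd
  where
  n=2⇒pronic : ∀ {d} (S : Sol d) → ¬ 3 ≤ Sol.n S → ∃[ x ] (d ≡ x * suc x × (u S ≡ x * x ⊎ u S ≡ suc x * suc x))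
  n=2⇒pronic S n≱3 = go (Sol.i S) (Sol.k S) (Sol.1≤i S) (Sol.1≤k S) n≱3 (Sol.near S) (Sol.d≡ S)
    where
    module S = Sol S
    go : ∀ i k {d} → 1 ≤ i → 1 ≤ k → ¬ 3 ≤ i + k → Near (S.c ^ k) S.D → d ≡ S.c ^ i * S.D →
      ∃[ x ] (d ≡ x * suc x × (S.c ^ (i + k) ≡ x * x ⊎ S.c ^ (i + k) ≡ suc x * suc x))
    go 1 1 _ _ _ (inj₁ D≡) d≡ = S.c , trans d≡ (trans (cong (S.c ^ 1 *_) D≡) (cong (λ z → z * suc z) (*-identityʳ S.c))) ,
      inj₁ (cong (S.c *_) (*-identityʳ S.c))
    go 1 1 _ _ _ (inj₂ c≡) d≡ = S.D , trans d≡ (trans (cong (_* S.D) c≡) (*-comm (suc S.D) S.D)) ,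
      inj₂ (cong₂ _*_ (trans (sym (*-identityʳ S.c)) c≡) c≡)
    go (suc (suc i)) k _ (s≤s _) n≱3 _ _ = ⊥-elim (n≱3 (s≤s (s≤s (≤-trans (s≤s z≤n) (m≤n+m k i)))))
    go 1 (suc (suc k)) _ _ n≱3 _ _ = ⊥-elim (n≱3 (s≤s (s≤s (s≤s z≤n))))
  pronic-unique : ∀ x y → x * suc x ≡ y * suc y → x ≡ y
  pronic-unique x y eq with <-cmp x y
  ... | tri≈ _ e _ = e
  ... | tri< h _ _ = ⊥-elim (<⇒≢ (*-mono-< h (s≤s h)) eq)
  ... | tri> _ _ h = ⊥-elim (<⇒≢ (*-mono-< h (s≤s h)) (sym eq))
  two : ∀ {x p q r : ℕ} → p ≡ x * x ⊎ p ≡ suc x * suc x → q ≡ x * x ⊎ q ≡ suc x * suc x → r ≡ x * x ⊎ r ≡ suc x * suc x →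
    p ≢ q × p ≢ r × q ≢ r → ⊥
  two (inj₁ e) (inj₁ f) _ (ne , _) = ne (trans e (sym f))
  two (inj₂ e) (inj₂ f) _ (ne , _) = ne (trans e (sym f))
  two (inj₁ e) (inj₂ _) (inj₁ f) (_ , ne , _) = ne (trans e (sym f))
  two (inj₂ e) (inj₁ _) (inj₂ f) (_ , ne , _) = ne (trans e (sym f))
  two (inj₁ _) (inj₂ e) (inj₂ f) (_ , _ , ne) = ne (trans e (sym f))
  two (inj₂ _) (inj₁ e) (inj₁ f) (_ , _ , ne) = ne (trans e (sym f))
  absurd : ∀ {d} → D₁ + D₂ ≤ d → (a b c : Sol d) → ¬ Distinct a b c
  absurd {d} d≥ a b c dist = go (3 ≤? Sol.n a) (3 ≤? Sol.n b) (3 ≤? Sol.n c)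
    where
    mixed : (X Y : Sol d) → 3 ≤ Sol.n X → ¬ 3 ≤ Sol.n Y → ⊥
    mixed X Y 3≤n n≱3 = pronic (≤-trans (m≤n+m D₂ D₁) d≥) X 3≤n (proj₁ (n=2⇒pronic Y n≱3)) (proj₁ (proj₂ (n=2⇒pronic Y n≱3)))
    go : Dec (3 ≤ Sol.n a) → Dec (3 ≤ Sol.n b) → Dec (3 ≤ Sol.n c) → ⊥
    go (yes p) (yes q) (yes r) = three (≤-trans (m≤m+n D₁ D₂) d≥) a b c p q r dist
    go (yes p) (no q) _ = mixed a b p q
    go (no p) (yes q) _ = mixed b a q p
    go (yes p) _ (no r) = mixed a c p r
    go (no p) (no q) (yes r) = mixed c a r p
    go (no p) (no q) (no r) with n=2⇒pronic a p | n=2⇒pronic b q | n=2⇒pronic c r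
    ... | x , eX , ua | y , eY , ub | z , eZ , uc with pronic-unique y x (trans (sym eY) eX) | pronic-unique z x (trans (sym eZ) eX)
    ... | refl | refl = two {x} ua ub uc dist

no-three : ABC → ∃[ D₀ ] ∀ {d} → D₀ ≤ d → (a b c : Sol d) → ¬ Distinct a b c
no-three abc = combine (ABC-log abc)
  where
  combine : (∃[ κ ] ABCLog κ) → ∃[ D₀ ] ∀ {d} → D₀ ≤ d → (a b c : Sol d) → ¬ Distinct a b c
  combine (κ , abcLog) = combine′ (no-three-n≥3 abcLog) (pronic-excluded abc abcLog)
    where
    combine′ : (∃[ D₁ ] ∀ {d} → D₁ ≤ d → (a b c : Sol d) → 3 ≤ Sol.n a → 3 ≤ Sol.n b → 3 ≤ Sol.n c → Distinct a b c → ⊥) →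
      (∃[ D₂ ] ∀ {d} → D₂ ≤ d → (S : Sol d) → 3 ≤ Sol.n S → ∀ x → d ≢ x * suc x) →
      ∃[ D₀ ] ∀ {d} → D₀ ≤ d → (a b c : Sol d) → ¬ Distinct a b c
    combine′ (D₁ , three) (D₂ , pronic) = D₁ + D₂ , no-three-combine D₁ D₂ three pronic

-- From pairs to solutions

-- Equality of unnormalised fractions avoids the reduction to lowest terms in ℚ, so products of
-- integers carry over directly.
Represents : ℚ → ℤ → Set
Represents q A = ℚ.toℚᵘ q ℚᵘ.≃ mkℚᵘ A 0

represents-* : ∀ {p q A B} → Represents p A → Represents q B → Represents (p ℚ.* q) (A Z.* B)
represents-* {p} {q} f g = ℚᵘP.≃-trans (toℚᵘ-homo-* p q) (ℚᵘP.*-cong f g)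

represents-injective : ∀ {q A B} → Represents q A → Represents q B → A ≡ B
represents-injective {_} {A} {B} f g with ℚᵘP.≃-trans (ℚᵘP.≃-sym f) g
... | *≡* eq = trans (sym (ℤP.*-identityʳ A)) (trans eq (ℤP.*-identityʳ B))

represents-qpow : ∀ a n → Represents (qpow (a ℚ./ 1) n) (a Z.^ n)
represents-qpow a zero = *≡* refl
represents-qpow a (suc n) = represents-* {a ℚ./ 1} {qpow (a ℚ./ 1) n} (toℚᵘ-fromℚᵘ (mkℚᵘ a 0)) (represents-qpow a n)

qinv-inverse : ∀ q → q ≢ 0ℚ → qinv q ℚ.* q ≡ 1ℚ
qinv-inverse q q≢0 with q ℚP.≟ 0ℚ
... | yes q≡0 = ⊥-elim (q≢0 q≡0)
... | no q≢0′ = ℚP.*-inverseˡ q {{ℚ.≢-nonZero q≢0′}}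

qpow≢0 : ∀ a n → 1 ≤ (abs a) → qpow (a ℚ./ 1) n ≢ 0ℚ
qpow≢0 a n 1≤a eq = <⇒≢ (1≤^ n 1≤a) (sym (trans (sym (∣^∣ a n)) (cong abs aⁿ≡0)))
  where
  aⁿ≡0 : a Z.^ n ≡ pos 0
  aⁿ≡0 = represents-injective {qpow (a ℚ./ 1) n} (represents-qpow a n) (toℚᵘ-cong eq)

1-represents : Represents 1ℚ (pos 1)
1-represents = *≡* refl

cancel-inverse : ∀ p q r → r ℚ.* q ≡ 1ℚ → p ℚ.* r ≡ 1ℚ → p ≡ q
cancel-inverse p q r rq≡1 pr≡1 = begin
  p                  ≡⟨ sym (ℚP.*-identityʳ p) ⟩
  p ℚ.* 1ℚ           ≡⟨ cong (p ℚ.*_) (sym rq≡1) ⟩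
  p ℚ.* (r ℚ.* q)    ≡⟨ sym (ℚP.*-assoc p r q) ⟩
  p ℚ.* r ℚ.* q      ≡⟨ cong (ℚ._* q) pr≡1 ⟩
  1ℚ ℚ.* q           ≡⟨ ℚP.*-identityˡ q ⟩
  q                  ∎
  where open ≡-Reasoning

qpow-≡ : ∀ a m b n → qpow (a ℚ./ 1) m ≡ qpow (b ℚ./ 1) n → (abs a) ^ m ≡ (abs b) ^ n
qpow-≡ a m b n eq = trans (sym (∣^∣ a m)) (trans (cong abs (represents-injective {qpow (a ℚ./ 1) m} (represents-qpow a m)
  (subst (λ q → Represents q (b Z.^ n)) (sym eq) (represents-qpow b n)))) (∣^∣ b n))

qpow-*≡1 : ∀ a m b n → qpow (a ℚ./ 1) m ℚ.* qpow (b ℚ./ 1) n ≡ 1ℚ → (abs a) ^ m * (abs b) ^ n ≡ 1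
qpow-*≡1 a m b n eq = trans (sym (cong₂ _*_ (∣^∣ a m) (∣^∣ b n))) (trans (sym (ℤP.abs-* (a Z.^ m) (b Z.^ n)))
  (cong abs (represents-injective {1ℚ} (subst (λ q → Represents q (a Z.^ m Z.* b Z.^ n)) eq
    (represents-* {qpow (a ℚ./ 1) m} {qpow (b ℚ./ 1) n} (represents-qpow a m) (represents-qpow b n))) 1-represents)))

-- For absolute values, exponents of equal sign force one of them to be 1, and opposite signs give
-- an equality of powers; hence positive exponents suffice.
Dependent : ℕ → ℕ → Set
Dependent A B = A ≡ 1 ⊎ B ≡ 1 ⊎ ∃[ e ] ∃[ f ] (1 ≤ e × 1 ≤ f × A ^ e ≡ B ^ f)

^≡1⇒≡1 : ∀ m n → m ^ suc n ≡ 1 → m ≡ 1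
^≡1⇒≡1 m n eq with m^n≡1⇒n≡0∨m≡1 m (suc n) eq
... | inj₂ e = e

product≡1⇒dependent : ∀ A m B n → ¬ (m ≡ 0 × n ≡ 0) → A ^ m * B ^ n ≡ 1 → Dependent A B
product≡1⇒dependent A zero B zero ne _ = ⊥-elim (ne (refl , refl))
product≡1⇒dependent A (suc m) B n _ eq = inj₁ (^≡1⇒≡1 A m (m*n≡1⇒m≡1 (A ^ suc m) (B ^ n) eq))
product≡1⇒dependent A zero B (suc n) _ eq = inj₂ (inj₁ (^≡1⇒≡1 B n (m*n≡1⇒n≡1 1 (B ^ suc n) eq)))

power≡⇒dependent : ∀ A m B n → A ^ m ≡ B ^ suc n → Dependent A B
power≡⇒dependent A zero B n eq = inj₂ (inj₁ (^≡1⇒≡1 B n (sym eq)))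
power≡⇒dependent A (suc m) B n eq = inj₂ (inj₂ (suc m , suc n , s≤s z≤n , s≤s z≤n , eq))

Dependent-sym : ∀ {A B} → Dependent A B → Dependent B A
Dependent-sym (inj₁ e) = inj₂ (inj₁ e)
Dependent-sym (inj₂ (inj₁ e)) = inj₁ e
Dependent-sym (inj₂ (inj₂ (e , f , 1≤e , 1≤f , eq))) = inj₂ (inj₂ (f , e , 1≤f , 1≤e , sym eq))

zpow⇒dependent : ∀ a b → 1 ≤ (abs a) → 1 ≤ (abs b) → ∀ k₁ k₂ → ¬ (k₁ ≡ Z.0ℤ × k₂ ≡ Z.0ℤ) →
  zpow a k₁ ℚ.* zpow b k₂ ≡ 1ℚ → Dependent (abs a) (abs b)
zpow⇒dependent a b 1≤a 1≤b (pos m) (pos n) ne eq =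
  product≡1⇒dependent (abs a) m (abs b) n (λ (p , q) → ne (cong pos p , cong pos q)) (qpow-*≡1 a m b n eq)
zpow⇒dependent a b 1≤a 1≤b (pos m) -[1+ n ] ne eq = power≡⇒dependent (abs a) m (abs b) n (qpow-≡ a m b (suc n)
  (cancel-inverse (qpow (a ℚ./ 1) m) (qpow (b ℚ./ 1) (suc n)) (qinv (qpow (b ℚ./ 1) (suc n))) (qinv-inverse _ (qpow≢0 b (suc n) 1≤b)) eq))
zpow⇒dependent a b 1≤a 1≤b -[1+ m ] (pos n) ne eq = Dependent-sym {abs b} (power≡⇒dependent (abs b) n (abs a) m (qpow-≡ b n a (suc m)
  (cancel-inverse (qpow (b ℚ./ 1) n) (qpow (a ℚ./ 1) (suc m)) (qinv (qpow (a ℚ./ 1) (suc m))) (qinv-inverse _ (qpow≢0 a (suc m) 1≤a))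
    (trans (ℚP.*-comm (qpow (b ℚ./ 1) n) _) eq))))
zpow⇒dependent a b 1≤a 1≤b -[1+ m ] -[1+ n ] ne eq = product≡1⇒dependent (abs a) (suc m) (abs b) (suc n) (λ ())
  (qpow-*≡1 a (suc m) b (suc n) AB≡1)
  where
  A = qpow (a ℚ./ 1) (suc m)
  B = qpow (b ℚ./ 1) (suc n)
  A⁻¹≡B : qinv A ≡ B
  A⁻¹≡B = cancel-inverse (qinv A) B (qinv B) (qinv-inverse B (qpow≢0 b (suc n) 1≤b)) eq
  AB≡1 : A ℚ.* B ≡ 1ℚ
  AB≡1 = trans (ℚP.*-comm A B) (trans (cong (ℚ._* A) (sym A⁻¹≡B)) (qinv-inverse A (qpow≢0 a (suc m) 1≤a)))

≢0⇒1≤∣∣ : ∀ {a} → a ≢ Z.0ℤ → 1 ≤ (abs a)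
≢0⇒1≤∣∣ {a} ne = n≢0⇒n>0 (ne ∘ ℤP.∣i∣≡0⇒i≡0)

MultDep⇒ : ∀ a b → MultDep a b → 1 ≤ (abs a) × 1 ≤ (abs b) × Dependent (abs a) (abs b)
MultDep⇒ a b (ab≢0 , k₁ , k₂ , ne , eq) = 1≤a , 1≤b , zpow⇒dependent a b 1≤a 1≤b k₁ k₂ ne eq
  where
  1≤a = ≢0⇒1≤∣∣ {a} λ e → ab≢0 (trans (cong (Z._* b) e) (ℤP.*-zeroˡ b))
  1≤b = ≢0⇒1≤∣∣ {b} λ e → ab≢0 (trans (cong (a Z.*_) e) (ℤP.*-zeroʳ a))

difference-cases : ∀ a b d → b Z.- a ≡ pos d → (abs b) ≡ (abs a) + d ⊎ (abs a) ≡ (abs b) + d ⊎ (abs a) + (abs b) ≡ d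
difference-cases a b d eq = go a b≡
  where
  b≡ : b ≡ pos d Z.+ a
  b≡ = trans (sym (trans (ℤP.+-assoc b (Z.- a) a) (trans (cong (Z._+_ b) (ℤP.+-inverseˡ a)) (ℤP.+-identityʳ b)))) (cong (Z._+ a) eq)
  go : ∀ a → b ≡ pos d Z.+ a → (abs b) ≡ (abs a) + d ⊎ (abs a) ≡ (abs b) + d ⊎ (abs a) + (abs b) ≡ d
  go (pos m) refl = inj₁ (+-comm d m)
  go -[1+ m ] refl with ≤-total (suc m) d
  ... | inj₁ h = inj₂ (inj₂ (trans (cong (λ z → suc m + abs z) (ℤP.⊖-≥ h)) (m+[n∸m]≡n h)))
  ... | inj₂ h = inj₂ (inj₁ (sym (trans (cong (_+ d) (ℤP.∣⊖∣-≤ h)) (m∸n+n≡m h))))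

mkSol₋ : ∀ {d} c i k → 2 ≤ c → 1 ≤ i → 1 ≤ k → Coprime i k → c ^ (i + k) ≡ c ^ i + d → ∃[ S ] (u {d} S ≡ c ^ (i + k))
mkSol₋ {d} c i k 2≤c 1≤i 1≤k co eq = record
  { c = c ; i = i ; k = k ; D = c ^ k ∸ 1 ; 2≤c = 2≤c ; 1≤i = 1≤i ; 1≤k = 1≤k ; i⊥k = co ; near = inj₂ (sym 1+D)
  ; d≡ = +-cancelˡ-≡ (c ^ i) _ _ (trans (sym eq) (trans (^-distribˡ-+-* c i k) (trans (cong (c ^ i *_) (sym 1+D)) (*-suc (c ^ i) _)))) } , refl
  where
  1+D : suc (c ^ k ∸ 1) ≡ c ^ k
  1+D = m+[n∸m]≡n (1≤^ k (<⇒≤ 2≤c))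

mkSol₊ : ∀ {d} c i k → 2 ≤ c → 1 ≤ i → 1 ≤ k → Coprime i k → c ^ i + c ^ (i + k) ≡ d → ∃[ S ] (u {d} S ≡ c ^ (i + k))
mkSol₊ {d} c i k 2≤c 1≤i 1≤k co eq = record
  { c = c ; i = i ; k = k ; D = suc (c ^ k) ; 2≤c = 2≤c ; 1≤i = 1≤i ; 1≤k = 1≤k ; i⊥k = co ; near = inj₁ refl
  ; d≡ = trans (sym eq) (trans (cong (c ^ i +_) (^-distribˡ-+-* c i k)) (sym (*-suc (c ^ i) (c ^ k)))) } , refl

SolutionFor : ℕ → ℕ → Set
SolutionFor d m = ∃[ S ] (u {d} S ≡ m)

-- `^≡^⇒common-base` writes A = c ^ i and B = c ^ n with i and n coprime. For k = n - i this is the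
-- coprimality of i and k.
ordered-solution : ∀ {d} A B → 1 ≤ A → A ≢ 1 → A < B → ∃[ e ] ∃[ f ] (1 ≤ e × 1 ≤ f × A ^ e ≡ B ^ f) →
  B ≡ A + d ⊎ A + B ≡ d → SolutionFor d B
ordered-solution {d} A B 1≤A A≢1 A<B (e , f , 1≤e , 1≤f , eq)
  with ^≡^⇒common-base e f A B 1≤e 1≤f 1≤A (≤-trans 1≤A (<⇒≤ A<B)) eq
... | c , i , n , 1≤c , 1≤i , _ , A≡ , B≡ , _ , co = build (m≤n⇒∃[o]m+o≡n (<⇒≤ i<n))
  where
  2≤c : 2 ≤ c
  2≤c = ≤∧≢⇒< 1≤c λ { refl → A≢1 (trans A≡ (^-zeroˡ i)) }
  i<n : i < n
  i<n = ≰⇒> λ n≤i → <⇒≱ A<B (subst₂ _≤_ (sym B≡) (sym A≡) (^-monoʳ-≤ c {{>-nonZero 1≤c}} n≤i))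
  build : ∃[ k ] (i + k ≡ n) → B ≡ A + d ⊎ A + B ≡ d → SolutionFor d B
  build (k , i+k≡n) = finish
    where
    B≡′ : B ≡ c ^ (i + k)
    B≡′ = trans B≡ (cong (c ^_) (sym i+k≡n))
    1≤k : 1 ≤ k
    1≤k = +-cancelˡ-< i 0 k (subst₂ _<_ (sym (+-identityʳ i)) (sym i+k≡n) i<n)
    co′ : Coprime i k
    co′ {x} (p , q) = co (p , subst (x ∣_) i+k≡n (∣m∣n⇒∣m+n p q))
    finish : B ≡ A + d ⊎ A + B ≡ d → SolutionFor d B
    finish (inj₁ h) = subst (SolutionFor d) (sym B≡′) (mkSol₋ c i k 2≤c 1≤i 1≤k co′ (trans (sym B≡′) (trans h (cong (_+ d) A≡))))
    finish (inj₂ h) = subst (SolutionFor d) (sym B≡′) (mkSol₊ c i k 2≤c 1≤i 1≤k co′ (trans (cong₂ _+_ (sym A≡) (sym B≡′)) h))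

-- Counting

Pair = ℤ × ℤ

_≟ₚ_ : (z w : Pair) → Dec (z ≡ w)
_≟ₚ_ = ≡-dec Z._≟_ Z._≟_

open import Data.List.Membership.DecPropositional _≟ₚ_ using (_∈?_)

unique-⊆-length : ∀ {A : Set} (xs ys : List A) → Unique xs → (∀ {z} → z ∈ xs → z ∈ ys) → length xs ≤ length ys
unique-⊆-length [] ys _ _ = z≤n
unique-⊆-length {A} (x ∷ xs) ys (x∉ AllPairs.∷ u) sub with ∈-∃++ (sub (here refl))
... | as , bs , refl = begin
    suc (length xs)                       ≤⟨ s≤s (unique-⊆-length xs (as ++ bs) u sub′) ⟩
    suc (length (as ++ bs))               ≡⟨ cong suc (length-++ as) ⟩
    suc (length as + length bs)           ≡⟨ sym (+-suc (length as) (length bs)) ⟩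
    length as + suc (length bs)           ≡⟨ sym (length-++ as) ⟩
    length (as ++ x ∷ bs)                 ∎
  where
  open ≤-Reasoning
  sub′ : ∀ {z} → z ∈ xs → z ∈ as ++ bs
  sub′ {z} z∈xs with ∈-++⁻ as (sub (there z∈xs))
  ... | inj₁ z∈as = ∈-++⁺ˡ z∈as
  ... | inj₂ (here z≡x) = ⊥-elim (All.lookup x∉ z∈xs (sym z≡x))
  ... | inj₂ (there z∈bs) = ∈-++⁺ʳ as z∈bs

module _ (d : ℕ) where
  -- The pairs with a = ±1 or b = ±1, and the one with equal absolute values. Only an upper bound is
  -- sought, so entries may lie outside 𝓜(d); the last one is meant for even d.
  trivial : List Pair
  trivial = (pos 1 , pos d Z.+ pos 1) ∷ (Z.- pos 1 , pos d Z.+ Z.- pos 1) ∷ (pos 1 Z.- pos d , pos 1) ∷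
    (Z.- pos 1 Z.- pos d , Z.- pos 1) ∷ (Z.- pos ⌊ d /2⌋ , pos ⌊ d /2⌋) ∷ []

  -- The only pairs with difference d whose larger absolute value is m.
  pairs : ℕ → List Pair
  pairs m = (pos m Z.- pos d , pos m) ∷ (Z.- pos m , pos d Z.+ Z.- pos m) ∷ []

  module _ (a b : ℤ) (b-a≡d : b Z.- a ≡ pos d) where
    b≡ : b ≡ pos d Z.+ a
    b≡ = trans (sym (trans (ℤP.+-assoc b (Z.- a) a) (trans (cong (Z._+_ b) (ℤP.+-inverseˡ a)) (ℤP.+-identityʳ b)))) (cong (Z._+ a) b-a≡d)

    a≡ : a ≡ b Z.- pos d
    a≡ = sym (trans (cong (λ z → b Z.- z) (sym b-a≡d)) (lem a b))
      where
      lem : ∀ a b → b Z.- (b Z.- a) ≡ a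
      lem = ℤS.solve-∀

    ∣∣-cases : ∀ (z : ℤ) → z ≡ pos (abs z) ⊎ z ≡ Z.- pos (abs z)
    ∣∣-cases (pos n) = inj₁ refl
    ∣∣-cases -[1+ n ] = inj₂ refl

    with-a : ∀ {z} → a ≡ z → (a , b) ≡ (z , pos d Z.+ z)
    with-a refl = cong (a ,_) b≡

    with-b : ∀ {z} → b ≡ z → (a , b) ≡ (z Z.- pos d , z)
    with-b refl = cong (_, b) a≡

    abs-a≡1 : abs a ≡ 1 → (a , b) ∈ trivial
    abs-a≡1 e with ∣∣-cases a
    ... | inj₁ h = here (with-a (trans h (cong pos e)))
    ... | inj₂ h = there (here (with-a (trans h (cong (λ n → Z.- pos n) e))))

    abs-b≡1 : abs b ≡ 1 → (a , b) ∈ trivial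
    abs-b≡1 e with ∣∣-cases b
    ... | inj₁ h = there (there (here (with-b (trans h (cong pos e)))))
    ... | inj₂ h = there (there (there (here (with-b (trans h (cong (λ n → Z.- pos n) e))))))

    b-negative : b ≡ Z.- pos (abs b) → abs a ≡ abs b + d
    b-negative e = trans (cong abs (trans a≡ (trans (cong (Z._- pos d) e) (sym (ℤP.neg-distrib-+ (pos (abs b)) (pos d)))))) (ℤP.∣-i∣≡∣i∣ (pos (abs b + d)))

    a-positive : a ≡ pos (abs a) → abs b ≡ d + abs a
    a-positive e = cong abs (trans b≡ (cong (Z._+_ (pos d)) e))

    larger-b : 1 ≤ d → abs a ≤ abs b → (a , b) ∈ pairs (abs b)
    larger-b 1≤d h with ∣∣-cases b
    ... | inj₁ e = here (with-b e)
    ... | inj₂ e = ⊥-elim (<⇒≱ (subst (abs b <_) (sym (b-negative e)) (m<m+n (abs b) 1≤d)) h)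

    larger-a : 1 ≤ d → abs b ≤ abs a → (a , b) ∈ pairs (abs a)
    larger-a 1≤d h with ∣∣-cases a
    ... | inj₂ e = there (here (with-a e))
    ... | inj₁ e = ⊥-elim (<⇒≱ (subst (abs a <_) (sym (a-positive e)) (m<n+m (abs a) 1≤d)) h)

    opposite : 1 ≤ d → abs a ≡ abs b → (a , b) ∈ trivial
    opposite 1≤d e with ∣∣-cases a | ∣∣-cases b | difference-cases a b d b-a≡d
    ... | inj₁ h | _ | _ = ⊥-elim (<⇒≢ (m<n+m (abs a) 1≤d) (trans e (a-positive h)))
    ... | inj₂ _ | inj₂ h | _ = ⊥-elim (<⇒≢ (m<m+n (abs b) 1≤d) (trans (sym e) (b-negative h)))
    ... | inj₂ _ | inj₁ _ | inj₁ h = ⊥-elim (<⇒≢ (m<m+n (abs a) 1≤d) (trans e h))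
    ... | inj₂ _ | inj₁ _ | inj₂ (inj₁ h) = ⊥-elim (<⇒≢ (m<m+n (abs b) 1≤d) (trans (sym e) h))
    ... | inj₂ ha | inj₁ hb | inj₂ (inj₂ h) = there (there (there (there (here
      (cong₂ _,_ (trans ha (cong (λ n → Z.- pos n) (trans e b≡½))) (trans hb (cong pos b≡½)))))))
      where
      b≡½ : abs b ≡ ⌊ d /2⌋
      b≡½ = trans (n≡⌊n+n/2⌋ (abs b)) (cong ⌊_/2⌋ (trans (cong (_+ abs b) (sym e)) h))

    Classified : Set
    Classified = (a , b) ∈ trivial ⊎ ∃[ S ] ((a , b) ∈ pairs (u {d} S))

    classify-pair : 1 ≤ d → MultDep a b → Classified
    classify-pair 1≤d md = go (MultDep⇒ a b md)
      where
      found : ∀ {m} → SolutionFor d m → (a , b) ∈ pairs m → Classified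
      found (S , refl) h = inj₂ (S , h)
      go : 1 ≤ abs a × 1 ≤ abs b × Dependent (abs a) (abs b) → Classified
      go (_ , _ , inj₁ e) = inj₁ (abs-a≡1 e)
      go (_ , _ , inj₂ (inj₁ e)) = inj₁ (abs-b≡1 e)
      go (1≤a , 1≤b , inj₂ (inj₂ dep@(e , f , 1≤e , 1≤f , eq))) with abs a ≟ 1 | abs b ≟ 1 | <-cmp (abs a) (abs b)
      ... | yes h | _ | _ = inj₁ (abs-a≡1 h)
      ... | no _ | yes h | _ = inj₁ (abs-b≡1 h)
      ... | no _ | no _ | tri≈ _ h _ = inj₁ (opposite 1≤d h)
      ... | no a≢1 | no _ | tri< a<b _ _ = found
        (ordered-solution (abs a) (abs b) 1≤a a≢1 a<b dep (cases (difference-cases a b d b-a≡d))) (larger-b 1≤d (<⇒≤ a<b))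
        where
        cases : abs b ≡ abs a + d ⊎ abs a ≡ abs b + d ⊎ abs a + abs b ≡ d → abs b ≡ abs a + d ⊎ abs a + abs b ≡ d
        cases (inj₁ h) = inj₁ h
        cases (inj₂ (inj₁ h)) = ⊥-elim (<⇒≱ a<b (≤-trans (m≤m+n (abs b) d) (≤-reflexive (sym h))))
        cases (inj₂ (inj₂ h)) = inj₂ h
      ... | no _ | no b≢1 | tri> _ _ b<a = found
        (ordered-solution (abs b) (abs a) 1≤b b≢1 b<a (f , e , 1≤f , 1≤e , sym eq) (cases (difference-cases a b d b-a≡d))) (larger-a 1≤d (<⇒≤ b<a))
        where
        cases : abs b ≡ abs a + d ⊎ abs a ≡ abs b + d ⊎ abs a + abs b ≡ d → abs a ≡ abs b + d ⊎ abs b + abs a ≡ d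
        cases (inj₁ h) = ⊥-elim (<⇒≱ b<a (≤-trans (m≤m+n (abs a) d) (≤-reflexive (sym h))))
        cases (inj₂ (inj₁ h)) = inj₁ h
        cases (inj₂ (inj₂ h)) = inj₂ (trans (+-comm (abs b) (abs a)) h)

  u≤2*d : (S : Sol d) → u S ≤ 2 * d
  u≤2*d S = ≤-trans (u≤d+v S) (+-monoʳ-≤ d (≤-trans (∣⇒≤ {{>-nonZero 1≤d}} v∣d) (≤-reflexive (sym (+-identityʳ d)))))
    where
    open Sol S
    1≤d : 1 ≤ d
    1≤d = subst (1 ≤_) (sym d≡) (1≤* (1≤^ i 1≤c) 1≤D)
    v∣d : c ^ i ∣ d
    v∣d = subst (c ^ i ∣_) (sym d≡) (m∣m*n D)

  pairs-below : ℕ → List Pair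
  pairs-below zero = []
  pairs-below (suc m) = pairs m ++ pairs-below m

  length-pairs-below : ∀ m → length (pairs-below m) ≡ 2 * m
  length-pairs-below zero = refl
  length-pairs-below (suc m) = trans (cong (λ n → suc (suc n)) (length-pairs-below m)) (sym (*-suc 2 m))

  ∈-pairs-below : ∀ {z j} m → j < m → z ∈ pairs j → z ∈ pairs-below m
  ∈-pairs-below {j = j} (suc m) j<1+m h with m≤n⇒m<n∨m≡n (s≤s⁻¹ j<1+m)
  ... | inj₁ j<m = ∈-++⁺ʳ (pairs m) (∈-pairs-below m j<m h)
  ... | inj₂ refl = ∈-++⁺ˡ h

  module _ (1≤d : 1 ≤ d) where
    -- Since u ≤ 2 d, listing the pairs for every m ≤ 2 d covers everything without ABC. The bound
    -- grows with d and serves for d below the threshold.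
    M≤-crude : M≤ (pos d) (5 + 2 * suc (2 * d))
    M≤-crude xs uniq inM = subst (length xs ≤_) (cong (5 +_) (length-pairs-below (suc (2 * d))))
      (unique-⊆-length xs (trivial ++ pairs-below (suc (2 * d))) uniq sub)
      where
      sub : ∀ {z} → z ∈ xs → z ∈ trivial ++ pairs-below (suc (2 * d))
      sub {a , b} z∈xs with All.lookup inM z∈xs
      ... | md , eq with classify-pair a b eq 1≤d md
      ... | inj₁ h = ∈-++⁺ˡ h
      ... | inj₂ (S , h) = ∈-++⁺ʳ trivial (∈-pairs-below (suc (2 * d)) (s≤s (u≤2*d S)) h)

    search : ∀ xs (ys : List Pair) → (∃[ z ] (z ∈ xs × z ∉ ys)) ⊎ (∀ {z} → z ∈ xs → z ∈ ys)
    search xs ys with Any.any? (λ z → ¬? (z ∈? ys)) xs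
    ... | yes p = inj₁ (find p)
    ... | no ¬p = inj₂ λ {z} z∈xs → decidable-stable (z ∈? ys) (All.lookup (¬Any⇒All¬ xs ¬p) z∈xs)

    -- Elements outside the current list are picked one after another. Each supplies a solution with
    -- a new `u`, so a third pick would contradict the hypothesis; the lists have lengths 5, 7 and
    -- 9.
    M≤9 : ((S T U : Sol d) → ¬ Distinct S T U) → M≤ (pos d) 9
    M≤9 no-three xs uniq inM = start (search xs trivial)
      where
      covered : ∀ ys → length ys ≤ 9 → (∀ {z} → z ∈ xs → z ∈ ys) → length xs ≤ 9
      covered ys h sub = ≤-trans (unique-⊆-length xs ys uniq sub) h
      solution : ∀ {z ys} → z ∈ xs → z ∉ trivial ++ ys → ∃[ S ] (z ∈ pairs (u {d} S))
      solution {a , b} z∈xs z∉ with All.lookup inM z∈xs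
      ... | md , eq with classify-pair a b eq 1≤d md
      ... | inj₁ h = ⊥-elim (z∉ (∈-++⁺ˡ h))
      ... | inj₂ s = s
      third : ∀ S T → u S ≢ u T → (∃[ z ] (z ∈ xs × z ∉ trivial ++ pairs (u S) ++ pairs (u T))) ⊎ (∀ {z} → z ∈ xs → z ∈ trivial ++ pairs (u S) ++ pairs (u T)) → length xs ≤ 9
      third S T _ (inj₂ sub) = covered _ ≤-refl sub
      third S T S≢T (inj₁ (z , z∈xs , z∉)) with solution z∈xs z∉
      ... | U , z∈U = ⊥-elim (no-three S T U (S≢T ,
        (λ e → z∉ (∈-++⁺ʳ trivial (∈-++⁺ˡ (subst (λ m → z ∈ pairs m) (sym e) z∈U)))) ,
        (λ e → z∉ (∈-++⁺ʳ trivial (∈-++⁺ʳ (pairs (u S)) (subst (λ m → z ∈ pairs m) (sym e) z∈U))))))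
      second : ∀ S → (∃[ z ] (z ∈ xs × z ∉ trivial ++ pairs (u S))) ⊎ (∀ {z} → z ∈ xs → z ∈ trivial ++ pairs (u S)) → length xs ≤ 9
      second S (inj₂ sub) = covered _ (m≤m+n 7 2) sub
      second S (inj₁ (z , z∈xs , z∉)) with solution z∈xs z∉
      ... | T , z∈T = third S T (λ e → z∉ (∈-++⁺ʳ trivial (subst (λ m → z ∈ pairs m) (sym e) z∈T))) (search xs _)
      start : (∃[ z ] (z ∈ xs × z ∉ trivial)) ⊎ (∀ {z} → z ∈ xs → z ∈ trivial) → length xs ≤ 9
      start (inj₂ sub) = covered trivial (m≤m+n 5 4) sub
      start (inj₁ (z , z∈xs , z∉)) with solution {ys = []} z∈xs z∉
      ... | S , _ = second S (search xs _)

open import Data.Integer using (+_)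

theorem4p8 : ABC →
    (∃[ C₁ ] (1 ≤ C₁ × ((d : ℕ) → 1 ≤ d → M≤ (+ d) C₁)))
    × (∃[ D ] ((d : ℕ) → D ≤ d → 1 ≤ d → M≤ (+ d) 9))
theorem4p8 abc = combine (no-three abc)
  where
  combine : (∃[ D₀ ] ∀ {d} → D₀ ≤ d → (S T U : Sol d) → ¬ Distinct S T U) →
    (∃[ C₁ ] (1 ≤ C₁ × ((d : ℕ) → 1 ≤ d → M≤ (pos d) C₁))) × (∃[ D ] ((d : ℕ) → D ≤ d → 1 ≤ d → M≤ (pos d) 9))
  -- The summand 9 serves d ≥ D₀, and the crude bound evaluated at D₀ serves all d ≤ D₀.
  combine (D₀ , h) = (9 + (5 + 2 * suc (2 * D₀)) , s≤s z≤n , all-d) , D₀ , large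
    where
    large : (d : ℕ) → D₀ ≤ d → 1 ≤ d → M≤ (pos d) 9
    large d D₀≤d 1≤d = M≤9 d 1≤d (h D₀≤d)
    all-d : (d : ℕ) → 1 ≤ d → M≤ (pos d) (9 + (5 + 2 * suc (2 * D₀)))
    all-d d 1≤d xs uniq inM with ≤-total D₀ d
    ... | inj₁ D₀≤d = ≤-trans (large d D₀≤d 1≤d xs uniq inM) (m≤m+n 9 _)
    ... | inj₂ d≤D₀ = ≤-trans (M≤-crude d 1≤d xs uniq inM) (≤-trans (+-monoʳ-≤ 5 (*-monoʳ-≤ 2 (s≤s (*-monoʳ-≤ 2 d≤D₀)))) (m≤n+m _ 9))
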